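{- Let $N\geq 1$ be an integer, and let $f$ and $g$ be (normalised) cuspidal eigenforms on the group $\Gamma_0(N)$ of weights $k_1$ and $k_2$ respectively, with $k_1\neq k_2$. Then there exists a positive integer $n\leq 4(\log(N)+1)^2$ such that $a_n(f)\neq a_n(g)$.
   Context: A cuspidal eigenform of weight $k$ on $\Gamma_0(N)$ is a nonzero cusp form of weight $k$ (with trivial character) on $\Gamma_0(N)\subset \mathrm{SL}_2(\mathbb{Z})$ that is a simultaneous eigenvector of all Hecke operators $T_n$, $n\geq 1$; it is not required to be a newform. $a_n(f)$ denotes the coefficient of $q^n$ in the Fourier expansion $f=\sum_{n\geq 1}a_n(f)q^n$ at the cusp $\infty$, $q=e^{2\pi i z}$. All cuspidal eigenforms are assumed normalised so that $a_1(f)=1$. $\log$ is the natural logarithm. -}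

module Defs where

open import Algebra.Apartness.Bundles using (HeytingCommutativeRing; HeytingField)
open import Algebra.Bundles using (CommutativeRing; RawRing)
import Algebra.Apartness.Properties.HeytingCommutativeRing as HeytingProperties
import Algebra.Definitions.RawSemiring as RawSemiringDefinitions
import Algebra.Properties.Ring as RingProperties
import Algebra.Properties.Semiring.Mult as MultProperties
import Algebra.Solver.Ring as RingSolver
open import Algebra.Solver.Ring.AlmostCommutativeRing
  using (AlmostCommutativeRing; fromCommutativeRing; _-Raw-AlmostCommutative⟶_)
open import Data.Empty using (⊥-elim)
open import Data.Integer.Base as ℤ using (ℤ; +_; -[1+_]; +0; +[1+_])
open import Data.Integer.Divisibility using () renaming (_∣_ to _∣ℤ_)
import Data.Integer.Properties as ℤₚ
open import Data.List.Base
  using (List; map; foldr; filter; concatMap; cartesianProduct; upTo)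
open import Data.Maybe.Base using (Maybe; just; nothing)
open import Data.Nat.Base as ℕ using (ℕ; zero; suc; NonZero; _!)
open import Data.Nat.Coprimality using (coprime?)
import Data.Nat.Properties as ℕₚ
open import Data.Product.Base using (∃; _×_; _,_; proj₁; proj₂)
open import Data.Sum.Base using (_⊎_; inj₁; inj₂; [_,_]′)
open import Function.Base using (_∘_)
open import Level using (Level; _⊔_) renaming (suc to lsuc)
open import Relation.Binary.Core using (Rel)
open import Relation.Binary.PropositionalEquality as ≡ using (_≡_)
open import Relation.Binary.Structures using (IsStrictPartialOrder)
import Relation.Binary.Reasoning.Setoid as SetoidReasoning
open import Relation.Nullary.Decidable using (yes; no; _×-dec_)
open import Relation.Nullary.Negation using (¬_)

-- The real numbers, axiomatised as a Cauchy-complete Archimedean ordered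
-- field.  Classically these axioms determine ℝ up to unique isomorphism.

record RealNumbers (c ℓ₁ ℓ₂ ℓ₃ : Level) : Set (lsuc (c ⊔ ℓ₁ ⊔ ℓ₂ ⊔ ℓ₃)) where
  infix 4 _<_ _≤_
  field
    heytingField : HeytingField c ℓ₁ ℓ₂

  open HeytingField heytingField public
    using (Carrier; _≈_; _#_; _+_; _*_; -_; _-_; 0#; 1#; heytingCommutativeRing)

  commutativeRing : CommutativeRing c ℓ₁
  commutativeRing = HeytingCommutativeRing.commutativeRing heytingCommutativeRing

  open RawSemiringDefinitions
    (RawRing.rawSemiring (CommutativeRing.rawRing commutativeRing))
    public using (_^_) renaming (_×_ to _·_)

  fromℕ : ℕ → Carrier
  fromℕ n = n · 1#

  field
    _<_                  : Rel Carrier ℓ₃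
    isStrictPartialOrder : IsStrictPartialOrder _≈_ _<_
    #⇒<⊎>                : ∀ {x y} → x # y → x < y ⊎ y < x
    <⇒#                  : ∀ {x y} → x < y → x # y
    +-monoˡ-<            : ∀ z {x y} → x < y → x + z < y + z
    *-pos                : ∀ {x y} → 0# < x → 0# < y → 0# < x * y
    archimedean          : ∀ x → ∃ λ n → x < fromℕ n

  _≤_ : Rel Carrier ℓ₃
  x ≤ y = ¬ (y < x)

  -- One-sided bounds suffice, since m and n may be interchanged.
  Cauchy : (ℕ → Carrier) → Set (c ⊔ ℓ₃)
  Cauchy u = ∀ ε → 0# < ε →
    ∃ λ M → ∀ m n → M ℕ.≤ m → M ℕ.≤ n → u m - u n < ε

  ConvergesTo : (ℕ → Carrier) → Carrier → Set (c ⊔ ℓ₃)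
  ConvergesTo u l = ∀ ε → 0# < ε →
    ∃ λ M → ∀ n → M ℕ.≤ n → (u n - l < ε) × (l - u n < ε)

  field
    complete : ∀ u → Cauchy u → ∃ λ l → ConvergesTo u l

module OrderedFieldProperties {c ℓ₁ ℓ₂ ℓ₃} (R : RealNumbers c ℓ₁ ℓ₂ ℓ₃) where

  open RealNumbers R public
  open CommutativeRing commutativeRing public
    using ( refl; sym; trans; reflexive; setoid; ring; semiring; +-abelianGroup
          ; +-cong; +-congˡ; +-congʳ; *-cong; *-congˡ; *-congʳ; -‿cong
          ; +-identityˡ; +-identityʳ; *-identityˡ; *-identityʳ; +-comm; +-assoc
          ; *-comm; *-assoc; zeroˡ; zeroʳ; -‿inverseʳ; -‿inverseˡ )
  open HeytingField heytingField public
    using (#-sym; #-cotrans; #⇒invertible; invertible⇒#; tight)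
  open HeytingProperties heytingCommutativeRing public
    using (1#0; #-congʳ; #-congˡ; x-0≈x; invertibleʳ⇒#)
  open RingProperties ring public
    using (-‿distribˡ-*; -‿distribʳ-*; -‿involutive; -0#≈0#; -‿+-comm)
  open MultProperties semiring public using (×-homo-+; ×-assoc-*; ×1-homo-*)
  open IsStrictPartialOrder isStrictPartialOrder public
    using (<-respˡ-≈; <-respʳ-≈; <-resp-≈)
    renaming (irrefl to <-irrefl; trans to <-trans; asym to <-asym)

  fromℤ : ℤ → Carrier
  fromℤ (+ n)    = fromℕ n
  fromℤ -[1+ n ] = - fromℕ (suc n)

  abstract
    fromℤ-⊖ : ∀ m n → fromℤ (m ℤ.⊖ n) ≈ fromℕ m - fromℕ n
    fromℤ-⊖ zero    zero    = sym (-‿inverseʳ 0#)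
    fromℤ-⊖ zero    (suc n) = sym (+-identityˡ _)
    fromℤ-⊖ (suc m) zero    = sym (x-0≈x _)
    fromℤ-⊖ (suc m) (suc n) = begin
      fromℤ (suc m ℤ.⊖ suc n)               ≡⟨ ≡.cong fromℤ (ℤₚ.[1+m]⊖[1+n]≡m⊖n m n) ⟩
      fromℤ (m ℤ.⊖ n)                       ≈⟨ fromℤ-⊖ m n ⟩
      fromℕ m - fromℕ n                     ≈⟨ +-congʳ (+-identityˡ _) ⟨
      (0# + fromℕ m) - fromℕ n              ≈⟨ +-congʳ (+-congʳ (-‿inverseʳ 1#)) ⟨
      ((1# - 1#) + fromℕ m) - fromℕ n       ≈⟨ +-congʳ (+-assoc _ _ _) ⟩
      (1# + (- 1# + fromℕ m)) - fromℕ n     ≈⟨ +-congʳ (+-congˡ (+-comm _ _)) ⟩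
      (1# + (fromℕ m - 1#)) - fromℕ n       ≈⟨ +-congʳ (+-assoc _ _ _) ⟨
      (fromℕ (suc m) - 1#) - fromℕ n        ≈⟨ +-assoc _ _ _ ⟩
      fromℕ (suc m) + (- 1# - fromℕ n)      ≈⟨ +-congˡ (-‿+-comm _ _) ⟩
      fromℕ (suc m) - fromℕ (suc n)         ∎
      where open SetoidReasoning setoid

    fromℤ-neg : ∀ i → fromℤ (ℤ.- i) ≈ - fromℤ i
    fromℤ-neg +0       = sym -0#≈0#
    fromℤ-neg +[1+ n ] = refl
    fromℤ-neg -[1+ n ] = sym (-‿involutive _)

    fromℤ-+ : ∀ i j → fromℤ (i ℤ.+ j) ≈ fromℤ i + fromℤ j
    fromℤ-+ (+ m)    (+ n)    = ×-homo-+ 1# m n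
    fromℤ-+ (+ m)    -[1+ n ] = fromℤ-⊖ m (suc n)
    fromℤ-+ -[1+ m ] (+ n)    = trans (fromℤ-⊖ n (suc m)) (+-comm _ _)
    fromℤ-+ -[1+ m ] -[1+ n ] = begin
      - fromℕ (suc (suc (m ℕ.+ n)))      ≡⟨ ≡.cong (λ k → - fromℕ (suc k)) (ℕₚ.+-suc m n) ⟨
      - fromℕ (suc m ℕ.+ suc n)          ≈⟨ -‿cong (×-homo-+ 1# (suc m) (suc n)) ⟩
      - (fromℕ (suc m) + fromℕ (suc n))  ≈⟨ -‿+-comm _ _ ⟨
      - fromℕ (suc m) - fromℕ (suc n)    ∎
      where open SetoidReasoning setoid

  private
    fromℤ-*⁺ : ∀ m j → fromℤ (+ m ℤ.* j) ≈ fromℕ m * fromℤ j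
    fromℤ-*⁺ m (+ n)    = trans (reflexive (≡.cong fromℤ (≡.sym (ℤₚ.pos-* m n)))) (×1-homo-* m n)
    fromℤ-*⁺ m -[1+ n ] = begin
      fromℤ (+ m ℤ.* -[1+ n ])        ≡⟨ ≡.cong fromℤ (ℤₚ.neg-distribʳ-* (+ m) +[1+ n ]) ⟨
      fromℤ (ℤ.- (+ m ℤ.* +[1+ n ]))  ≈⟨ fromℤ-neg (+ m ℤ.* +[1+ n ]) ⟩
      - fromℤ (+ m ℤ.* +[1+ n ])      ≈⟨ -‿cong (fromℤ-*⁺ m +[1+ n ]) ⟩
      - (fromℕ m * fromℕ (suc n))     ≈⟨ -‿distribʳ-* _ _ ⟩
      fromℕ m * - fromℕ (suc n)       ∎
      where open SetoidReasoning setoid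

  abstract
    fromℤ-* : ∀ i j → fromℤ (i ℤ.* j) ≈ fromℤ i * fromℤ j
    fromℤ-* (+ m)    j = fromℤ-*⁺ m j
    fromℤ-* -[1+ m ] j = begin
      fromℤ (-[1+ m ] ℤ.* j)        ≡⟨ ≡.cong fromℤ (ℤₚ.neg-distribˡ-* +[1+ m ] j) ⟨
      fromℤ (ℤ.- (+[1+ m ] ℤ.* j))  ≈⟨ fromℤ-neg (+[1+ m ] ℤ.* j) ⟩
      - fromℤ (+[1+ m ] ℤ.* j)      ≈⟨ -‿cong (fromℤ-*⁺ (suc m) j) ⟩
      - (fromℕ (suc m) * fromℤ j)   ≈⟨ -‿distribˡ-* _ _ ⟩
      - fromℕ (suc m) * fromℤ j     ∎
      where open SetoidReasoning setoid

  almostCommutativeRing : AlmostCommutativeRing c ℓ₁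
  almostCommutativeRing = fromCommutativeRing commutativeRing

  fromℤ-morphism : ℤ.+-*-rawRing -Raw-AlmostCommutative⟶ almostCommutativeRing
  fromℤ-morphism = record
    { ⟦_⟧    = fromℤ
    ; +-homo = fromℤ-+
    ; *-homo = fromℤ-*
    ; -‿homo = fromℤ-neg
    ; 0-homo = refl
    ; 1-homo = +-identityʳ 1#
    }

  private
    coeff≟ : ∀ i j → Maybe (fromℤ i ≈ fromℤ j)
    coeff≟ i j with i ℤₚ.≟ j
    ... | yes i≡j = just (reflexive (≡.cong fromℤ i≡j))
    ... | no  _   = nothing

  open RingSolver ℤ.+-*-rawRing almostCommutativeRing fromℤ-morphism coeff≟ public
    using (solve; _:=_; _:+_; _:*_; _:-_; :-_; con)

  abstract
    <-cotrans : ∀ {x y} → x < y → ∀ z → x < z ⊎ z < y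
    <-cotrans x<y z with #-cotrans (<⇒# x<y) z
    ... | inj₁ x#z = [ inj₁ , (λ z<x → inj₂ (<-trans z<x x<y)) ]′ (#⇒<⊎> x#z)
    ... | inj₂ z#y = [ inj₂ , (λ y<z → inj₁ (<-trans x<y y<z)) ]′ (#⇒<⊎> z#y)

    <⇒0<- : ∀ {x y} → x < y → 0# < y - x
    <⇒0<- {x} x<y = <-respˡ-≈ (-‿inverseʳ x) (+-monoˡ-< (- x) x<y)

    0<-⇒< : ∀ {x y} → 0# < y - x → x < y
    0<-⇒< {x} {y} p = <-respˡ-≈ (+-identityˡ x)
      (<-respʳ-≈ (solve 2 (λ x y → (y :- x) :+ x := y) refl x y) (+-monoˡ-< x p))

    neg-pos : ∀ {x} → x < 0# → 0# < - x
    neg-pos {x} x<0 = <-respʳ-≈ (+-identityˡ (- x)) (<⇒0<- x<0)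

    sq-pos : ∀ {x} → x # 0# → 0# < x * x
    sq-pos {x} x#0 with #⇒<⊎> x#0
    ... | inj₁ x<0 = <-respʳ-≈ (solve 1 (λ x → (:- x) :* (:- x) := x :* x) refl x)
                       (*-pos (neg-pos x<0) (neg-pos x<0))
    ... | inj₂ 0<x = *-pos 0<x 0<x

    0<1 : 0# < 1#
    0<1 = <-respʳ-≈ (*-identityˡ 1#) (sq-pos 1#0)

    #0-factorʳ : ∀ {x y} → x * y # 0# → y # 0#
    #0-factorʳ {x} {y} xy#0 with #⇒invertible xy#0
    ... | w , _ , xyw≈1 = invertibleʳ⇒# (x * w , trans
      (solve 3 (λ x y w → (y :- con +0) :* (x :* w) := (x :* y :- con +0) :* w) refl x y w)
      xyw≈1)

    ≤-refl : ∀ {x y} → x ≈ y → x ≤ y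
    ≤-refl x≈y y<x = <-irrefl (sym x≈y) y<x

    <⇒≤ : ∀ {x y} → x < y → x ≤ y
    <⇒≤ x<y y<x = <-asym x<y y<x

    ≤-trans : ∀ {x y z} → x ≤ y → y ≤ z → x ≤ z
    ≤-trans {y = y} x≤y y≤z z<x = [ y≤z , x≤y ]′ (<-cotrans z<x y)

    ≤-<-trans : ∀ {x y z} → x ≤ y → y < z → x < z
    ≤-<-trans {x} x≤y y<z = [ (λ y<x → ⊥-elim (x≤y y<x)) , (λ p → p) ]′ (<-cotrans y<z x)

    <-≤-trans : ∀ {x y z} → x < y → y ≤ z → x < z
    <-≤-trans {z = z} x<y y≤z = [ (λ p → p) , (λ z<y → ⊥-elim (y≤z z<y)) ]′ (<-cotrans x<y z)

    ≤⇒0≤- : ∀ {x y} → x ≤ y → 0# ≤ y - x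
    ≤⇒0≤- {x} {y} x≤y p = x≤y (0<-⇒< (<-respʳ-≈
      (solve 2 (λ x y → con +0 :- (y :- x) := x :- y) refl x y) (<⇒0<- p)))

    0≤-⇒≤ : ∀ {x y} → 0# ≤ y - x → x ≤ y
    0≤-⇒≤ {x} {y} p y<x = p (0<-⇒< (<-respʳ-≈
      (solve 2 (λ x y → x :- y := con +0 :- (y :- x)) refl x y) (<⇒0<- y<x)))

    ≤-resp-≈ : ∀ {x x′ y y′} → x ≈ x′ → y ≈ y′ → x ≤ y → x′ ≤ y′
    ≤-resp-≈ x≈x′ y≈y′ x≤y y′<x′ = x≤y (<-respˡ-≈ (sym y≈y′) (<-respʳ-≈ (sym x≈x′) y′<x′))

    0≤-+ : ∀ {x y} → 0# ≤ x → 0# ≤ y → 0# ≤ x + y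
    0≤-+ {x} {y} 0≤x 0≤y x+y<0 = 0≤y (≤-<-trans (0≤-⇒≤ (≤-resp-≈ refl
      (solve 2 (λ x y → x := (x :+ y) :- y) refl x y) 0≤x)) x+y<0)

    0<-+ : ∀ {x y} → 0# < x → 0# ≤ y → 0# < x + y
    0<-+ {x} {y} 0<x 0≤y = <-≤-trans 0<x (0≤-⇒≤ (≤-resp-≈ refl
      (solve 2 (λ x y → y := (x :+ y) :- x) refl x y) 0≤y))

    0<+⇒ : ∀ {x y} → 0# < x + y → 0# < x ⊎ 0# < y
    0<+⇒ {x} {y} p with <-cotrans p x
    ... | inj₁ 0<x = inj₁ 0<x
    ... | inj₂ q   = inj₂ (<-respʳ-≈ (solve 2 (λ x y → (x :+ y) :- x := y) refl x y) (<⇒0<- q))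

    0<*⇒ : ∀ {x y} → 0# ≤ x → 0# < x * y → 0# < x × 0# < y
    0<*⇒ {x} {y} 0≤x p = 0<x , 0<y
      where
      0<x : 0# < x
      0<x with #⇒<⊎> (#0-factorʳ (<⇒-# (<-respʳ-≈ (*-comm x y) p)))
        where
        <⇒-# : ∀ {z} → 0# < z → z # 0#
        <⇒-# q = #-sym (<⇒# q)
      ... | inj₁ x<0 = ⊥-elim (0≤x x<0)
      ... | inj₂ q   = q
      0<y : 0# < y
      0<y with #⇒<⊎> (#0-factorʳ (#-sym (<⇒# p)))
      ... | inj₂ q   = q
      ... | inj₁ y<0 = ⊥-elim (<-asym p (0<-⇒< (<-respʳ-≈
        (solve 2 (λ x y → x :* (:- y) := con +0 :- x :* y) refl x y)
        (*-pos 0<x (neg-pos y<0)))))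

    0≤-* : ∀ {x y} → 0# ≤ x → 0# ≤ y → 0# ≤ x * y
    0≤-* {x} {y} 0≤x 0≤y xy<0 = 0≤y (0<-⇒< (<-respʳ-≈ (sym (+-identityˡ (- y)))
      (proj₂ (0<*⇒ 0≤x (<-respʳ-≈ (-‿distribʳ-* x y) (neg-pos xy<0))))))

    0≤-halve : ∀ {x} → 0# ≤ x + x → 0# ≤ x
    0≤-halve {x} p x<0 = p (<-trans (+-monoˡ-< x x<0) (<-respˡ-≈ (sym (+-identityˡ x)) x<0))

    sq-nonneg : ∀ x → 0# ≤ x * x
    sq-nonneg x x²<0 = <-asym x²<0 (sq-pos (#0-factorʳ (<⇒# x²<0)))

    fromℕ-nonneg : ∀ n → 0# ≤ fromℕ n
    fromℕ-nonneg zero    = ≤-refl refl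
    fromℕ-nonneg (suc n) = 0≤-+ (<⇒≤ 0<1) (fromℕ-nonneg n)

    fromℕ-pos : ∀ n .{{_ : NonZero n}} → 0# < fromℕ n
    fromℕ-pos (suc n) = 0<-+ 0<1 (fromℕ-nonneg n)

    fromℕ-mono : ∀ {m n} → m ℕ.≤ n → fromℕ m ≤ fromℕ n
    fromℕ-mono {m} {n} m≤n = 0≤-⇒≤ (≤-resp-≈ refl eq (fromℕ-nonneg (n ℕ.∸ m)))
      where
      eq : fromℕ (n ℕ.∸ m) ≈ fromℕ n - fromℕ m
      eq = begin
        fromℕ (n ℕ.∸ m)                        ≈⟨ solve 2 (λ x y → x := (y :+ x) :- y) refl _ _ ⟩
        (fromℕ m + fromℕ (n ℕ.∸ m)) - fromℕ m  ≈⟨ +-congʳ (×-homo-+ 1# m (n ℕ.∸ m)) ⟨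
        fromℕ (m ℕ.+ (n ℕ.∸ m)) - fromℕ m      ≡⟨ ≡.cong (λ k → fromℕ k - fromℕ m) (ℕₚ.m+[n∸m]≡n m≤n) ⟩
        fromℕ n - fromℕ m                      ∎
        where open SetoidReasoning setoid

  inverse : ∀ x → 0# < x → Carrier
  inverse x 0<x = proj₁ (#⇒invertible (#-sym (<⇒# 0<x)))

  abstract
    inverse-correct : ∀ x (p : 0# < x) → x * inverse x p ≈ 1#
    inverse-correct x p = trans (*-congʳ (sym (x-0≈x x)))
      (proj₂ (proj₂ (#⇒invertible (#-sym (<⇒# p)))))

    inverse-pos : ∀ x (p : 0# < x) → 0# < inverse x p
    inverse-pos x p = proj₂ (0<*⇒ (<⇒≤ p) (<-respʳ-≈ (sym (inverse-correct x p)) 0<1))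

  1/ : ∀ n .{{_ : NonZero n}} → Carrier
  1/ n = inverse (fromℕ n) (fromℕ-pos n)

  abstract
    1/-correct : ∀ n .{{_ : NonZero n}} → fromℕ n * 1/ n ≈ 1#
    1/-correct n = inverse-correct (fromℕ n) (fromℕ-pos n)

module ComplexNumbers {c ℓ₁ ℓ₂ ℓ₃} (R : RealNumbers c ℓ₁ ℓ₂ ℓ₃) where

  open OrderedFieldProperties R public
    renaming (Carrier to ℝ; _^_ to _^ʳ_)

  infix  4 _≈ᶜ_ _SumsTo_
  infixl 6 _+ᶜ_ _-ᶜ_
  infixl 7 _*ᶜ_

  record ℂ : Set c where
    constructor _+i_
    field
      re im : ℝ

  open ℂ public

  _≈ᶜ_ : Rel ℂ ℓ₁
  z ≈ᶜ w = (re z ≈ re w) × (im z ≈ im w)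

  ofReal : ℝ → ℂ
  ofReal x = x +i 0#

  ofℤ : ℤ → ℂ
  ofℤ = ofReal ∘ fromℤ

  0ᶜ 1ᶜ 𝕚 : ℂ
  0ᶜ = ofReal 0#
  1ᶜ = ofReal 1#
  𝕚  = 0# +i 1#

  _+ᶜ_ _-ᶜ_ _*ᶜ_ : ℂ → ℂ → ℂ
  z +ᶜ w = (re z + re w) +i (im z + im w)
  z -ᶜ w = (re z - re w) +i (im z - im w)
  z *ᶜ w = (re z * re w - im z * im w) +i (re z * im w + im z * re w)

  ℂ-rawRing : RawRing c ℓ₁
  ℂ-rawRing = record
    { _≈_ = _≈ᶜ_
    ; _+_ = _+ᶜ_
    ; _*_ = _*ᶜ_
    ; -_  = λ z → (- re z) +i (- im z)
    ; 0#  = 0ᶜ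
    ; 1#  = 1ᶜ
    }

  open RawSemiringDefinitions (RawRing.rawSemiring ℂ-rawRing) public
    using () renaming (_^_ to _^ᶜ_)

  ∣_∣² : ℂ → ℝ
  ∣ z ∣² = re z * re z + im z * im z

  NonZeroᶜ : ℂ → Set ℓ₃
  NonZeroᶜ z = 0# < ∣ z ∣²

  inverseᶜ : ∀ z → NonZeroᶜ z → ℂ
  inverseᶜ z p = (re z * r) +i (- im z * r)
    where
    r : ℝ
    r = inverse ∣ z ∣² p

  powᶜ : ∀ z → NonZeroᶜ z → ℤ → ℂ
  powᶜ z p (+ n)    = z ^ᶜ n
  powᶜ z p -[1+ n ] = inverseᶜ z p ^ᶜ suc n

  abstract
    nonZero-ofReal : ∀ {x} → 0# < x → NonZeroᶜ (ofReal x)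
    nonZero-ofReal 0<x = 0<-+ (*-pos 0<x 0<x) (sq-nonneg 0#)

    -- A number with a nonzero product (here, nonzero imaginary part of w z̄)
    -- is itself nonzero.
    nonZero-factor : ∀ w z → 0# < im w * re z + re w * (- im z) → NonZeroᶜ z
    nonZero-factor w z p with 0<+⇒ p
    ... | inj₁ q = 0<-+ (sq-pos (#0-factorʳ (#-sym (<⇒# q)))) (sq-nonneg (im z))
    ... | inj₂ q = <-respʳ-≈ (+-comm _ _) (0<-+
      (sq-pos (#0-factorʳ (#-sym (<⇒# (<-respʳ-≈
        (solve 2 (λ a b → a :* (:- b) := (:- a) :* b) refl (re w) (im z)) q)))))
      (sq-nonneg (re z)))

  partialSum : (ℕ → ℂ) → ℕ → ℂ
  partialSum t zero    = 0ᶜ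
  partialSum t (suc n) = partialSum t n +ᶜ t n

  _SumsTo_ : (ℕ → ℂ) → ℂ → Set (c ⊔ ℓ₃)
  t SumsTo s = ∀ ε → 0# < ε →
    ∃ λ M → ∀ n → M ℕ.≤ n → ∣ partialSum t n -ᶜ s ∣² < ε * ε

  expTerm : ℂ → ℕ → ℂ
  expTerm z n = ofReal (1/ (n !) {{n!≢0}}) *ᶜ (z ^ᶜ n)
    where
    n!≢0 : NonZero (n !)
    n!≢0 = ℕₚ._!≢0 n

  module ExpConvergence where

    Bounded : ℝ → ℝ → Set ℓ₃
    Bounded x b = x ≤ b × - x ≤ b

    bounded-* : ∀ {x y a b} → 0# ≤ a → 0# ≤ b → Bounded x a → Bounded y b → Bounded (x * y) (a * b)
    bounded-* {x} {y} {a} {b} 0≤a 0≤b (x≤a , -x≤a) (y≤b , -y≤b) = upper x≤a -x≤a , lower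
      where
      upper : ∀ {x} → x ≤ a → - x ≤ a → x * y ≤ a * b
      upper {x} x≤a -x≤a = 0≤-⇒≤ (0≤-halve (≤-resp-≈ refl
        (solve 4 (λ x y a b →
          (a :- x) :* (b :- (:- y)) :+ (a :- (:- x)) :* (b :- y)
          := (a :* b :- x :* y) :+ (a :* b :- x :* y)) refl x y a b)
        (0≤-+ (0≤-* (≤⇒0≤- x≤a) (≤⇒0≤- -y≤b)) (0≤-* (≤⇒0≤- -x≤a) (≤⇒0≤- y≤b)))))
      lower : - (x * y) ≤ a * b
      lower = ≤-resp-≈ (sym (-‿distribˡ-* x y)) refl
        (upper -x≤a (≤-resp-≈ (sym (-‿involutive x)) refl x≤a))

    +-mono-≤ : ∀ {x y a b} → x ≤ a → y ≤ b → x + y ≤ a + b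
    +-mono-≤ {x} {y} {a} {b} x≤a y≤b = 0≤-⇒≤ (≤-resp-≈ refl
      (solve 4 (λ x y a b → (a :- x) :+ (b :- y) := (a :+ b) :- (x :+ y)) refl x y a b)
      (0≤-+ (≤⇒0≤- x≤a) (≤⇒0≤- y≤b)))

    bounded-+ : ∀ {x y a b} → Bounded x a → Bounded y b → Bounded (x + y) (a + b)
    bounded-+ {x} {y} (p , q) (r , s) = +-mono-≤ p r , ≤-resp-≈ (-‿+-comm x y) refl (+-mono-≤ q s)

    bounded-neg : ∀ {x a} → Bounded x a → Bounded (- x) a
    bounded-neg {x} (p , q) = q , ≤-resp-≈ (sym (-‿involutive x)) refl p

    bounded-resp : ∀ {x y a b} → x ≈ y → a ≈ b → Bounded x a → Bounded y b
    bounded-resp e f (p , q) = ≤-resp-≈ e f p , ≤-resp-≈ (-‿cong e) f q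

    *-monoʳ-< : ∀ {k x y} → 0# < k → x < y → k * x < k * y
    *-monoʳ-< {k} {x} {y} 0<k x<y = 0<-⇒< (<-respʳ-≈
      (solve 3 (λ k x y → k :* (y :- x) := k :* y :- k :* x) refl k x y)
      (*-pos 0<k (<⇒0<- x<y)))

    four* : ∀ x → fromℕ 4 * x ≈ (x + x) + (x + x)
    four* x = trans (×-assoc-* 4 1# x)
      (trans (+-cong e (+-cong e (+-cong e (+-congʳ e))))
        (solve 1 (λ x → x :+ (x :+ (x :+ (x :+ con +0))) := (x :+ x) :+ (x :+ x)) refl x))
      where
      e : 1# * x ≈ x
      e = *-identityˡ x

    *-inverse-cancel : ∀ k x i → k * i ≈ 1# → k * (x * i) ≈ x
    *-inverse-cancel k x i ki≈1 = trans
      (solve 3 (λ k x i → k :* (x :* i) := x :* (k :* i)) refl k x i)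
      (trans (*-congˡ ki≈1) (*-identityʳ x))

    bound : ∀ x → ∃ λ m → Bounded x (fromℕ m)
    bound x = m₁ ℕ.+ m₂
      , ≤-trans (<⇒≤ p₁) (fromℕ-mono (ℕₚ.m≤m+n m₁ m₂))
      , ≤-trans (<⇒≤ p₂) (fromℕ-mono (ℕₚ.m≤n+m m₂ m₁))
      where
      m₁ m₂ : ℕ
      m₁ = proj₁ (archimedean x)
      m₂ = proj₁ (archimedean (- x))
      p₁ : x < fromℕ m₁
      p₁ = proj₂ (archimedean x)
      p₂ : - x < fromℕ m₂
      p₂ = proj₂ (archimedean (- x))

    module Majorised
      (b : ℕ) .{{_ : NonZero b}} (u : ℕ → ℝ) (u-nonneg : ∀ n → 0# ≤ u n)
      (u-step : ∀ n → fromℕ (suc n) * u (suc n) ≈ fromℕ b * u n)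
      where

      K : ℕ
      K = b ℕ.+ b

      halving : ∀ n → K ℕ.≤ n → u (suc n) + u (suc n) ≤ u n
      halving n K≤n lt = ≤-trans bound₁ (≤-refl (u-step n)) bound₂
        where
        v = u (suc n)
        bound₁ : fromℕ b * (v + v) ≤ fromℕ (suc n) * v
        bound₁ = 0≤-⇒≤ (≤-resp-≈ refl
          (trans (*-congʳ (+-congˡ (-‿cong (×-homo-+ 1# b b))))
            (solve 3 (λ b v n → (n :- (b :+ b)) :* v := n :* v :- b :* (v :+ v))
              refl (fromℕ b) v (fromℕ (suc n))))
          (0≤-* (≤⇒0≤- (fromℕ-mono (ℕₚ.m≤n⇒m≤1+n K≤n))) (u-nonneg (suc n))))
        bound₂ : fromℕ b * u n < fromℕ b * (v + v)
        bound₂ = 0<-⇒< (<-respʳ-≈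
          (solve 3 (λ b v w → b :* ((v :+ v) :- w) := b :* (v :+ v) :- b :* w)
            refl (fromℕ b) v (u n))
          (*-pos (fromℕ-pos b) (<⇒0<- lt)))

      decreasing : ∀ j → u (K ℕ.+ j) ≤ u K
      decreasing zero    = ≤-refl (reflexive (≡.cong u (ℕₚ.+-identityʳ K)))
      decreasing (suc j) = ≤-trans (≤-trans step (halving (K ℕ.+ j) (ℕₚ.m≤m+n K j)))
        (decreasing j)
        where
        e : u (suc (K ℕ.+ j)) ≈ u (K ℕ.+ suc j)
        e = reflexive (≡.cong u (≡.sym (ℕₚ.+-suc K j)))
        step : u (K ℕ.+ suc j) ≤ u (suc (K ℕ.+ j)) + u (suc (K ℕ.+ j))
        step = ≤-resp-≈ (trans (+-identityʳ _) e) refl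
          (+-mono-≤ (≤-refl refl) (u-nonneg (suc (K ℕ.+ j))))

      vanishing : ∀ ε → 0# < ε → ∃ λ n → K ℕ.≤ n × u n < ε
      vanishing ε 0<ε = suc N , ℕₚ.m≤n⇒m≤1+n (ℕₚ.m≤m+n K m) , u<ε
        where
        D : ℝ
        D = fromℕ b * u K
        m N : ℕ
        m = proj₁ (archimedean (D * inverse ε 0<ε))
        N = K ℕ.+ m
        D<mε : D < fromℕ m * ε
        D<mε = 0<-⇒< (<-respʳ-≈ eq (*-pos 0<ε (<⇒0<- (proj₂ (archimedean (D * inverse ε 0<ε))))))
          where
          eq : ε * (fromℕ m - D * inverse ε 0<ε) ≈ fromℕ m * ε - D
          eq = trans (solve 4 (λ e m d i → e :* (m :- d :* i) := m :* e :- d :* (e :* i))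
                       refl ε (fromℕ m) D (inverse ε 0<ε))
                 (+-congˡ (-‿cong (trans (*-congˡ (inverse-correct ε 0<ε)) (*-identityʳ D))))
        upper : fromℕ (suc N) * u (suc N) ≤ D
        upper = ≤-resp-≈ (sym (u-step N)) refl (0≤-⇒≤ (≤-resp-≈ refl
          (solve 3 (λ b x y → b :* (x :- y) := b :* x :- b :* y) refl (fromℕ b) (u K) (u N))
          (0≤-* (fromℕ-nonneg b) (≤⇒0≤- (decreasing m)))))
        lower : fromℕ m * ε ≤ fromℕ (suc N) * ε
        lower = 0≤-⇒≤ (≤-resp-≈ refl
          (solve 3 (λ n m e → (n :- m) :* e := n :* e :- m :* e) refl (fromℕ (suc N)) (fromℕ m) ε)
          (0≤-* (≤⇒0≤- (fromℕ-mono (ℕₚ.m≤n⇒m≤1+n (ℕₚ.m≤n+m m K)))) (<⇒≤ 0<ε)))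
        u<ε : u (suc N) < ε
        u<ε = 0<-⇒< (proj₂ (0<*⇒ (fromℕ-nonneg (suc N)) (<-respʳ-≈
          (solve 3 (λ n e v → n :* e :- n :* v := n :* (e :- v)) refl
            (fromℕ (suc N)) ε (u (suc N)))
          (<⇒0<- (≤-<-trans upper (<-≤-trans D<mε lower))))))

      module Series (t s : ℕ → ℝ) (t-bounded : ∀ n → Bounded (t n) (u n))
                    (s-step : ∀ n → s (suc n) ≈ s n + t n) where

        upperEnvelope : ∀ n → K ℕ.≤ n →
          s (suc n) + (u (suc n) + u (suc n)) ≤ s n + (u n + u n)
        upperEnvelope n K≤n = ≤-trans
          (+-mono-≤ (≤-trans (≤-refl (s-step n)) (+-mono-≤ (≤-refl refl) (proj₁ (t-bounded n))))
                    (halving n K≤n))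
          (≤-refl (+-assoc _ _ _))

        lowerEnvelope : ∀ n → K ℕ.≤ n →
          s n - (u n + u n) ≤ s (suc n) - (u (suc n) + u (suc n))
        lowerEnvelope n K≤n = 0≤-⇒≤ (≤-resp-≈ refl
          (trans (solve 4 (λ s t u v →
              (t :- (:- u)) :+ (u :- (v :+ v)) := (s :+ t :- (v :+ v)) :- (s :- (u :+ u)))
              refl (s n) (t n) (u n) (u (suc n)))
            (+-congʳ (+-congʳ (sym (s-step n)))))
          (0≤-+ (≤⇒0≤- (≤-resp-≈ refl refl -u≤t)) (≤⇒0≤- (halving n K≤n))))
          where
          -u≤t : - u n ≤ t n
          -u≤t = 0≤-⇒≤ (≤-resp-≈ refl
            (solve 2 (λ t u → u :- (:- t) := t :- (:- u)) refl (t n) (u n))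
            (≤⇒0≤- (proj₂ (t-bounded n))))

        upperTail : ∀ n j → K ℕ.≤ n → s (n ℕ.+ j) + (u (n ℕ.+ j) + u (n ℕ.+ j)) ≤ s n + (u n + u n)
        upperTail n zero    K≤n rewrite ℕₚ.+-identityʳ n = ≤-refl refl
        upperTail n (suc j) K≤n rewrite ℕₚ.+-suc n j =
          ≤-trans (upperEnvelope (n ℕ.+ j) (ℕₚ.≤-trans K≤n (ℕₚ.m≤m+n n j))) (upperTail n j K≤n)

        lowerTail : ∀ n j → K ℕ.≤ n → s n - (u n + u n) ≤ s (n ℕ.+ j) - (u (n ℕ.+ j) + u (n ℕ.+ j))
        lowerTail n zero    K≤n rewrite ℕₚ.+-identityʳ n = ≤-refl refl
        lowerTail n (suc j) K≤n rewrite ℕₚ.+-suc n j =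
          ≤-trans (lowerTail n j K≤n) (lowerEnvelope (n ℕ.+ j) (ℕₚ.≤-trans K≤n (ℕₚ.m≤m+n n j)))

        tails : ∀ M m n → K ℕ.≤ M → M ℕ.≤ m → M ℕ.≤ n → s m - s n ≤ (u M + u M) + (u M + u M)
        tails M m n K≤M M≤m M≤n = 0≤-⇒≤ (≤-resp-≈ refl
          (solve 6 (λ sM sm sn uM um un →
              (((sM :+ (uM :+ uM)) :- (sm :+ (um :+ um))) :+ ((sn :- (un :+ un)) :- (sM :- (uM :+ uM))))
                :+ ((um :+ um) :+ (un :+ un))
              := ((uM :+ uM) :+ (uM :+ uM)) :- (sm :- sn))
            refl (s M) (s m) (s n) (u M) (u m) (u n))
          (0≤-+ (0≤-+ (≤⇒0≤- upper) (≤⇒0≤- lower)) (0≤-+ (dbl m) (dbl n))))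
          where
          dbl : ∀ k → 0# ≤ u k + u k
          dbl k = 0≤-+ (u-nonneg k) (u-nonneg k)
          upper : s m + (u m + u m) ≤ s M + (u M + u M)
          upper = ≡.subst (λ k → s k + (u k + u k) ≤ s M + (u M + u M))
            (ℕₚ.m+[n∸m]≡n M≤m) (upperTail M (m ℕ.∸ M) K≤M)
          lower : s M - (u M + u M) ≤ s n - (u n + u n)
          lower = ≡.subst (λ k → s M - (u M + u M) ≤ s k - (u k + u k))
            (ℕₚ.m+[n∸m]≡n M≤n) (lowerTail M (n ℕ.∸ M) K≤M)

        cauchy : Cauchy s
        cauchy ε 0<ε = M , λ m n M≤m M≤n → ≤-<-trans (tails M m n K≤M M≤m M≤n) 4u<ε
          where
          δ : ℝ
          δ = ε * 1/ 4
          0<δ : 0# < δ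
          0<δ = *-pos 0<ε (inverse-pos _ _)
          M : ℕ
          M = proj₁ (vanishing δ 0<δ)
          K≤M : K ℕ.≤ M
          K≤M = proj₁ (proj₂ (vanishing δ 0<δ))
          4δ≈ε : fromℕ 4 * δ ≈ ε
          4δ≈ε = *-inverse-cancel (fromℕ 4) ε (1/ 4) (1/-correct 4)
          4u<ε : (u M + u M) + (u M + u M) < ε
          4u<ε = <-respʳ-≈ 4δ≈ε (<-respˡ-≈ (four* (u M))
            (*-monoʳ-< (fromℕ-pos 4) (proj₂ (proj₂ (vanishing δ 0<δ)))))

      complexSeries-re : ∀ t → (∀ n → Bounded (re (t n)) (u n)) → Cauchy (re ∘ partialSum t)
      complexSeries-re t b = Series.cauchy (re ∘ t) (re ∘ partialSum t) b
        (λ n → refl {x = re (partialSum t (suc n))})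

      complexSeries-im : ∀ t → (∀ n → Bounded (im (t n)) (u n)) → Cauchy (im ∘ partialSum t)
      complexSeries-im t b = Series.cauchy (im ∘ t) (im ∘ partialSum t) b
        (λ n → refl {x = im (partialSum t (suc n))})

    module _ (z : ℂ) where

      private
        X b : ℕ
        X = proj₁ (bound (re z)) ℕ.+ proj₁ (bound (im z))
        b = suc (X ℕ.+ X)

        B : ℝ
        B = fromℕ b

        widen : ∀ {x y y′} → y ≤ y′ → Bounded x y → Bounded x y′
        widen q (r , s) = ≤-trans r q , ≤-trans s q

        re-bounded : Bounded (re z) (fromℕ X)
        re-bounded = widen (fromℕ-mono (ℕₚ.m≤m+n (proj₁ (bound (re z))) (proj₁ (bound (im z))))) (proj₂ (bound (re z)))

        im-bounded : Bounded (im z) (fromℕ X)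
        im-bounded = widen (fromℕ-mono (ℕₚ.m≤n+m (proj₁ (bound (im z))) (proj₁ (bound (re z))))) (proj₂ (bound (im z)))

        pow-nonneg : ∀ n → 0# ≤ B ^ʳ n
        pow-nonneg zero    = <⇒≤ 0<1
        pow-nonneg (suc n) = 0≤-* (fromℕ-nonneg b) (pow-nonneg n)

        X+X≤B : ∀ {x} → 0# ≤ x → fromℕ X * x + fromℕ X * x ≤ B * x
        X+X≤B {x} 0≤x = 0≤-⇒≤ (≤-resp-≈ refl
          (trans (solve 2 (λ a x → x := ((con (+ 1) :+ (a :+ a)) :* x) :- (a :* x :+ a :* x)) refl (fromℕ X) x)
            (+-congʳ (*-congʳ (+-cong (+-identityʳ 1#) (sym (×-homo-+ 1# X X))))))
          0≤x)

        pow-bounded : ∀ n → Bounded (re (z ^ᶜ n)) (B ^ʳ n) × Bounded (im (z ^ᶜ n)) (B ^ʳ n)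
        pow-bounded zero =
          (≤-refl refl , ≤-trans (<⇒≤ (0<-⇒< (<-respʳ-≈
             (solve 1 (λ x → x := con +0 :- (:- x)) refl 1#) 0<1))) (<⇒≤ 0<1)) ,
          (<⇒≤ 0<1 , ≤-trans (≤-refl -0#≈0#) (<⇒≤ 0<1))
        pow-bounded (suc n) =
          widen (X+X≤B (pow-nonneg n))
            (bounded-+ (prod re-bounded p) (bounded-neg (prod im-bounded q))) ,
          widen (X+X≤B (pow-nonneg n))
            (bounded-+ (prod re-bounded q) (prod im-bounded p))
          where
          p = proj₁ (pow-bounded n)
          q = proj₂ (pow-bounded n)
          prod : ∀ {x y} → Bounded x (fromℕ X) → Bounded y (B ^ʳ n) → Bounded (x * y) (fromℕ X * B ^ʳ n)
          prod = bounded-* (fromℕ-nonneg X) (pow-nonneg n)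

        1/! : ℕ → ℝ
        1/! n = 1/ (n !) {{ℕₚ._!≢0 n}}

        1/!-nonneg : ∀ n → 0# ≤ 1/! n
        1/!-nonneg n = <⇒≤ (inverse-pos _ _)

        1/!-step : ∀ n → fromℕ (suc n) * 1/! (suc n) ≈ 1/! n
        1/!-step n = begin
          s * i′                        ≈⟨ *-identityʳ _ ⟨
          (s * i′) * 1#                 ≈⟨ *-congˡ (1/-correct (n !) {{ℕₚ._!≢0 n}}) ⟨
          (s * i′) * (f * 1/! n)        ≈⟨ solve 4 (λ s i f j → (s :* i) :* (f :* j) := ((s :* f) :* i) :* j) refl s i′ f (1/! n) ⟩
          ((s * f) * i′) * 1/! n        ≈⟨ *-congʳ (*-congʳ (×1-homo-* (suc n) (n !))) ⟨
          (fromℕ (suc n !) * i′) * 1/! n ≈⟨ *-congʳ (1/-correct (suc n !) {{ℕₚ._!≢0 (suc n)}}) ⟩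
          1# * 1/! n                    ≈⟨ *-identityˡ _ ⟩
          1/! n                         ∎
          where
          open SetoidReasoning setoid
          s  = fromℕ (suc n)
          f  = fromℕ (n !)
          i′ = 1/! (suc n)

        u : ℕ → ℝ
        u n = 1/! n * B ^ʳ n

        u-step : ∀ n → fromℕ (suc n) * u (suc n) ≈ B * u n
        u-step n = trans
          (solve 4 (λ s i b p → s :* (i :* (b :* p)) := b :* ((s :* i) :* p)) refl
            (fromℕ (suc n)) (1/! (suc n)) B (B ^ʳ n))
          (*-congˡ (*-congʳ (1/!-step n)))

        scaled : ∀ n {x} → Bounded x (B ^ʳ n) → Bounded (1/! n * x) (u n)
        scaled n = bounded-* (1/!-nonneg n) (pow-nonneg n)
          (≤-refl refl , ≤-trans (0≤-⇒≤ (≤-resp-≈ refl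
            (solve 1 (λ x → x := con +0 :- (:- x)) refl (1/! n)) (1/!-nonneg n))) (1/!-nonneg n))

        re-term : ∀ n → Bounded (re (expTerm z n)) (u n)
        re-term n = bounded-resp
          (solve 3 (λ a x y → a :* x := a :* x :- con +0 :* y) refl
            (1/! n) (re (z ^ᶜ n)) (im (z ^ᶜ n))) refl
          (scaled n (proj₁ (pow-bounded n)))

        im-term : ∀ n → Bounded (im (expTerm z n)) (u n)
        im-term n = bounded-resp
          (solve 3 (λ a x y → a :* y := a :* y :+ con +0 :* x) refl
            (1/! n) (re (z ^ᶜ n)) (im (z ^ᶜ n))) refl
          (scaled n (proj₂ (pow-bounded n)))

        module M = Majorised b u (λ n → 0≤-* (1/!-nonneg n) (pow-nonneg n)) u-step

      abstract
        re-cauchy : Cauchy (re ∘ partialSum (expTerm z))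
        re-cauchy = M.complexSeries-re (expTerm z) re-term

        im-cauchy : Cauchy (im ∘ partialSum (expTerm z))
        im-cauchy = M.complexSeries-im (expTerm z) im-term

  exp : ℂ → ℂ
  exp z = proj₁ (complete (re ∘ partialSum (expTerm z)) (ExpConvergence.re-cauchy z))
       +i proj₁ (complete (im ∘ partialSum (expTerm z)) (ExpConvergence.im-cauchy z))

  sin : ℝ → ℝ
  sin x = im (exp (𝕚 *ᶜ ofReal x))

  record IsPi (π : ℝ) : Set (c ⊔ ℓ₁ ⊔ ℓ₃) where
    field
      positive : 0# < π
      sinπ≈0   : sin π ≈ 0#
      least    : ∀ x → 0# < x → x < π → ¬ (sin x ≈ 0#)

  -- y is the natural logarithm of x.
  IsLog : ℝ → ℝ → Set ℓ₁
  IsLog x y = exp (ofReal y) ≈ᶜ ofReal x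

module ModularForms {ℓ ℓ₁ ℓ₂ ℓ₃} (R : RealNumbers ℓ ℓ₁ ℓ₂ ℓ₃) where

  open ComplexNumbers R public

  record ℍ : Set (ℓ ⊔ ℓ₃) where
    constructor _,_
    field
      point : ℂ
      im>0  : 0# < im point

  open ℍ public

  record M₂⁺ : Set where
    field
      a b c d : ℤ

    det : ℤ
    det = a ℤ.* d ℤ.- b ℤ.* c

    field
      det>0 : ℤ.0ℤ ℤ.< det

  open M₂⁺ using (det)

  numerator denominator : M₂⁺ → ℍ → ℂ
  numerator   γ z = ofℤ (M₂⁺.a γ) *ᶜ point z +ᶜ ofℤ (M₂⁺.b γ)
  denominator γ z = ofℤ (M₂⁺.c γ) *ᶜ point z +ᶜ ofℤ (M₂⁺.d γ)

  abstract
    fromℤ-pos : ∀ {i} → ℤ.0ℤ ℤ.< i → 0# < fromℤ i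
    fromℤ-pos {+ suc n} _ = fromℕ-pos (suc n)
    fromℤ-pos {+ zero} (ℤ.+<+ ())

    im-quotient : ∀ γ z →
      im (numerator γ z) * re (denominator γ z) + re (numerator γ z) * (- im (denominator γ z))
      ≈ fromℤ (det γ) * im (point z)
    im-quotient γ z = trans
      (solve 6 (λ a b c d x y →
        ((a :* y :+ con +0 :* x) :+ con +0) :* ((c :* x :- con +0 :* y) :+ d)
          :+ ((a :* x :- con +0 :* y) :+ b) :* (:- ((c :* y :+ con +0 :* x) :+ con +0))
        := (a :* d :- b :* c) :* y)
        refl (fromℤ a) (fromℤ b) (fromℤ c) (fromℤ d) (re (point z)) (im (point z)))
      (*-congʳ (sym (trans (fromℤ-+ (a ℤ.* d) (ℤ.- (b ℤ.* c)))
        (+-cong (fromℤ-* a d) (trans (fromℤ-neg (b ℤ.* c)) (-‿cong (fromℤ-* b c)))))))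
      where open M₂⁺ γ

    im-quotient>0 : ∀ γ z →
      0# < im (numerator γ z) * re (denominator γ z) + re (numerator γ z) * (- im (denominator γ z))
    im-quotient>0 γ z = <-respʳ-≈ (sym (im-quotient γ z)) (*-pos (fromℤ-pos (M₂⁺.det>0 γ)) (im>0 z))

    denominator-nonZero : ∀ γ z → NonZeroᶜ (denominator γ z)
    denominator-nonZero γ z = nonZero-factor (numerator γ z) (denominator γ z) (im-quotient>0 γ z)

    det-nonZero : ∀ γ → NonZeroᶜ (ofℤ (det γ))
    det-nonZero γ = nonZero-ofReal (fromℤ-pos (M₂⁺.det>0 γ))

  möbius : M₂⁺ → ℍ → ℂ
  möbius γ z = numerator γ z *ᶜ inverseᶜ (denominator γ z) (denominator-nonZero γ z)

  abstract
    möbius-im>0 : ∀ γ z → 0# < im (möbius γ z)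
    möbius-im>0 γ z = <-respʳ-≈
      (solve 5 (λ p q s t r → (q :* s :+ p :* (:- t)) :* r := p :* ((:- t) :* r) :+ q :* (s :* r)) refl
        (re (numerator γ z)) (im (numerator γ z))
        (re (denominator γ z)) (im (denominator γ z))
        (inverse ∣ denominator γ z ∣² (denominator-nonZero γ z)))
      (*-pos (im-quotient>0 γ z) (inverse-pos ∣ denominator γ z ∣² (denominator-nonZero γ z)))

  _⟨_⟩ : M₂⁺ → ℍ → ℍ
  γ ⟨ z ⟩ = möbius γ z , möbius-im>0 γ z

  -- Normalised by det^(k-1), so that Hecke operators are plain sums of slashes.
  _∣[_]_ : (ℍ → ℂ) → ℤ → M₂⁺ → ℍ → ℂ
  (f ∣[ k ] γ) z =
    powᶜ (ofℤ (det γ)) (det-nonZero γ) (k ℤ.- ℤ.1ℤ)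
    *ᶜ powᶜ (denominator γ z) (denominator-nonZero γ z) (ℤ.- k)
    *ᶜ f (γ ⟨ z ⟩)

  SL₂ : M₂⁺ → Set
  SL₂ γ = det γ ≡ ℤ.1ℤ

  Γ₀ : ℕ → M₂⁺ → Set
  Γ₀ N γ = SL₂ γ × + N ∣ℤ M₂⁺.c γ

  Respects≈ : (ℍ → ℂ) → Set (ℓ ⊔ ℓ₁ ⊔ ℓ₃)
  Respects≈ f = ∀ z w → point z ≈ᶜ point w → f z ≈ᶜ f w

  HasDerivativeAt : (ℍ → ℂ) → ℍ → ℂ → Set (ℓ ⊔ ℓ₃)
  HasDerivativeAt f z f′ = ∀ ε → 0# < ε → ∃ λ δ → 0# < δ × (∀ w →
    ∣ point w -ᶜ point z ∣² < δ * δ →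
    ∣ (f w -ᶜ f z) -ᶜ f′ *ᶜ (point w -ᶜ point z) ∣² ≤ (ε * ε) * ∣ point w -ᶜ point z ∣²)

  Holomorphic : (ℍ → ℂ) → Set (ℓ ⊔ ℓ₃)
  Holomorphic f = ∀ z → ∃ λ f′ → HasDerivativeAt f z f′

  VanishesAt∞ : (ℍ → ℂ) → Set (ℓ ⊔ ℓ₃)
  VanishesAt∞ f = ∀ ε → 0# < ε → ∃ λ A → ∀ z → A < im (point z) → ∣ f z ∣² < ε * ε

  -- As γ runs over SL₂(ℤ), γ∞ runs over all cusps.
  record IsCuspForm (N : ℕ) (k : ℤ) (f : ℍ → ℂ) : Set (ℓ ⊔ ℓ₁ ⊔ ℓ₃) where
    field
      respects≈   : Respects≈ f
      holomorphic : Holomorphic f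
      invariant   : ∀ γ → Γ₀ N γ → ∀ z → (f ∣[ k ] γ) z ≈ᶜ f z
      cuspidal    : ∀ γ → SL₂ γ → VanishesAt∞ (f ∣[ k ] γ)

  upperTriangular : (a b d : ℕ) .{{_ : NonZero a}} .{{_ : NonZero d}} → M₂⁺
  upperTriangular a@(suc _) b d@(suc _) = record
    { a     = + a
    ; b     = + b
    ; c     = ℤ.0ℤ
    ; d     = + d
    ; det>0 = ≡.subst (λ i → ℤ.0ℤ ℤ.< + a ℤ.* + d ℤ.- i) (≡.sym (ℤₚ.*-zeroʳ (+ b))) (ℤ.+<+ (ℕ.s≤s ℕ.z≤n))
    }

  -- Representatives of Γ₀(N)\Δⁿ, where Δⁿ is the set of integer matrices of
  -- determinant n with N ∣ c and gcd(a, N) = 1: the matrices (a b; 0 d) with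
  -- ad = n, gcd(a, N) = 1 and 0 ≤ b < d.  The pair (i , j) stands for
  -- a = 1 + i and d = 1 + j.
  heckeRepresentatives : ℕ → ℕ → List M₂⁺
  heckeRepresentatives N n = concatMap
    (λ (i , j) → map (λ b → upperTriangular (suc i) b (suc j)) (upTo (suc j)))
    (filter (λ (i , j) → (suc i ℕ.* suc j ℕₚ.≟ n) ×-dec coprime? (suc i) N)
      (cartesianProduct (upTo n) (upTo n)))

  T : (N : ℕ) (k : ℤ) (n : ℕ) → (ℍ → ℂ) → ℍ → ℂ
  T N k n f z = foldr _+ᶜ_ 0ᶜ (map (λ γ → (f ∣[ k ] γ) z) (heckeRepresentatives N n))

  record IsCuspidalEigenform (N : ℕ) (k : ℤ) (f : ℍ → ℂ) : Set (ℓ ⊔ ℓ₁ ⊔ ℓ₃) where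
    field
      isCuspForm    : IsCuspForm N k f
      nonzero       : ¬ (∀ z → f z ≈ᶜ 0ᶜ)
      isEigenvector : ∀ n → 1 ℕ.≤ n → ∃ λ μ → ∀ z → T N k n f z ≈ᶜ μ *ᶜ f z

  -- f(z) = Σ_{n ≥ 1} a n qⁿ with q = exp (2πiz); the value a 0 plays no role.
  IsFourierExpansion : ℝ → (ℍ → ℂ) → (ℕ → ℂ) → Set (ℓ ⊔ ℓ₃)
  IsFourierExpansion π f a = ∀ z →
    (λ n → a (suc n) *ᶜ q z ^ᶜ suc n) SumsTo f z
    where
    q : ℍ → ℂ
    q z = exp (ofReal (fromℕ 2 * π) *ᶜ 𝕚 *ᶜ point z)

{-# OPTIONS --safe #-}
-- The least prime p not dividing N already works: n = p or n = p².  Comparing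
-- coefficients in the relation T_p f = μ f gives μ = a_p and
-- a_p² = a_{p²} + p^(k-1); since p^(k₁-1) ≠ p^(k₂-1), the forms differ at p or
-- p².  Only this one Hecke relation is needed.  Along the points i p h, the terms
-- of T_p f have q-expansions in powers of X = e^(-2πh), and coefficients are
-- compared through the uniqueness of expansions up to O(X^(p²+1)); the
-- translates by b < p contribute the factors ζ^(bn), which are 1 at n = p and
-- n = p².
--
-- For the bound put m = p - 2.  Every prime up to m + 1 divides N, so N L² is a
-- common multiple of 1, …, m + 1, where L = lcm(1, …, ⌊√(m+1)⌋).  The integrals
-- ∫₀¹ xⁱ(1-x)ʲ dx with i + j = m show that such a multiple is at least 2ᵐ, and as
-- L is small this yields N² ≥ 3ᵐ ≥ eᵐ, that is p ≤ 2 (log N + 1).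
module Submission where

open import Defs
open import Algebra.Bundles using (CommutativeRing)
import Algebra.Properties.CommutativeSemiring.Exp as CommutativeExpProperties
import Algebra.Properties.Semiring.Exp as ExpProperties
import Algebra.Solver.Ring as RingSolver
open import Algebra.Solver.Ring.AlmostCommutativeRing using (AlmostCommutativeRing; fromCommutativeRing; _-Raw-AlmostCommutative⟶_)
open import Data.Empty using (⊥-elim)
open import Data.Integer.Base as ℤ using (ℤ; +_; +0; +[1+_]; -[1+_])
import Data.Integer.Properties as ℤₚ
import Data.Integer.Solver as ℤSolver
open import Data.List.Base using (List; []; _∷_; _++_; map; foldr; filter; concatMap; cartesianProduct; upTo; applyUpTo)
open import Data.List.Membership.Propositional using (_∈_)
open import Data.List.Membership.Propositional.Properties using (∈-filter⁺; ∈-filter⁻; ∈-cartesianProduct⁺; ∈-upTo⁺)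
open import Data.List.Membership.Propositional.Properties.WithK using (unique∧set⇒bag)
open import Data.List.Properties using (map-++)
open import Data.List.Relation.Binary.BagAndSetEquality using (∼bag⇒↭)
open import Data.List.Relation.Binary.Permutation.Propositional as Permutation using (_↭_)
open import Data.List.Relation.Unary.All using ([]; _∷_)
open import Data.List.Relation.Unary.AllPairs using ([]; _∷_)
open import Data.List.Relation.Unary.Any using (here; there)
import Data.List.Relation.Unary.Unique.Propositional.Properties as Unique
open import Data.Maybe.Base using (Maybe; just; nothing)
open import Data.Nat.Base as ℕ using (ℕ; zero; suc; NonZero; _!)
open import Data.Nat.Coprimality using (Coprime; coprime?)
open import Data.Nat.Divisibility using (_∣_; _∤_; _∣?_; divides; n∣m*n; ∣⇒≤; ∣m+n∣m⇒∣n; ∣1⇒≡1)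
open import Data.Nat.Primality using (Prime; prime⇒irreducible; ¬prime[1])
import Data.Nat.Properties as ℕₚ
open import Data.Product.Base using (∃; _×_; _,_; proj₁; proj₂)
open import Data.Sum.Base using (_⊎_; inj₁; inj₂; [_,_]′)
open import Function.Base using (_∘_)
open import Function.Bundles using (mk⇔)
open import Level using (Level; _⊔_)
open import Relation.Binary.PropositionalEquality as ≡ using (_≡_; _≢_)
import Relation.Binary.Reasoning.Setoid as SetoidReasoning
open import Relation.Nullary.Decidable using (Dec; yes; no; _×-dec_)
open import Relation.Nullary.Negation using (¬_)

-- Squaring 2ᵐ ≤ N L² gives N² ≥ 4ᵐ/L⁴, so the whole slack is the ratio 4/3. It has to pay for L⁴,
-- which grows only like exp(O(√m log m)), already by the crude estimate that L gains at most a
-- factor S when S is reached. This works once ⌊√(m+1)⌋ ≥ 14, that is m ≥ 195; smaller m are settled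
-- by evaluating primorials. The base 3 is an integer between e and 4, so the passage to log N needs
-- no more about e than e ≤ 3. On the analytic side the obstacle is constructivity: equality of
-- reals is not decided. Sizes are therefore bounds on squared absolute values, and distinctness is
-- the positivity of ∣z - w∣², which can be split over a sum. Coefficients are isolated by growth
-- alone: convergence of the Fourier series at z = i bounds every coefficient, and this gives
-- remainder estimates uniform over all points with small nome. The number π is known only through
-- sin π = 0 and its minimality; exp(2πi) = 1 is derived from the addition law and ∣exp(ix)∣ = 1.

-- A bound for the least prime not dividing N.

module PrimeNonDivisors where

  open import Data.Empty using (⊥-elim)
  open import Data.List.Base using ([]; _∷_)
  open import Data.Nat.ListAction using (product)
  open import Data.Nat.ListAction.Properties using (∈⇒∣product)
  open import Data.List.Relation.Unary.All using (All; []; _∷_; lookup; tabulate)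
  open import Data.Nat.Base
  open import Data.Nat.Divisibility
  open import Data.Nat.DivMod using (m≡m%n+[m/n]*n; m%n<n; /-monoˡ-≤; m<n*o⇒m/o<n)
  open import Data.Nat.Induction using (<-rec)
  open import Data.Nat.LCM using (lcm; m∣lcm[m,n]; n∣lcm[m,n]; lcm-least)
  open import Data.Nat.Primality
  open import Data.Nat.Primality.Factorisation using (factorise)
  open import Data.Nat.Properties
  open import Data.Nat.Solver using (module +-*-Solver)
  open import Data.Product.Base using (∃; ∃₂; _×_; _,_; proj₁; proj₂)
  open import Data.Sum.Base using (_⊎_; inj₁; inj₂)
  open import Relation.Binary.PropositionalEquality
  open import Relation.Nullary.Decidable using (yes; no; Dec; toWitness; decidable-stable; map′; _→-dec_; _×-dec_; ¬?)
  open import Relation.Nullary.Negation using (¬_)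
  open import Relation.Unary using (Decidable)
  open +-*-Solver

  least : {P : ℕ → Set} → Decidable P → ∀ n → P n → ∃ λ m → P m × (∀ {k} → k < m → ¬ P k)
  least {P} P? = <-rec _ go
    where
    go : ∀ n → (∀ {k} → k < n → P k → ∃ λ m → P m × (∀ {k} → k < m → ¬ P k)) →
         P n → ∃ λ m → P m × (∀ {k} → k < m → ¬ P k)
    go n rec Pn with anyUpTo? P? n
    ... | yes (k , k<n , Pk) = rec k<n Pk
    ... | no none            = n , Pn , λ k<n Pk → none (_ , k<n , Pk)

  PrimeNonDivisor : ℕ → ℕ → Set
  PrimeNonDivisor N p = Prime p × ¬ (p ∣ N)

  primeNonDivisor? : ∀ N → Decidable (PrimeNonDivisor N)
  primeNonDivisor? N p = prime? p ×-dec ¬? (p ∣? N)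

  -- Any prime factor of `suc N` will do: if it divided `N` as well, it would divide 1. This only
  -- starts the search for the least one.
  primeNonDivisor : ∀ N → 1 ≤ N → ∃ (PrimeNonDivisor N)
  primeNonDivisor N 1≤N with factorise (suc N)
  ... | record { factors = [] ; isFactorisation = eq } =
    ⊥-elim (1+n≰n (subst (1 ≤_) (suc-injective eq) 1≤N))
  ... | record { factors = p ∷ ps ; isFactorisation = eq ; factorsPrime = pp ∷ _ } =
    p , pp , λ p∣N → ¬prime[1] (subst Prime (∣1⇒≡1 (∣m+n∣m⇒∣n (subst (p ∣_) (trans (sym eq) (+-comm 1 N)) (m∣m*n (product ps))) p∣N)) pp)

  CommonMultiple : ℕ → ℕ → Set
  CommonMultiple n M = ∀ m → 1 ≤ m → m ≤ n → m ∣ M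

  -- M i! j! / (i+j+1)! = M ∫₀¹ xⁱ(1-x)ʲ dx is an integer, because expanding
  -- the integrand only produces the denominators 1, …, i+j+1.
  beta-integral : ∀ {n M} → CommonMultiple n M → ∀ i j → i + j < n →
                  ∃ λ v → v * suc (i + j) ! ≡ M * (i ! * j !)
  beta-integral {M = M} cm i zero i+0<n rewrite +-identityʳ i with cm (suc i) (s≤s z≤n) i+0<n
  ... | divides v M≡ = v , trans
    (solve 3 (λ v s f → v :* (s :* f) := (v :* s) :* (f :* con 1)) refl v (suc i) (i !))
    (cong (_* (i ! * 1)) (sym M≡))
  beta-integral {n} {M} cm i (suc j) lt
    with beta-integral cm i j (<-trans (subst (i + j <_) (sym (+-suc i j)) ≤-refl) lt)
       | beta-integral cm (suc i) j (subst (_< n) (+-suc i j) lt)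
  -- xⁱ(1-x)ʲ⁺¹ = xⁱ(1-x)ʲ - xⁱ⁺¹(1-x)ʲ, so the two integers are subtracted. Truncation does no
  -- harm, because `*` distributes over `∸` and the difference is evaluated only after scaling,
  -- where t ∸ (i+1) = j+1.
  ... | v , p | u , q rewrite +-suc i j = v ∸ u , (begin
    (v ∸ u) * (t * F)           ≡⟨ *-distribʳ-∸ (t * F) v u ⟩
    v * (t * F) ∸ u * (t * F)   ≡⟨ cong₂ _∸_ p′ q′ ⟩
    t * A ∸ suc i * A           ≡⟨ *-distribʳ-∸ A t (suc i) ⟨
    (t ∸ suc i) * A             ≡⟨ cong (_* A) t∸ ⟩
    suc j * A                   ≡⟨ solve 4 (λ s m a b → s :* (m :* (a :* b)) := m :* (a :* (s :* b))) refl (suc j) M (i !) (j !) ⟩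
    M * (i ! * (suc j) !)       ∎)
    where
    open ≡-Reasoning
    t F A : ℕ
    t = suc (suc (i + j))
    F = suc (i + j) !
    A = M * (i ! * j !)
    p′ : v * (t * F) ≡ t * A
    p′ = trans (solve 3 (λ v t f → v :* (t :* f) := t :* (v :* f)) refl v t F) (cong (t *_) p)
    q′ : u * (t * F) ≡ suc i * A
    q′ = trans q (solve 4 (λ m s a b → m :* ((s :* a) :* b) := s :* (m :* (a :* b))) refl M (suc i) (i !) (j !))
    t∸ : t ∸ suc i ≡ suc j
    t∸ = trans (cong (_∸ i) (sym (+-suc i j))) (m+n∸m≡n i (suc j))

  -- The counterpart of x(1-x) ≤ 1/4 on [0,1]. The two factorials are raised alternately, hence the
  -- mutual induction: each raise costs 2(k+1) on the left, and the new factor of the factorial on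
  -- the right is 2k+2 or 2k+3.
  centralFactorial : ∀ k → 2 ^ (k + k) * (k ! * k !) ≤ suc (k + k) !
  centralFactorial′ : ∀ k → 2 ^ suc (k + k) * (suc k ! * k !) ≤ suc (suc (k + k)) !
  centralFactorial zero    = ≤-refl
  centralFactorial (suc k) rewrite +-suc k k = begin
    2 * P * ((s * k !) * (s * k !))    ≡⟨ solve 3 (λ p s f → (con 2 :* p) :* ((s :* f) :* (s :* f)) := (con 2 :* s) :* (p :* ((s :* f) :* f))) refl P s (k !) ⟩
    (2 * s) * (P * ((s * k !) * k !))  ≤⟨ *-mono-≤ 2s≤ (centralFactorial′ k) ⟩
    suc (suc (suc (k + k))) * suc (suc (k + k)) ! ∎
    where
    open ≤-Reasoning
    P s : ℕ
    P = 2 ^ suc (k + k)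
    s = suc k
    2s≤ : 2 * s ≤ suc (suc (suc (k + k)))
    2s≤ = ≤-trans (≤-reflexive (solve 1 (λ k → con 2 :* (con 1 :+ k) := con 2 :+ (k :+ k)) refl k)) (n≤1+n _)
  centralFactorial′ k = begin
    2 * 2 ^ (k + k) * ((s * k !) * k !)       ≡⟨ solve 3 (λ p s f → (con 2 :* p) :* ((s :* f) :* f) := (con 2 :* s) :* (p :* (f :* f))) refl (2 ^ (k + k)) s (k !) ⟩
    (2 * s) * (2 ^ (k + k) * (k ! * k !))     ≤⟨ *-mono-≤ (≤-reflexive (solve 1 (λ k → con 2 :* (con 1 :+ k) := con 2 :+ (k :+ k)) refl k)) (centralFactorial k) ⟩
    suc (suc (k + k)) * suc (k + k) !         ∎
    where
    open ≤-Reasoning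
    s = suc k

  halve : ∀ m → ∃ λ k → (k + k ≡ m) ⊎ (suc k + k ≡ m)
  halve zero = 0 , inj₁ refl
  halve (suc m) with halve m
  ... | k , inj₁ e = k , inj₂ (cong suc e)
  ... | k , inj₂ e = suc k , inj₁ (trans (+-suc (suc k) k) (cong suc e))

  balancedFactorials : ∀ m → ∃₂ λ i j → i + j ≡ m × 2 ^ m * (i ! * j !) ≤ suc m !
  balancedFactorials m with halve m
  ... | k , inj₁ refl = k , k , refl , centralFactorial k
  ... | k , inj₂ refl = suc k , k , refl , centralFactorial′ k

  -- M times the balanced beta integral is a nonzero natural number, hence at least 1, while the
  -- integral itself is at most 2⁻ᵐ.
  commonMultiple-≥ : ∀ m {M} → .{{NonZero M}} → CommonMultiple (suc m) M → 2 ^ m ≤ M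
  commonMultiple-≥ m {M} {{M≢0}} cm with balancedFactorials m
  ... | i , j , refl , bound with beta-integral cm i j ≤-refl
  ... | zero  , eq = ⊥-elim (≢-nonZero⁻¹ _ {{m*n≢0 M (i ! * j !) {{M≢0}} {{i !* j !≢0}}}} (sym eq))
  ... | suc v , eq = *-cancelʳ-≤ (2 ^ (i + j)) M (i ! * j !) {{i !* j !≢0}} (begin
    2 ^ (i + j) * (i ! * j !)  ≤⟨ bound ⟩
    suc (i + j) !              ≤⟨ m≤m+n _ _ ⟩
    suc v * suc (i + j) !      ≡⟨ eq ⟩
    M * (i ! * j !)            ∎)
    where open ≤-Reasoning

  prime-*-∣ : ∀ {p r N} → Prime p → ¬ (p ∣ r) → p ∣ N → r ∣ N → p * r ∣ N
  prime-*-∣ {r = r} pp p∤r p∣N (divides c refl) with euclidsLemma c r pp p∣N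
  ... | inj₁ p∣c = *-monoˡ-∣ r p∣c
  ... | inj₂ p∣r = ⊥-elim (p∤r p∣r)

  -- The primes are absorbed one at a time. A prime not dividing r enters r, and the product still
  -- divides N by coprimality; a prime already in r leaves it, its two copies becoming one factor of
  -- s.
  squareDecomposition : ∀ {N} ps → All Prime ps → All (_∣ N) ps →
                        ∃₂ λ r s → product ps ≡ r * (s * s) × r ∣ N
  squareDecomposition [] [] [] = 1 , 1 , refl , 1∣ _
  squareDecomposition {N} (p ∷ ps) (pp ∷ pps) (p∣N ∷ ps∣N) with squareDecomposition ps pps ps∣N
  ... | r , s , eq , r∣N with p ∣? r
  ... | yes (divides r′ refl) = r′ , p * s
    , trans (cong (p *_) eq) (solve 3 (λ p r s → p :* ((r :* p) :* (s :* s)) := r :* ((p :* s) :* (p :* s))) refl p r′ s)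
    , ∣-trans (m∣m*n p) r∣N
  ... | no p∤r = p * r , s , trans (cong (p *_) eq) (sym (*-assoc p r (s * s))) , prime-*-∣ pp p∤r p∣N r∣N

  lcmUpTo : ℕ → ℕ
  lcmUpTo zero    = 1
  lcmUpTo (suc n) = lcm (suc n) (lcmUpTo n)

  lcmUpTo-commonMultiple : ∀ n → CommonMultiple n (lcmUpTo n)
  lcmUpTo-commonMultiple zero    m 1≤m m≤0 = ⊥-elim (<⇒≱ 1≤m m≤0)
  lcmUpTo-commonMultiple (suc n) m 1≤m m≤1+n with m≤n⇒m<n∨m≡n m≤1+n
  ... | inj₁ m<1+n = ∣-trans (lcmUpTo-commonMultiple n m 1≤m (s≤s⁻¹ m<1+n)) (n∣lcm[m,n] (suc n) (lcmUpTo n))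
  ... | inj₂ refl  = m∣lcm[m,n] (suc n) (lcmUpTo n)

  lcmUpTo∣! : ∀ n → lcmUpTo n ∣ n !
  lcmUpTo∣! zero    = ∣-refl
  lcmUpTo∣! (suc n) = lcm-least (m∣m*n (n !)) (∣n⇒∣m*n (suc n) (lcmUpTo∣! n))

  lcmUpTo-nonZero : ∀ n → NonZero (lcmUpTo n)
  lcmUpTo-nonZero n = ≢-nonZero λ eq → ≢-nonZero⁻¹ (n !) {{n !≢0}} (0∣⇒≡0 (subst (_∣ n !) eq (lcmUpTo∣! n)))

  lcmUpTo-suc-≤ : ∀ n → lcmUpTo (suc n) ≤ suc n * lcmUpTo n
  lcmUpTo-suc-≤ n = ∣⇒≤ {{m*n≢0 (suc n) (lcmUpTo n) {{_}} {{lcmUpTo-nonZero n}}}}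
    (lcm-least (m∣m*n (lcmUpTo n)) (n∣m*n (suc n)))

  DivisibleByPrimesUpTo : ℕ → ℕ → Set
  DivisibleByPrimesUpTo n N = ∀ q → Prime q → q ≤ n → q ∣ N

  -- Write m = r s² with r ∣ N. Then s² ≤ m < (S+1)², so s ≤ S and s divides `lcmUpTo S`.
  smoothCommonMultiple : ∀ {n N} S → n < suc S * suc S → DivisibleByPrimesUpTo n N →
                         CommonMultiple n (N * (lcmUpTo S * lcmUpTo S))
  smoothCommonMultiple {n} {N} S n<[1+S]² div m@(suc _) 1≤m m≤n with factorise m
  ... | record { factors = ps ; isFactorisation = m≡ ; factorsPrime = pps }
    with squareDecomposition {N} ps pps (tabulate λ q∈ps → let q∣m = subst (_ ∣_) (sym m≡) (∈⇒∣product q∈ps) in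
           div _ (lookup pps q∈ps) (≤-trans (∣⇒≤ q∣m) m≤n))
  ... | r , s , eq , r∣N = subst (_∣ N * (lcmUpTo S * lcmUpTo S)) (sym m≡rs²) (*-pres-∣ r∣N (*-pres-∣ s∣L s∣L))
    where
    m≡rs² : m ≡ r * (s * s)
    m≡rs² = trans m≡ eq
    s≢0 : s ≢ 0
    s≢0 refl = 1+n≢0 (trans m≡rs² (*-zeroʳ r))
    s<1+S : s < suc S
    s<1+S = ≰⇒> λ 1+S≤s → <⇒≱ n<[1+S]² (≤-trans (*-mono-≤ 1+S≤s 1+S≤s)
      (≤-trans (∣⇒≤ (subst (s * s ∣_) (sym m≡rs²) (n∣m*n r))) m≤n))
    s∣L : s ∣ lcmUpTo S
    s∣L = lcmUpTo-commonMultiple S s (n≢0⇒n>0 s≢0) (s≤s⁻¹ s<1+S)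

  floorSqrt : ∀ n → ∃ λ S → S * S ≤ n × n < suc S * suc S
  floorSqrt zero    = 0 , z≤n , s≤s z≤n
  floorSqrt (suc n) with floorSqrt n
  ... | S , S²≤n , n<[1+S]² with m≤n⇒m<n∨m≡n n<[1+S]²
  ... | inj₁ 1+n<[1+S]² = S , m≤n⇒m≤1+n S²≤n , 1+n<[1+S]²
  ... | inj₂ 1+n≡[1+S]² = suc S , ≤-reflexive (sym 1+n≡[1+S]²) ,
    subst (_< suc (suc S) * suc (suc S)) (sym 1+n≡[1+S]²) (*-mono-< (n<1+n (suc S)) (n<1+n (suc S)))

  -- Both sides are squares, of 3(24+j)² and 4(23+j)². The difference of these roots is 388 + 40j +
  -- j², a polynomial without negative coefficients.
  fourthPower-growth : ∀ j → 9 * (24 + j) ^ 4 ≤ 16 * (23 + j) ^ 4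
  fourthPower-growth j = begin
    9 * (24 + j) ^ 4  ≡⟨ solve 1 (λ t → con 9 :* t :^ 4 := (con 3 :* (t :* t)) :* (con 3 :* (t :* t))) refl (24 + j) ⟩
    A * A             ≤⟨ *-mono-≤ {A} {B} {A} {B} A≤B A≤B ⟩
    B * B             ≡⟨ solve 1 (λ t → (con 4 :* (t :* t)) :* (con 4 :* (t :* t)) := con 16 :* t :^ 4) refl (23 + j) ⟩
    16 * (23 + j) ^ 4 ∎
    where
    open ≤-Reasoning
    A B : ℕ
    A = 3 * ((24 + j) * (24 + j))
    B = 4 * ((23 + j) * (23 + j))
    A≤B : A ≤ B
    A≤B = ≤-trans (m≤m+n A (388 + 40 * j + j * j)) (≤-reflexive
      (solve 1 (λ j → con 3 :* ((con 24 :+ j) :* (con 24 :+ j)) :+ (con 388 :+ con 40 :* j :+ j :* j)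
                      := con 4 :* ((con 23 :+ j) :* (con 23 :+ j))) refl j))

  linearExponential : ∀ a b → a * 23 ^ 4 ≤ b → ∀ j → a * (3 ^ 2) ^ j * suc (22 + j) ^ 4 ≤ b * (4 ^ 2) ^ j
  linearExponential a b base zero = ≤-trans (≤-reflexive (cong (_* 23 ^ 4) (*-identityʳ a)))
    (≤-trans base (≤-reflexive (sym (*-identityʳ b))))
  linearExponential a b base (suc j) = begin
    a * (3 ^ 2 * (3 ^ 2) ^ j) * suc (22 + suc j) ^ 4      ≡⟨ solve 3 (λ a e t → a :* (con (3 ^ 2) :* e) :* t := a :* e :* (con 9 :* t)) refl a ((3 ^ 2) ^ j) (suc (22 + suc j) ^ 4) ⟩
    a * (3 ^ 2) ^ j * (9 * suc (22 + suc j) ^ 4)      ≤⟨ *-monoʳ-≤ (a * (3 ^ 2) ^ j) (fourthPower-growth j) ⟩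
    a * (3 ^ 2) ^ j * (16 * suc (22 + j) ^ 4)     ≡⟨ solve 3 (λ a e t → a :* e :* (con 16 :* t) := con 16 :* (a :* e :* t)) refl a ((3 ^ 2) ^ j) (suc (22 + j) ^ 4) ⟩
    16 * (a * (3 ^ 2) ^ j * suc (22 + j) ^ 4)     ≤⟨ *-monoʳ-≤ 16 (linearExponential a b base j) ⟩
    16 * (b * (4 ^ 2) ^ j)                   ≡⟨ solve 2 (λ b e → con 16 :* (b :* e) := b :* (con (4 ^ 2) :* e)) refl b ((4 ^ 2) ^ j) ⟩
    b * (4 ^ 2 * (4 ^ 2) ^ j)                   ∎
    where open ≤-Reasoning

  -- A record, so that comparing two instances never unfolds the powers.
  record LcmSmall (S : ℕ) : Set where
    constructor lcmSmall
    field
      bound : 4 * (3 ^ (S * S) * lcmUpTo S ^ 4) ≤ 3 * 4 ^ (S * S)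

  lcmSmall? : Decidable LcmSmall
  lcmSmall? S = map′ lcmSmall LcmSmall.bound (4 * (3 ^ (S * S) * lcmUpTo S ^ 4) ≤? 3 * 4 ^ (S * S))

  -- At S = 13 the inequality fails; from 14 on it holds for good. The values up to 22 are evaluated
  -- because the inductive step `lcmSmall-suc`, with its crude factor (S+1)⁴, is too weak for the
  -- smallest of them.
  lcmSmall-14+ : ∀ {j} → j < 9 → LcmSmall (14 + j)
  lcmSmall-14+ = toWitness {a? = allUpTo? (λ j → lcmSmall? (14 + j)) 9} _

  -- Passing to S + 1 multiplies the fourth power of the lcm by at most (S+1)⁴ and adds d = 2S + 1
  -- to both exponents, so (S+1)⁴ ≤ (4/3)ᵈ suffices.
  lcmSmall-suc : ∀ S d → suc S * suc S ≡ S * S + d → 3 ^ d * suc S ^ 4 ≤ 4 ^ d → LcmSmall S → LcmSmall (suc S)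
  lcmSmall-suc S d eq le (lcmSmall ih) = lcmSmall (begin
    4 * (3 ^ (S′ * S′) * lcmUpTo S′ ^ 4)             ≤⟨ *-monoʳ-≤ 4 (*-monoʳ-≤ (3 ^ (S′ * S′)) (^-monoˡ-≤ 4 (lcmUpTo-suc-≤ S))) ⟩
    4 * (3 ^ (S′ * S′) * (S′ * lcmUpTo S) ^ 4)       ≡⟨ cong (λ e → 4 * (e * (S′ * lcmUpTo S) ^ 4)) (split 3) ⟩
    4 * (3 ^ (S * S) * 3 ^ d * (S′ * lcmUpTo S) ^ 4) ≡⟨ solve 4 (λ e f s l → con 4 :* ((e :* f) :* ((s :* l) :^ 4)) := (con 4 :* (e :* l :^ 4)) :* (f :* s :^ 4)) refl (3 ^ (S * S)) (3 ^ d) S′ (lcmUpTo S) ⟩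
    4 * (3 ^ (S * S) * lcmUpTo S ^ 4) * (3 ^ d * S′ ^ 4) ≤⟨ *-mono-≤ ih le ⟩
    3 * 4 ^ (S * S) * 4 ^ d                          ≡⟨ trans (*-assoc 3 (4 ^ (S * S)) (4 ^ d)) (cong (3 *_) (sym (split 4))) ⟩
    3 * 4 ^ (S′ * S′)                                ∎)
    where
    open ≤-Reasoning
    S′ : ℕ
    S′ = suc S
    split : ∀ b → b ^ (S′ * S′) ≡ b ^ (S * S) * b ^ d
    split b = trans (cong (b ^_) eq) (^-distribˡ-+-* b (S * S) d)

  mergePowers : ∀ x y c j X → x ^ c * (x ^ 2) ^ j * X ≤ y ^ c * (y ^ 2) ^ j → x ^ (c + 2 * j) * X ≤ y ^ (c + 2 * j)
  mergePowers x y c j X = subst₂ _≤_ (cong (_* X) (merge x)) (merge y)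
    where
    merge : ∀ b → b ^ c * (b ^ 2) ^ j ≡ b ^ (c + 2 * j)
    merge b = trans (cong (b ^ c *_) (^-*-assoc b 2 j)) (sym (^-distribˡ-+-* b c (2 * j)))

  -- The exponent 45 is 23² - 22², and the induction rests on the numerical fact 23⁴ ≤ (4/3)⁴⁵.
  linearExponential-22+ : ∀ j → 3 ^ (45 + 2 * j) * suc (22 + j) ^ 4 ≤ 4 ^ (45 + 2 * j)
  linearExponential-22+ j = mergePowers 3 4 45 j (suc (22 + j) ^ 4)
    (linearExponential (3 ^ 45) (4 ^ 45) (toWitness {a? = 3 ^ 45 * 23 ^ 4 ≤? 4 ^ 45} _) j)

  square-22+ : ∀ j → suc (22 + j) * suc (22 + j) ≡ (22 + j) * (22 + j) + (45 + 2 * j)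
  square-22+ = solve 1 (λ j → (con 1 :+ (con 22 :+ j)) :* (con 1 :+ (con 22 :+ j)) := (con 22 :+ j) :* (con 22 :+ j) :+ (con 45 :+ con 2 :* j)) refl

  lcmSmall-22+ : ∀ j → LcmSmall (22 + j)
  lcmSmall-22+ zero    = lcmSmall-14+ {8} ≤-refl
  lcmSmall-22+ (suc j) = lcmSmall-suc (22 + j) (45 + 2 * j) (square-22+ j) (linearExponential-22+ j) (lcmSmall-22+ j)

  14≤⇒lcmSmall : ∀ {S} → 14 ≤ S → LcmSmall S
  14≤⇒lcmSmall {S} 14≤S with S ∸ 14 <? 9
  ... | yes <9 = subst LcmSmall (m+[n∸m]≡n 14≤S) (lcmSmall-14+ <9)
  ... | no  ≮9 = subst LcmSmall (m+[n∸m]≡n 22≤S) (lcmSmall-22+ (S ∸ 22))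
    where
    22≤S : 22 ≤ S
    22≤S = ≤-trans (+-monoʳ-≤ 14 (≤-trans (n≤1+n 8) (≮⇒≥ ≮9))) (≤-reflexive (m+[n∸m]≡n 14≤S))

  -- Built with `lcm` rather than as a product, so that its divisibility properties come from
  -- `lcm-least` directly instead of through coprimality of distinct primes.
  primorial : ℕ → ℕ
  primorial zero = 1
  primorial (suc n) with prime? (suc n)
  ... | yes _ = lcm (suc n) (primorial n)
  ... | no  _ = primorial n

  primorial-∣ : ∀ {N} n → DivisibleByPrimesUpTo n N → primorial n ∣ N
  primorial-∣ zero    div = 1∣ _
  primorial-∣ (suc n) div with prime? (suc n)
  ... | yes pr = lcm-least (div (suc n) pr ≤-refl) (primorial-∣ n λ q pq q≤n → div q pq (m≤n⇒m≤1+n q≤n))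
  ... | no  _  = primorial-∣ n λ q pq q≤n → div q pq (m≤n⇒m≤1+n q≤n)

  primorial-nonZero : ∀ n → NonZero (primorial n)
  primorial-nonZero n = ≢-nonZero λ eq → ≢-nonZero⁻¹ (n !) {{n !≢0}} (0∣⇒≡0 (subst (_∣ n !) eq
    (primorial-∣ n λ q pq q≤n → ∣-trans (lcmUpTo-commonMultiple n q (>-nonZero⁻¹ q {{prime⇒nonZero pq}}) q≤n) (lcmUpTo∣! n))))

  primorial-mono-≤ : ∀ {m n} → m ≤ n → primorial m ≤ primorial n
  primorial-mono-≤ {m} {n} m≤n = ∣⇒≤ {{primorial-nonZero n}}
    (primorial-∣ m λ q pq q≤m → primes∣primorial n q pq (≤-trans q≤m m≤n))
    where
    primes∣primorial : ∀ n → DivisibleByPrimesUpTo n (primorial n)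
    primes∣primorial zero    q pq q≤0 = ⊥-elim (<⇒≱ (>-nonZero⁻¹ q {{prime⇒nonZero pq}}) q≤0)
    primes∣primorial (suc n) q pq q≤1+n with m≤n⇒m<n∨m≡n q≤1+n | prime? (suc n)
    ... | inj₁ q<1+n | yes _ = ∣-trans (primes∣primorial n q pq (s≤s⁻¹ q<1+n)) (n∣lcm[m,n] (suc n) (primorial n))
    ... | inj₁ q<1+n | no  _ = primes∣primorial n q pq (s≤s⁻¹ q<1+n)
    ... | inj₂ refl  | yes _ = m∣lcm[m,n] (suc n) (primorial n)
    ... | inj₂ refl  | no ¬p = ⊥-elim (¬p pq)

  record PrimorialLarge (n m : ℕ) : Set where
    constructor primorialLarge
    field
      bound : 3 ^ m ≤ primorial n * primorial n

  primorialLarge? : ∀ n m → Dec (PrimorialLarge n m)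
  primorialLarge? n m = map′ primorialLarge PrimorialLarge.bound (3 ^ m ≤? primorial n * primorial n)

  primorialLarge-<20 : ∀ {m} → m < 20 → PrimorialLarge (suc m) m
  primorialLarge-<20 = toWitness {a? = allUpTo? (λ m → primorialLarge? (suc m) m) 20} _

  -- One evaluation settles ten values of m: by monotonicity the least primorial of a decade is set
  -- against its largest power of 3. This is too lossy for q < 2, hence the individual checks below
  -- 20.
  primorialLarge-decade : ∀ {q} → q < 20 → 2 ≤ q → PrimorialLarge (suc (q * 10)) (9 + q * 10)
  primorialLarge-decade = toWitness {a? = allUpTo? (λ q → (2 ≤? q) →-dec primorialLarge? (suc (q * 10)) (9 + q * 10)) 20} _

  primorialLarge-mono : ∀ {n n′ m m′} → n ≤ n′ → m′ ≤ m → PrimorialLarge n m → PrimorialLarge n′ m′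
  primorialLarge-mono n≤n′ m′≤m (primorialLarge bound) = primorialLarge
    (≤-trans (^-monoʳ-≤ 3 m′≤m) (≤-trans bound (*-mono-≤ (primorial-mono-≤ n≤n′) (primorial-mono-≤ n≤n′))))

  primorialLarge-<200 : ∀ m → m < 200 → PrimorialLarge (suc m) m
  primorialLarge-<200 m m<200 with m <? 20
  ... | yes m<20 = primorialLarge-<20 m<20
  ... | no  m≮20 = primorialLarge-mono (s≤s 10q≤m) m≤9+10q
    (primorialLarge-decade (m<n*o⇒m/o<n {m} {20} {10} m<200) (/-monoˡ-≤ 10 (≮⇒≥ m≮20)))
    where
    10q≤m : m / 10 * 10 ≤ m
    10q≤m = ≤-trans (m≤n+m _ (m % 10)) (≤-reflexive (sym (m≡m%n+[m/n]*n m 10)))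
    m≤9+10q : m ≤ 9 + m / 10 * 10
    m≤9+10q = ≤-trans (≤-reflexive (m≡m%n+[m/n]*n m 10)) (+-monoˡ-≤ _ (s≤s⁻¹ (m%n<n m 10)))

  -- θ(m+1) ≥ (m log 3)/2, with N in place of the primorial.
  divisibleByPrimes⇒large : ∀ m {N} → .{{NonZero N}} → DivisibleByPrimesUpTo (suc m) N → 3 ^ m ≤ N * N
  divisibleByPrimes⇒large m {N} {{N≢0}} div with m <? 195
  ... | yes m<195 = ≤-trans (PrimorialLarge.bound (primorialLarge-<200 m (<-≤-trans m<195 (m≤m+n 195 5)))) (*-mono-≤ R≤N R≤N)
    where
    R≤N : primorial (suc m) ≤ N
    R≤N = ∣⇒≤ (primorial-∣ (suc m) div)
  -- 195 = 14² - 1: from here on m + 1 ≥ 14², so S ≥ 14 and `LcmSmall` applies.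
  ... | no m≮195 with floorSqrt (suc m)
  ... | S , S²≤1+m , 1+m<[1+S]² with m≤n⇒∃[o]m+o≡n S²≤1+m
  ... | d , S²+d≡1+m = *-cancelʳ-≤ (3 ^ m) (N * N) (L ^ 4) {{m^n≢0 L 4 {{L≢0}}}} (begin
    3 ^ m * L ^ 4            ≤⟨ *-cancelˡ-≤ 12 scaled ⟩
    4 ^ m                    ≡⟨ ^-*-assoc 2 2 m ⟩
    2 ^ (2 * m)              ≡⟨ cong (2 ^_) (cong (λ e → m + e) (+-identityʳ m)) ⟩
    2 ^ (m + m)              ≡⟨ ^-distribˡ-+-* 2 m m ⟩
    2 ^ m * 2 ^ m            ≤⟨ *-mono-≤ 2^m≤ 2^m≤ ⟩
    N * (L * L) * (N * (L * L)) ≡⟨ solve 2 (λ n l → n :* (l :* l) :* (n :* (l :* l)) := n :* n :* l :^ 4) refl N L ⟩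
    N * N * L ^ 4            ∎)
    where
    open ≤-Reasoning
    L : ℕ
    L = lcmUpTo S
    L≢0 : NonZero L
    L≢0 = lcmUpTo-nonZero S
    14≤S : 14 ≤ S
    14≤S = ≮⇒≥ λ S<14 → <⇒≱ 1+m<[1+S]² (≤-trans (*-mono-≤ S<14 S<14) (s≤s (≮⇒≥ m≮195)))
    2^m≤ : 2 ^ m ≤ N * (L * L)
    2^m≤ = commonMultiple-≥ m {{m*n≢0 N (L * L) {{N≢0}} {{m*n≢0 L L {{L≢0}} {{L≢0}}}}}} (smoothCommonMultiple S 1+m<[1+S]² div)
    power : ∀ b → b * b ^ m ≡ b ^ (S * S) * b ^ d
    power b = trans (cong (b ^_) (sym S²+d≡1+m)) (^-distribˡ-+-* b (S * S) d)
    -- The factors 4 and 3 in `LcmSmall` pay for the shift from m + 1 to m: 4·3ᵐ⁺¹L⁴ ≤ 3·4ᵐ⁺¹ reads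
    -- 12·3ᵐL⁴ ≤ 12·4ᵐ. The excess d = m + 1 - S² costs only 3ᵈ ≤ 4ᵈ.
    scaled : 12 * (3 ^ m * L ^ 4) ≤ 12 * 4 ^ m
    scaled = begin
      12 * (3 ^ m * L ^ 4)                          ≡⟨ solve 2 (λ a l → con 12 :* (a :* l) := con 4 :* ((con 3 :* a) :* l)) refl (3 ^ m) (L ^ 4) ⟩
      4 * (3 * 3 ^ m * L ^ 4)                       ≡⟨ cong (λ e → 4 * (e * L ^ 4)) (power 3) ⟩
      4 * (3 ^ (S * S) * 3 ^ d * L ^ 4)             ≡⟨ solve 3 (λ a b l → con 4 :* (a :* b :* l) := con 4 :* (a :* l) :* b) refl (3 ^ (S * S)) (3 ^ d) (L ^ 4) ⟩
      4 * (3 ^ (S * S) * L ^ 4) * 3 ^ d             ≤⟨ *-mono-≤ (LcmSmall.bound (14≤⇒lcmSmall 14≤S)) (^-monoˡ-≤ d (n≤1+n 3)) ⟩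
      3 * 4 ^ (S * S) * 4 ^ d                       ≡⟨ trans (*-assoc 3 (4 ^ (S * S)) (4 ^ d)) (cong (3 *_) (sym (power 4))) ⟩
      3 * (4 * 4 ^ m)                               ≡⟨ *-assoc 3 4 (4 ^ m) ⟨
      12 * 4 ^ m                                    ∎

  -- Minimality puts every prime q ≤ m + 1 among the divisors of N; divisibility being decidable,
  -- the double negation can be removed.
  smallPrimeNonDivisor : ∀ N → 1 ≤ N → ∃ λ m → Prime (2 + m) × ¬ (2 + m ∣ N) × 3 ^ m ≤ N * N
  smallPrimeNonDivisor N@(suc _) 1≤N with primeNonDivisor N 1≤N
  ... | n , nd with least (primeNonDivisor? N) n nd
  ... | zero , (pr , _) , _ = ⊥-elim (¬prime[0] pr)
  ... | suc zero , (pr , _) , _ = ⊥-elim (¬prime[1] pr)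
  ... | suc (suc m) , (pr , ∤N) , minimal = m , pr , ∤N , divisibleByPrimes⇒large m
    λ q pq q≤1+m → decidable-stable (q ∣? N) λ q∤N → minimal (s≤s q≤1+m) (pq , q∤N)

-- The Hecke representatives of prime index.

-- The pair (i , j) stands for the matrices (a b; 0 d) with a = i + 1 and d = j + 1.
HeckePair : ℕ → ℕ → ℕ × ℕ → Set
HeckePair N p (i , j) = suc i ℕ.* suc j ≡ p × Coprime (suc i) N

heckePair? : ∀ N p x → Dec (HeckePair N p x)
heckePair? N p (i , j) = (suc i ℕ.* suc j ℕₚ.≟ p) ×-dec coprime? (suc i) N

-- A product equal to a prime has a factor 1, and a = p passes the coprimality test because p ∤ N.
-- The order of enumeration is left open: duplicate-free lists with the same members are
-- permutations of each other, which is enough for a sum.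
heckePairs : ∀ N r → Prime (suc r) → suc r ∤ N →
  filter (heckePair? N (suc r)) (cartesianProduct (upTo (suc r)) (upTo (suc r))) ↭ (0 , r) ∷ (r , 0) ∷ []
heckePairs N r pp p∤N = ∼bag⇒↭ (unique∧set⇒bag
  (Unique.filter⁺ (heckePair? N p) (Unique.cartesianProduct⁺ (Unique.upTo⁺ p) (Unique.upTo⁺ p)))
  ((distinct ∷ []) ∷ ([] ∷ []))
  (mk⇔ to from))
  where
  p : ℕ
  p = suc r
  pairs : List (ℕ × ℕ)
  pairs = cartesianProduct (upTo p) (upTo p)
  r≢0 : ¬ (r ≡ 0)
  r≢0 ≡.refl = ¬prime[1] pp
  distinct : ¬ ((0 , r) ≡ (r , 0))
  distinct e = r≢0 (≡.sym (≡.cong proj₁ e))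
  to : ∀ {x} → x ∈ filter (heckePair? N p) pairs → x ∈ (0 , r) ∷ (r , 0) ∷ []
  to {i , j} x∈ with proj₂ (∈-filter⁻ (heckePair? N p) {xs = pairs} x∈)
  ... | ij≡p , _ with prime⇒irreducible pp (divides (suc j) (≡.trans (≡.sym ij≡p) (ℕₚ.*-comm (suc i) (suc j))))
  ... | inj₁ ≡.refl = here (≡.cong (0 ,_) (ℕₚ.suc-injective (≡.trans (≡.sym (ℕₚ.*-identityˡ (suc j))) ij≡p)))
  ... | inj₂ ≡.refl = there (here (≡.cong (r ,_) (ℕₚ.suc-injective
    (ℕₚ.*-cancelˡ-≡ (suc j) 1 p (≡.trans ij≡p (≡.sym (ℕₚ.*-identityʳ p)))))))
  p-coprime : Coprime p N
  p-coprime (d∣p , d∣N) with prime⇒irreducible pp d∣p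
  ... | inj₁ d≡1    = d≡1
  ... | inj₂ ≡.refl = ⊥-elim (p∤N d∣N)
  from : ∀ {x} → x ∈ (0 , r) ∷ (r , 0) ∷ [] → x ∈ filter (heckePair? N p) pairs
  from (here ≡.refl)         = ∈-filter⁺ (heckePair? N p) (∈-cartesianProduct⁺ (∈-upTo⁺ {p} {0} (ℕ.s≤s ℕ.z≤n)) (∈-upTo⁺ {p} {r} ℕₚ.≤-refl))
    (ℕₚ.*-identityˡ p , λ (d∣1 , _) → ∣1⇒≡1 d∣1)
  from (there (here ≡.refl)) = ∈-filter⁺ (heckePair? N p) (∈-cartesianProduct⁺ (∈-upTo⁺ {p} {r} ℕₚ.≤-refl) (∈-upTo⁺ {p} {0} (ℕ.s≤s ℕ.z≤n)))
    (ℕₚ.*-identityʳ p , p-coprime)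

k-1+[k′-k] : ∀ k k′ → k′ ℤ.- ℤ.1ℤ ≡ (k ℤ.- ℤ.1ℤ) ℤ.+ (k′ ℤ.- k)
k-1+[k′-k] = solve 2 (λ k k′ → k′ :- con ℤ.1ℤ := (k :- con ℤ.1ℤ) :+ (k′ :- k)) ≡.refl
  where open ℤSolver.+-*-Solver

k′-k≡-[k-k′] : ∀ k k′ → k′ ℤ.- k ≡ ℤ.- (k ℤ.- k′)
k′-k≡-[k-k′] = solve 2 (λ k k′ → k′ :- k := :- (k :- k′)) ≡.refl
  where open ℤSolver.+-*-Solver

module EigenformComparison {c ℓ₁ ℓ₂ ℓ₃ : Level} (R : RealNumbers c ℓ₁ ℓ₂ ℓ₃) where

  open ComplexNumbers R public
  open ModularForms R using
    ( ℍ; point; IsFourierExpansion; IsCuspidalEigenform; M₂⁺; numerator; denominator; denominator-nonZero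
    ; _⟨_⟩; _∣[_]_; upperTriangular; heckeRepresentatives )

  -- The commutative ring of complex numbers.

  module ComplexField where

    open ExpConvergence public using (+-mono-≤; *-monoʳ-<)

    -ᶜ_ : ℂ → ℂ
    -ᶜ z = (- re z) +i (- im z)

    ℂ-commutativeRing : CommutativeRing c ℓ₁
    ℂ-commutativeRing = record
      { Carrier = ℂ ; _≈_ = _≈ᶜ_ ; _+_ = _+ᶜ_ ; _*_ = _*ᶜ_ ; -_ = -ᶜ_ ; 0# = 0ᶜ ; 1# = 1ᶜ
      ; isCommutativeRing = record
        { isRing = record
          { +-isAbelianGroup = record
            { isGroup = record
              { isMonoid = record
                { isSemigroup = record
                  { isMagma = record
                    { isEquivalence = record
                      { refl  = refl , refl
                      ; sym   = λ (p , q) → sym p , sym q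
                      ; trans = λ (p , q) (p′ , q′) → trans p p′ , trans q q′
                      }
                    ; ∙-cong = λ (p , q) (p′ , q′) → +-cong p p′ , +-cong q q′
                    }
                  ; assoc = λ _ _ _ → +-assoc _ _ _ , +-assoc _ _ _
                  }
                ; identity = (λ _ → +-identityˡ _ , +-identityˡ _) , (λ _ → +-identityʳ _ , +-identityʳ _)
                }
              ; inverse = (λ _ → -‿inverseˡ _ , -‿inverseˡ _) , (λ _ → -‿inverseʳ _ , -‿inverseʳ _)
              ; ⁻¹-cong = λ (p , q) → -‿cong p , -‿cong q
              }
            ; comm = λ _ _ → +-comm _ _ , +-comm _ _
            }
          ; *-cong = λ (p , q) (p′ , q′) →
              +-cong (*-cong p p′) (-‿cong (*-cong q q′)) , +-cong (*-cong p q′) (*-cong q p′)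
          ; *-assoc = λ z w v → *ᶜ-assoc z w v
          ; *-identity = (λ z → trans (*ᶜ-comm-re 1ᶜ z) (proj₁ (*ᶜ-identityʳ z)) , trans (*ᶜ-comm-im 1ᶜ z) (proj₂ (*ᶜ-identityʳ z)))
                       , *ᶜ-identityʳ
          ; distrib = distribˡ , distribʳ
          }
        ; *-comm = λ z w → *ᶜ-comm-re z w , *ᶜ-comm-im z w
        }
      }
      where
      abstract
        *ᶜ-comm-re : ∀ z w → re (z *ᶜ w) ≈ re (w *ᶜ z)
        *ᶜ-comm-re z w = solve 4 (λ a b c d → a :* c :- b :* d := c :* a :- d :* b) refl (re z) (im z) (re w) (im w)
        *ᶜ-comm-im : ∀ z w → im (z *ᶜ w) ≈ im (w *ᶜ z)
        *ᶜ-comm-im z w = solve 4 (λ a b c d → a :* d :+ b :* c := c :* b :+ d :* a) refl (re z) (im z) (re w) (im w)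
        *ᶜ-identityʳ : ∀ z → z *ᶜ 1ᶜ ≈ᶜ z
        *ᶜ-identityʳ z =
          trans (solve 3 (λ a b e → a :* e :- b :* con +0 := a :* e) refl (re z) (im z) 1#) (*-identityʳ _) ,
          trans (solve 3 (λ a b e → a :* con +0 :+ b :* e := b :* e) refl (re z) (im z) 1#) (*-identityʳ _)
        *ᶜ-assoc : ∀ z w v → (z *ᶜ w) *ᶜ v ≈ᶜ z *ᶜ (w *ᶜ v)
        *ᶜ-assoc z w v =
          solve 6 (λ a b c d e f → (a :* c :- b :* d) :* e :- (a :* d :+ b :* c) :* f := a :* (c :* e :- d :* f) :- b :* (c :* f :+ d :* e)) refl (re z) (im z) (re w) (im w) (re v) (im v) ,
          solve 6 (λ a b c d e f → (a :* c :- b :* d) :* f :+ (a :* d :+ b :* c) :* e := a :* (c :* f :+ d :* e) :+ b :* (c :* e :- d :* f)) refl (re z) (im z) (re w) (im w) (re v) (im v)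
        distribˡ : ∀ z w v → z *ᶜ (w +ᶜ v) ≈ᶜ z *ᶜ w +ᶜ z *ᶜ v
        distribˡ z w v =
          solve 6 (λ a b c d e f → a :* (c :+ e) :- b :* (d :+ f) := (a :* c :- b :* d) :+ (a :* e :- b :* f)) refl (re z) (im z) (re w) (im w) (re v) (im v) ,
          solve 6 (λ a b c d e f → a :* (d :+ f) :+ b :* (c :+ e) := (a :* d :+ b :* c) :+ (a :* f :+ b :* e)) refl (re z) (im z) (re w) (im w) (re v) (im v)
        distribʳ : ∀ v z w → (z +ᶜ w) *ᶜ v ≈ᶜ z *ᶜ v +ᶜ w *ᶜ v
        distribʳ v z w =
          solve 6 (λ a b c d e f → (a :+ c) :* e :- (b :+ d) :* f := (a :* e :- b :* f) :+ (c :* e :- d :* f)) refl (re z) (im z) (re w) (im w) (re v) (im v) ,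
          solve 6 (λ a b c d e f → (a :+ c) :* f :+ (b :+ d) :* e := (a :* f :+ b :* e) :+ (c :* f :+ d :* e)) refl (re z) (im z) (re w) (im w) (re v) (im v)

    open CommutativeRing ℂ-commutativeRing public
      using () renaming
      ( refl to reflᶜ; sym to symᶜ; trans to transᶜ; reflexive to reflexiveᶜ; setoid to ℂ-setoid; semiring to ℂ-semiring
      ; +-cong to +ᶜ-cong; +-congˡ to +ᶜ-congˡ; +-congʳ to +ᶜ-congʳ
      ; *-cong to *ᶜ-cong; *-congˡ to *ᶜ-congˡ; *-congʳ to *ᶜ-congʳ; -‿cong to -ᶜ-cong
      ; +-identityˡ to +ᶜ-identityˡ; +-identityʳ to +ᶜ-identityʳ; +-assoc to +ᶜ-assoc; +-comm to +ᶜ-comm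
      ; *-identityˡ to *ᶜ-identityˡ; *-identityʳ to *ᶜ-identityʳ; *-assoc to *ᶜ-assoc; *-comm to *ᶜ-comm
      ; zeroˡ to zeroˡᶜ; zeroʳ to zeroʳᶜ; -‿inverseʳ to -ᶜ-inverseʳ )

    -ᶜ-cong₂ : ∀ {z z′ w w′} → z ≈ᶜ z′ → w ≈ᶜ w′ → z -ᶜ w ≈ᶜ z′ -ᶜ w′
    -ᶜ-cong₂ p q = +ᶜ-cong p (-ᶜ-cong q)

    ofReal-cong : ∀ {x y} → x ≈ y → ofReal x ≈ᶜ ofReal y
    ofReal-cong p = p , refl

    ofReal-+ : ∀ x y → ofReal (x + y) ≈ᶜ ofReal x +ᶜ ofReal y
    ofReal-+ x y = refl , sym (+-identityʳ 0#)

    abstract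
      ofReal-* : ∀ x y → ofReal (x * y) ≈ᶜ ofReal x *ᶜ ofReal y
      ofReal-* x y = solve 2 (λ x y → x :* y := x :* y :- con +0 :* con +0) refl x y ,
                     solve 2 (λ x y → con +0 := x :* con +0 :+ con +0 :* y) refl x y

    ofReal-neg : ∀ x → ofReal (- x) ≈ᶜ -ᶜ ofReal x
    ofReal-neg x = refl , sym -0#≈0#

    private
      ℂ-almostCommutativeRing : AlmostCommutativeRing c ℓ₁
      ℂ-almostCommutativeRing = fromCommutativeRing ℂ-commutativeRing

      ofℤ-morphism : ℤ.+-*-rawRing -Raw-AlmostCommutative⟶ ℂ-almostCommutativeRing
      ofℤ-morphism = record
        { ⟦_⟧    = ofℤ
        ; +-homo = λ i j → transᶜ (ofReal-cong (fromℤ-+ i j)) (ofReal-+ _ _)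
        ; *-homo = λ i j → transᶜ (ofReal-cong (fromℤ-* i j)) (ofReal-* _ _)
        ; -‿homo = λ i → transᶜ (ofReal-cong (fromℤ-neg i)) (ofReal-neg _)
        ; 0-homo = reflᶜ
        ; 1-homo = ofReal-cong (+-identityʳ 1#)
        }

      coeff≟ : ∀ i j → Maybe (ofℤ i ≈ᶜ ofℤ j)
      coeff≟ i j with i ℤₚ.≟ j
      ... | yes i≡j = just (reflexiveᶜ (≡.cong ofℤ i≡j))
      ... | no  _   = nothing

    open RingSolver ℤ.+-*-rawRing ℂ-almostCommutativeRing ofℤ-morphism coeff≟ public
      using () renaming (solve to solveᶜ; _:=_ to _⩵_; _:+_ to _⊕_; _:*_ to _⊗_; _:-_ to _⊝_; :-_ to ⊝_; con to κ)

    open ExpProperties ℂ-semiring public using ()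
      renaming (^-congˡ to ^ᶜ-congˡ; ^-assocʳ to ^ᶜ-assocʳ)
    open ExpProperties semiring public using ()
      renaming (^-congˡ to ^ʳ-congˡ; ^-homo-* to ^ʳ-homo-*; ^-assocʳ to ^ʳ-assocʳ)

  open ComplexField public

  -- Bounds on absolute values and limits of complex sequences.

  module ComplexLimits where

    abstract
      half : ∀ {x} → 0# < x → ∃ λ h → 0# < h × h + h ≈ x
      half {x} 0<x = x * 1/ 2 , *-pos 0<x (inverse-pos _ _) , (begin
        x * 1/ 2 + x * 1/ 2     ≈⟨ solve 2 (λ x i → x :* i :+ x :* i := x :* ((con (+ 2)) :* i)) refl x (1/ 2) ⟩
        x * (fromℕ 2 * 1/ 2)    ≈⟨ *-congˡ (1/-correct 2) ⟩
        x * 1#                  ≈⟨ *-identityʳ x ⟩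
        x                       ∎)
        where open SetoidReasoning setoid

      -- Apart elements are comparable, and both strict comparisons are excluded; tightness of
      -- apartness then yields equality.
      ≤-antisym : ∀ {x y} → x ≤ y → y ≤ x → x ≈ y
      ≤-antisym {x} {y} x≤y y≤x = proj₁ (tight x y) λ x#y → [ y≤x , x≤y ]′ (#⇒<⊎> x#y)

      ≤-+ε : ∀ {x y} → (∀ ε → 0# < ε → x ≤ y + ε) → x ≤ y
      ≤-+ε {x} {y} p y<x = p h 0<h (0<-⇒< (<-respʳ-≈ eq 0<h))
        where
        halved : ∃ λ h → 0# < h × h + h ≈ x - y
        halved = half (<⇒0<- y<x)
        h : ℝ
        h = proj₁ halved
        0<h : 0# < h
        0<h = proj₁ (proj₂ halved)
        h+h≈ : h + h ≈ x - y
        h+h≈ = proj₂ (proj₂ halved)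
        eq : h ≈ x - (y + h)
        eq = trans (solve 2 (λ h y → h := (h :+ h) :+ y :- (y :+ h)) refl h y)
          (+-congʳ (trans (+-congʳ h+h≈) (solve 2 (λ x y → x :- y :+ y := x) refl x y)))

      *-mono-≤ : ∀ {x y a b} → 0# ≤ x → 0# ≤ b → x ≤ a → y ≤ b → x * y ≤ a * b
      *-mono-≤ {x} {y} {a} {b} 0≤x 0≤b x≤a y≤b = 0≤-⇒≤ (≤-resp-≈ refl
        (solve 4 (λ x y a b → (a :- x) :* b :+ x :* (b :- y) := a :* b :- x :* y) refl x y a b)
        (0≤-+ (0≤-* (≤⇒0≤- x≤a) 0≤b) (0≤-* 0≤x (≤⇒0≤- y≤b))))

      sq-cancel-≤ : ∀ {x v} → 0# ≤ v → x * x ≤ v * v → x ≤ v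
      sq-cancel-≤ {x} {v} 0≤v x²≤v² v<x = x²≤v² (0<-⇒< (<-respʳ-≈
        (solve 2 (λ x v → (x :- v) :* (x :+ v) := x :* x :- v :* v) refl x v)
        (*-pos (<⇒0<- v<x) (0<-+ (≤-<-trans 0≤v v<x) 0≤v))))

      ^ʳ-nonneg : ∀ {x} → 0# ≤ x → ∀ n → 0# ≤ x ^ʳ n
      ^ʳ-nonneg 0≤x zero    = <⇒≤ 0<1
      ^ʳ-nonneg 0≤x (suc n) = 0≤-* 0≤x (^ʳ-nonneg 0≤x n)

      ^ʳ-pos : ∀ {x} → 0# < x → ∀ n → 0# < x ^ʳ n
      ^ʳ-pos 0<x zero    = 0<1
      ^ʳ-pos 0<x (suc n) = *-pos 0<x (^ʳ-pos 0<x n)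

      ^ʳ-≤1 : ∀ {x} → 0# ≤ x → x ≤ 1# → ∀ n → x ^ʳ n ≤ 1#
      ^ʳ-≤1 0≤x x≤1 zero    = ≤-refl refl
      ^ʳ-≤1 0≤x x≤1 (suc n) = ≤-trans (*-mono-≤ 0≤x (<⇒≤ 0<1) x≤1 (^ʳ-≤1 0≤x x≤1 n)) (≤-refl (*-identityʳ 1#))

      ^ʳ-monoˡ-≤ : ∀ {x y} → 0# ≤ x → x ≤ y → ∀ n → x ^ʳ n ≤ y ^ʳ n
      ^ʳ-monoˡ-≤ 0≤x x≤y zero    = ≤-refl refl
      ^ʳ-monoˡ-≤ 0≤x x≤y (suc n) = *-mono-≤ 0≤x (^ʳ-nonneg (≤-trans 0≤x x≤y) n) x≤y (^ʳ-monoˡ-≤ 0≤x x≤y n)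

      -- δ = ε/(C+ε) meets both bounds at once, which spares taking the minimum of two reals.
      scale-down : ∀ ε C → 0# < ε → 0# < C → ∃ λ δ → 0# < δ × δ ≤ 1# × δ * C ≤ ε
      scale-down ε C 0<ε 0<C = δ , *-pos 0<ε (inverse-pos D 0<D) , δ≤1 , δC≤ε
        where
        D i δ : ℝ
        D = C + ε
        0<D : 0# < D
        0<D = 0<-+ 0<C (<⇒≤ 0<ε)
        i = inverse D 0<D
        δ = ε * i
        Di≈1 : D * i ≈ 1#
        Di≈1 = inverse-correct D 0<D
        0≤i : 0# ≤ i
        0≤i = <⇒≤ (inverse-pos D 0<D)
        δ≤1 : δ ≤ 1#
        δ≤1 = 0≤-⇒≤ (≤-resp-≈ refl
          (trans (solve 3 (λ c e i → c :* i := (c :+ e) :* i :- e :* i) refl C ε i) (+-congʳ Di≈1))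
          (0≤-* (<⇒≤ 0<C) 0≤i))
        δC≤ε : δ * C ≤ ε
        δC≤ε = 0≤-⇒≤ (≤-resp-≈ refl
          (trans (solve 3 (λ c e i → (e :* i) :* e := e :* ((c :+ e) :* i) :- (e :* i) :* c) refl C ε i)
            (+-congʳ (trans (*-congˡ Di≈1) (*-identityʳ ε))))
          (0≤-* (0≤-* (<⇒≤ 0<ε) 0≤i) (<⇒≤ 0<ε)))

      ∣∣²-cong : ∀ {z w} → z ≈ᶜ w → ∣ z ∣² ≈ ∣ w ∣²
      ∣∣²-cong (p , q) = +-cong (*-cong p p) (*-cong q q)

      ∣∣²-* : ∀ z w → ∣ z *ᶜ w ∣² ≈ ∣ z ∣² * ∣ w ∣²
      ∣∣²-* z w = solve 4 (λ a b c d →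
        (a :* c :- b :* d) :* (a :* c :- b :* d) :+ (a :* d :+ b :* c) :* (a :* d :+ b :* c)
        := (a :* a :+ b :* b) :* (c :* c :+ d :* d)) refl (re z) (im z) (re w) (im w)

      ∣∣²-nonneg : ∀ z → 0# ≤ ∣ z ∣²
      ∣∣²-nonneg z = 0≤-+ (sq-nonneg (re z)) (sq-nonneg (im z))

    -- ∣z∣ ≤ u, stated through squares because square roots are not available.
    infix 4 _⊑_
    record _⊑_ (z : ℂ) (u : ℝ) : Set ℓ₃ where
      constructor norm≤
      field
        0≤bound : 0# ≤ u
        ∣∣²≤    : ∣ z ∣² ≤ u * u

    open _⊑_ public

    abstract
      ⊑-resp : ∀ {z w u v} → z ≈ᶜ w → u ≈ v → z ⊑ u → w ⊑ v
      ⊑-resp p q (norm≤ 0≤u b) = norm≤ (≤-resp-≈ refl q 0≤u) (≤-resp-≈ (∣∣²-cong p) (*-cong q q) b)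

      ⊑-weaken : ∀ {z u v} → u ≤ v → z ⊑ u → z ⊑ v
      ⊑-weaken u≤v (norm≤ 0≤u b) = norm≤ (≤-trans 0≤u u≤v) (≤-trans b (*-mono-≤ 0≤u (≤-trans 0≤u u≤v) u≤v u≤v))

      ⊑-0 : ∀ {u} → 0# ≤ u → 0ᶜ ⊑ u
      ⊑-0 {u} 0≤u = norm≤ 0≤u (≤-trans (≤-refl (solve 0 (con +0 :* con +0 :+ con +0 :* con +0 := con +0) refl)) (sq-nonneg u))

      ⊑-ofReal : ∀ {x} → 0# ≤ x → ofReal x ⊑ x
      ⊑-ofReal {x} 0≤x = norm≤ 0≤x (≤-refl (solve 1 (λ x → x :* x :+ con +0 :* con +0 := x :* x) refl x))

      ⊑-neg : ∀ {z u} → z ⊑ u → -ᶜ z ⊑ u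
      ⊑-neg {z} (norm≤ 0≤u b) = norm≤ 0≤u (≤-resp-≈
        (solve 2 (λ a b → a :* a :+ b :* b := (:- a) :* (:- a) :+ (:- b) :* (:- b)) refl (re z) (im z)) refl b)

      -- After squaring, only the cross term ac + bd ≤ uv is at stake. This is Cauchy-Schwarz, from
      -- Lagrange's identity (a²+b²)(c²+d²) = (ac+bd)² + (ad-bc)².
      ⊑-+ : ∀ {z w u v} → z ⊑ u → w ⊑ v → z +ᶜ w ⊑ u + v
      ⊑-+ {z} {w} {u} {v} (norm≤ 0≤u p) (norm≤ 0≤v q) = norm≤ (0≤-+ 0≤u 0≤v) (0≤-⇒≤ (≤-resp-≈ refl
        (solve 6 (λ a b c d u v →
          ((u :* u :- (a :* a :+ b :* b)) :+ (v :* v :- (c :* c :+ d :* d)))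
            :+ ((u :* v :- (a :* c :+ b :* d)) :+ (u :* v :- (a :* c :+ b :* d)))
          := (u :+ v) :* (u :+ v) :- ((a :+ c) :* (a :+ c) :+ (b :+ d) :* (b :+ d)))
          refl (re z) (im z) (re w) (im w) u v)
        (0≤-+ (0≤-+ (≤⇒0≤- p) (≤⇒0≤- q)) (0≤-+ cauchy-schwarz cauchy-schwarz))))
        where
        cauchy-schwarz : 0# ≤ u * v - (re z * re w + im z * im w)
        cauchy-schwarz = ≤⇒0≤- (sq-cancel-≤ (0≤-* 0≤u 0≤v) (≤-trans
          (0≤-⇒≤ (≤-resp-≈ refl
            (solve 4 (λ a b c d → (a :* d :- b :* c) :* (a :* d :- b :* c)
              := (a :* a :+ b :* b) :* (c :* c :+ d :* d) :- (a :* c :+ b :* d) :* (a :* c :+ b :* d))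
              refl (re z) (im z) (re w) (im w))
            (sq-nonneg _)))
          (≤-trans (*-mono-≤ (∣∣²-nonneg z) (sq-nonneg v) p q)
            (≤-refl (solve 2 (λ u v → (u :* u) :* (v :* v) := (u :* v) :* (u :* v)) refl u v)))))

      ⊑-- : ∀ {z w u v} → z ⊑ u → w ⊑ v → z -ᶜ w ⊑ u + v
      ⊑-- p q = ⊑-+ p (⊑-neg q)

      ⊑-* : ∀ {z w u v} → z ⊑ u → w ⊑ v → z *ᶜ w ⊑ u * v
      ⊑-* {z} {w} {u} {v} (norm≤ 0≤u p) (norm≤ 0≤v q) = norm≤ (0≤-* 0≤u 0≤v)
        (≤-resp-≈ (sym (∣∣²-* z w)) (solve 2 (λ u v → (u :* u) :* (v :* v) := (u :* v) :* (u :* v)) refl u v)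
          (*-mono-≤ (∣∣²-nonneg z) (sq-nonneg v) p q))

      ⊑-^ : ∀ {z u} → z ⊑ u → ∀ n → z ^ᶜ n ⊑ u ^ʳ n
      ⊑-^ p zero    = ⊑-ofReal (<⇒≤ 0<1)
      ⊑-^ p (suc n) = ⊑-* p (⊑-^ p n)

      ⊑-re : ∀ {z u} → z ⊑ u → re z ≤ u
      ⊑-re {z} (norm≤ 0≤u p) = sq-cancel-≤ 0≤u (≤-trans (0≤-⇒≤ (≤-resp-≈ refl
        (solve 2 (λ a b → b :* b := (a :* a :+ b :* b) :- a :* a) refl (re z) (im z)) (sq-nonneg (im z)))) p)

      ⊑-im : ∀ {z u} → z ⊑ u → im z ≤ u
      ⊑-im {z} (norm≤ 0≤u p) = sq-cancel-≤ 0≤u (≤-trans (0≤-⇒≤ (≤-resp-≈ refl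
        (solve 2 (λ a b → a :* a := (a :* a :+ b :* b) :- b :* b) refl (re z) (im z)) (sq-nonneg (re z)))) p)

      ⊑-bound : ∀ z → ∃ λ n → z ⊑ fromℕ (suc n)
      ⊑-bound z = let (n , lt) = archimedean ∣ z ∣² in n , norm≤ (fromℕ-nonneg (suc n)) (≤-trans (<⇒≤ lt)
        (≤-trans (fromℕ-mono (ℕₚ.≤-trans (ℕₚ.n≤1+n n) (ℕₚ.m≤m*n (suc n) (suc n)))) (≤-refl (×1-homo-* (suc n) (suc n)))))

      ⊑-≈0 : ∀ {z} → (∀ ε → 0# < ε → z ⊑ ε) → z ≈ᶜ 0ᶜ
      ⊑-≈0 {z} p = vanishes (λ ε 0<ε → ⊑-re (p ε 0<ε)) (λ ε 0<ε → ⊑-re (⊑-neg (p ε 0<ε)))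
                 , vanishes (λ ε 0<ε → ⊑-im (p ε 0<ε)) (λ ε 0<ε → ⊑-im (⊑-neg (p ε 0<ε)))
        where
        vanishes : ∀ {x} → (∀ ε → 0# < ε → x ≤ ε) → (∀ ε → 0# < ε → - x ≤ ε) → x ≈ 0#
        vanishes {x} p q = ≤-antisym
          (≤-+ε λ ε 0<ε → ≤-trans (p ε 0<ε) (≤-refl (sym (+-identityˡ ε))))
          (≤-+ε λ ε 0<ε → 0≤-⇒≤ (≤-resp-≈ refl
            (solve 2 (λ x ε → ε :- (:- x) := (x :+ ε) :- con +0) refl x ε) (≤⇒0≤- (q ε 0<ε))))

    Tends : (ℕ → ℂ) → ℂ → Set (c ⊔ ℓ₃)
    Tends s l = ∀ ε → 0# < ε → ∃ λ M → ∀ n → M ℕ.≤ n → (s n -ᶜ l) ⊑ ε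

    sumsTo⇒tends : ∀ {t l} → t SumsTo l → Tends (partialSum t) l
    sumsTo⇒tends p ε 0<ε = let (M , close) = p ε 0<ε in M , λ n M≤n → norm≤ (<⇒≤ 0<ε) (<⇒≤ (close n M≤n))

    abstract
      tends-unique : ∀ {s l l′} → Tends s l → Tends s l′ → l ≈ᶜ l′
      tends-unique {s} {l} {l′} p q = transᶜ (solveᶜ 2 (λ l m → l ⩵ (l ⊝ m) ⊕ m) reflᶜ l l′)
        (transᶜ (+ᶜ-congʳ (⊑-≈0 close)) (+ᶜ-identityˡ l′))
        where
        close : ∀ ε → 0# < ε → (l -ᶜ l′) ⊑ ε
        close ε 0<ε = let (h , 0<h , h+h≈ε) = half 0<ε ; (M , a) = p h 0<h ; (M′ , b) = q h 0<h ; K = M ℕ.+ M′ in ⊑-resp (solveᶜ 3 (λ s l m → (s ⊝ m) ⊝ (s ⊝ l) ⩵ l ⊝ m) reflᶜ (s K) l l′) h+h≈ε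
          (⊑-- (b K (ℕₚ.m≤n+m M′ M)) (a K (ℕₚ.m≤m+n M M′)))

      tends-resp : ∀ {s t l m} → (∀ n → s n ≈ᶜ t n) → l ≈ᶜ m → Tends s l → Tends t m
      tends-resp e f p ε 0<ε = let (M , a) = p ε 0<ε in M , λ n M≤n → ⊑-resp (-ᶜ-cong₂ (e n) f) refl (a n M≤n)

      tends-close : ∀ {s t l} → (∀ ε → 0# < ε → ∃ λ M → ∀ n → M ℕ.≤ n → (t n -ᶜ s n) ⊑ ε) → Tends s l → Tends t l
      tends-close {s} {t} {l} p q ε 0<ε = let (h , 0<h , h+h≈ε) = half 0<ε ; (M , a) = p h 0<h ; (M′ , b) = q h 0<h in M ℕ.+ M′ , λ n K≤n → ⊑-resp
        (solveᶜ 3 (λ s t l → (t ⊝ s) ⊕ (s ⊝ l) ⩵ t ⊝ l) reflᶜ (s n) (t n) l) h+h≈ε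
        (⊑-+ (a n (ℕₚ.≤-trans (ℕₚ.m≤m+n M M′) K≤n)) (b n (ℕₚ.≤-trans (ℕₚ.m≤n+m M′ M) K≤n)))

      tends-* : ∀ {s t l m} → Tends s l → Tends t m → Tends (λ n → s n *ᶜ t n) (l *ᶜ m)
      tends-* {s} {t} {l} {m} p q ε 0<ε = bounded (proj₂ (⊑-bound l)) (proj₂ (⊑-bound m))
        where
        bounded : ∀ {A B} → l ⊑ A → m ⊑ B → ∃ λ M → ∀ n → M ℕ.≤ n → (s n *ᶜ t n -ᶜ l *ᶜ m) ⊑ ε
        bounded {A} {B} l⊑ m⊑ = let (M , a) = p δ 0<δ ; (M′ , b) = q δ 0<δ in M ℕ.+ M′ , λ n K≤n → close n
            (a n (ℕₚ.≤-trans (ℕₚ.m≤m+n M M′) K≤n)) (b n (ℕₚ.≤-trans (ℕₚ.m≤n+m M′ M) K≤n))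
          where
          scaled : ∃ λ δ → 0# < δ × δ ≤ 1# × δ * ((1# + A) + B) ≤ ε
          scaled = scale-down ε ((1# + A) + B) 0<ε (0<-+ (0<-+ 0<1 (0≤bound l⊑)) (0≤bound m⊑))
          δ : ℝ
          δ = proj₁ scaled
          0<δ : 0# < δ
          0<δ = proj₁ (proj₂ scaled)
          δ≤1 : δ ≤ 1#
          δ≤1 = proj₁ (proj₂ (proj₂ scaled))
          δC≤ε : δ * ((1# + A) + B) ≤ ε
          δC≤ε = proj₂ (proj₂ (proj₂ scaled))
          close : ∀ n → (s n -ᶜ l) ⊑ δ → (t n -ᶜ m) ⊑ δ → (s n *ᶜ t n -ᶜ l *ᶜ m) ⊑ ε
          close n s-l t-m = ⊑-weaken δC≤ε (⊑-resp
            (solveᶜ 4 (λ s t l m → ((s ⊝ l) ⊗ (t ⊝ m) ⊕ l ⊗ (t ⊝ m)) ⊕ (s ⊝ l) ⊗ m ⩵ s ⊗ t ⊝ l ⊗ m) reflᶜ (s n) (t n) l m)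
            (solve 4 (λ d e x y → (e :* d :+ x :* d) :+ d :* y := d :* ((e :+ x) :+ y)) refl δ 1# A B)
            (⊑-+ (⊑-+ (⊑-* (⊑-weaken δ≤1 s-l) t-m) (⊑-* l⊑ t-m)) (⊑-* s-l m⊑)))

      -- One late term lies within u of the limit, so 2u comes without a further ε. The lost factor
      -- 2 is absorbed into the constant of `remainder`.
      tends-⊑ : ∀ {s l u} → 0# < u → (∃ λ M → ∀ n → M ℕ.≤ n → s n ⊑ u) → Tends s l → l ⊑ u + u
      tends-⊑ {s} {l} {u} 0<u (M , a) p = let (M′ , b) = p u 0<u ; K = M ℕ.+ M′ in ⊑-resp (solveᶜ 2 (λ s l → s ⊝ (s ⊝ l) ⩵ l) reflᶜ (s K) l) refl
        (⊑-- (a K (ℕₚ.m≤m+n M M′)) (b K (ℕₚ.m≤n+m M′ M)))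

      tends-re-≤ : ∀ {s l x} → (∃ λ M → ∀ n → M ℕ.≤ n → re (s n) ≤ x) → Tends s l → re l ≤ x
      tends-re-≤ {s} {l} {x} (M , a) p = ≤-+ε bound
        where
        bound : ∀ ε → 0# < ε → re l ≤ x + ε
        bound ε 0<ε = let (M′ , b) = p ε 0<ε ; K = M ℕ.+ M′ in ≤-trans (≤-refl (solve 2 (λ s l → l := s :+ (:- (s :- l))) refl (re (s K)) (re l)))
          (+-mono-≤ (a K (ℕₚ.m≤m+n M M′)) (⊑-re (⊑-neg (b K (ℕₚ.m≤n+m M′ M)))))

      tends-≤-re : ∀ {s l x} → (∃ λ M → ∀ n → M ℕ.≤ n → x ≤ re (s n)) → Tends s l → x ≤ re l
      tends-≤-re {s} {l} {x} (M , a) p = ≤-+ε bound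
        where
        bound : ∀ ε → 0# < ε → x ≤ re l + ε
        bound ε 0<ε = let (M′ , b) = p ε 0<ε ; K = M ℕ.+ M′ in ≤-trans (a K (ℕₚ.m≤m+n M M′)) (≤-trans
          (≤-refl (solve 2 (λ s l → s := l :+ (s :- l)) refl (re (s K)) (re l)))
          (+-mono-≤ (≤-refl refl) (⊑-re (b K (ℕₚ.m≤n+m M′ M)))))

  open ComplexLimits public

  -- Geometrically bounded series and Cauchy products.

  module PowerSeries where

    abstract
      partialSum-cong : ∀ {s t} → (∀ n → s n ≈ᶜ t n) → ∀ n → partialSum s n ≈ᶜ partialSum t n
      partialSum-cong e zero    = reflᶜ
      partialSum-cong e (suc n) = +ᶜ-cong (partialSum-cong e n) (e n)

      partialSum-suc : ∀ t n → partialSum t (suc n) ≈ᶜ t 0 +ᶜ partialSum (t ∘ suc) n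
      partialSum-suc t zero    = +ᶜ-comm 0ᶜ (t 0)
      partialSum-suc t (suc n) = transᶜ (+ᶜ-congʳ (partialSum-suc t n)) (+ᶜ-assoc _ _ _)

      partialSum-+ : ∀ s t n → partialSum (λ i → s i +ᶜ t i) n ≈ᶜ partialSum s n +ᶜ partialSum t n
      partialSum-+ s t zero    = symᶜ (+ᶜ-identityʳ 0ᶜ)
      partialSum-+ s t (suc n) = transᶜ (+ᶜ-congʳ (partialSum-+ s t n))
        (solveᶜ 4 (λ a b c d → (a ⊕ b) ⊕ (c ⊕ d) ⩵ (a ⊕ c) ⊕ (b ⊕ d)) reflᶜ _ _ _ _)

      partialSum-* : ∀ k t n → partialSum (λ i → k *ᶜ t i) n ≈ᶜ k *ᶜ partialSum t n
      partialSum-* k t zero    = symᶜ (zeroʳᶜ k)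
      partialSum-* k t (suc n) = transᶜ (+ᶜ-congʳ (partialSum-* k t n))
        (solveᶜ 3 (λ k a b → k ⊗ a ⊕ k ⊗ b ⩵ k ⊗ (a ⊕ b)) reflᶜ _ _ _)

      partialSum-0 : ∀ {t} → (∀ n → t n ≈ᶜ 0ᶜ) → ∀ n → partialSum t n ≈ᶜ 0ᶜ
      partialSum-0 e zero    = reflᶜ
      partialSum-0 e (suc n) = transᶜ (+ᶜ-cong (partialSum-0 e n) (e n)) (+ᶜ-identityʳ 0ᶜ)

      -- The first term is peeled off: what remains is the same situation with Kr for K, and 2Kr ≤
      -- K.
      partialSum-geometric : ∀ {r} → 0# ≤ r → r + r ≤ 1# → ∀ n {t K} → 0# ≤ K →
                             (∀ i → t i ⊑ K * r ^ʳ i) → partialSum t n ⊑ K + K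
      partialSum-geometric 0≤r 2r≤1 zero 0≤K p = ⊑-0 (0≤-+ 0≤K 0≤K)
      partialSum-geometric {r} 0≤r 2r≤1 (suc n) {t} {K} 0≤K p = ⊑-weaken (+-mono-≤ (≤-refl refl) 2Kr≤K)
        (⊑-resp (symᶜ (partialSum-suc t n)) refl (⊑-+ (⊑-resp reflᶜ (*-identityʳ K) (p 0))
          (partialSum-geometric 0≤r 2r≤1 n (0≤-* 0≤K 0≤r) λ i → ⊑-resp reflᶜ (sym (*-assoc K r _)) (p (suc i)))))
        where
        2Kr≤K : K * r + K * r ≤ K
        2Kr≤K = 0≤-⇒≤ (≤-resp-≈ refl
          (trans (solve 3 (λ k r e → k :* (e :- (r :+ r)) := k :* e :- (k :* r :+ k :* r)) refl K r 1#) (+-congʳ (*-identityʳ K)))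
          (0≤-* 0≤K (≤⇒0≤- 2r≤1)))

      -- The ratio of consecutive values is (n+2)ρ/(n+1), at most 1 because 2ρ ≤ 1. Together with
      -- the Archimedean property this makes Cρⁿ small.
      geometric-step : ∀ {ρ} → 0# ≤ ρ → ρ + ρ ≤ 1# → ∀ n → fromℕ (suc n) * ρ ^ʳ n ≤ 1#
      geometric-step 0≤ρ 2ρ≤1 zero = ≤-refl (trans (*-identityʳ _) (+-identityʳ 1#))
      geometric-step {ρ} 0≤ρ 2ρ≤1 (suc n) = ≤-trans (bound (fromℕ n) (fromℕ-nonneg n) (^ʳ-nonneg 0≤ρ n)) (geometric-step 0≤ρ 2ρ≤1 n)
        where
        bound : ∀ {P} m → 0# ≤ m → 0# ≤ P → (1# + (1# + m)) * (ρ * P) ≤ (1# + m) * P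
        bound {P} m 0≤m 0≤P = 0≤-⇒≤ (≤-resp-≈ refl
          (trans (solve 4 (λ e m p r → ((e :+ m) :* (e :- (r :+ r))) :* p :+ m :* (r :* p)
                    := ((e :+ m) :* p) :* e :- (e :+ (e :+ m)) :* (r :* p)) refl 1# m P ρ)
            (+-congʳ (*-identityʳ _)))
          (0≤-+ (0≤-* (0≤-* (0≤-+ (<⇒≤ 0<1) 0≤m) (≤⇒0≤- 2ρ≤1)) 0≤P) (0≤-* 0≤m (0≤-* 0≤ρ 0≤P))))

      geometric-vanishing : ∀ {ρ C} → 0# ≤ ρ → ρ + ρ ≤ 1# → ∀ ε → 0# < ε → ∃ λ M → ∀ n → M ℕ.≤ n → C * ρ ^ʳ n ≤ ε
      geometric-vanishing {ρ} {C} 0≤ρ 2ρ≤1 ε 0<ε = M , λ n M≤n → ≤-trans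
        (*-monoˡ′ (^ʳ-nonneg 0≤ρ n) (≤-trans C≤Mε (*-monoˡ′ (<⇒≤ 0<ε) (fromℕ-mono (ℕₚ.m≤n⇒m≤1+n M≤n)))))
        (0≤-⇒≤ (≤-resp-≈ refl
          (trans (solve 4 (λ ε m p e → ε :* (e :- m :* p) := ε :* e :- (m :* ε) :* p) refl ε (fromℕ (suc n)) (ρ ^ʳ n) 1#) (+-congʳ (*-identityʳ ε)))
          (0≤-* (<⇒≤ 0<ε) (≤⇒0≤- (geometric-step 0≤ρ 2ρ≤1 n)))))
        where
        *-monoˡ′ : ∀ {x y k} → 0# ≤ k → x ≤ y → x * k ≤ y * k
        *-monoˡ′ {x} {y} {k} 0≤k x≤y = 0≤-⇒≤ (≤-resp-≈ refl (solve 3 (λ x y k → (y :- x) :* k := y :* k :- x :* k) refl x y k)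
          (0≤-* (≤⇒0≤- x≤y) 0≤k))
        i : ℝ
        i = inverse ε 0<ε
        M : ℕ
        M = proj₁ (archimedean (C * i))
        C≤Mε : C ≤ fromℕ M * ε
        C≤Mε = ≤-trans (≤-refl (trans (sym (*-identityʳ C)) (trans (*-congˡ (sym (inverse-correct ε 0<ε)))
            (solve 3 (λ c e i → c :* (e :* i) := (c :* i) :* e) refl C ε i))))
          (*-monoˡ′ (<⇒≤ 0<ε) (<⇒≤ (proj₂ (archimedean (C * i)))))

    -- The Cauchy product Σ_{i + j = n} a i * b j.
    conv : (ℕ → ℂ) → (ℕ → ℂ) → ℕ → ℂ
    conv a b zero    = a 0 *ᶜ b 0
    conv a b (suc n) = a 0 *ᶜ b (suc n) +ᶜ conv (a ∘ suc) b n

    abstract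
      conv-cong : ∀ {a a′ b b′} → (∀ i → a i ≈ᶜ a′ i) → (∀ i → b i ≈ᶜ b′ i) → ∀ n → conv a b n ≈ᶜ conv a′ b′ n
      conv-cong p q zero    = *ᶜ-cong (p 0) (q 0)
      conv-cong p q (suc n) = +ᶜ-cong (*ᶜ-cong (p 0) (q (suc n))) (conv-cong (p ∘ suc) q n)

      conv-+ˡ : ∀ a a′ b n → conv (λ i → a i +ᶜ a′ i) b n ≈ᶜ conv a b n +ᶜ conv a′ b n
      conv-+ˡ a a′ b zero    = solveᶜ 3 (λ a c b → (a ⊕ c) ⊗ b ⩵ a ⊗ b ⊕ c ⊗ b) reflᶜ _ _ _
      conv-+ˡ a a′ b (suc n) = transᶜ (+ᶜ-congˡ (conv-+ˡ (a ∘ suc) (a′ ∘ suc) b n))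
        (solveᶜ 5 (λ a c b x y → (a ⊕ c) ⊗ b ⊕ (x ⊕ y) ⩵ (a ⊗ b ⊕ x) ⊕ (c ⊗ b ⊕ y)) reflᶜ (a 0) (a′ 0) (b (suc n)) (conv (a ∘ suc) b n) (conv (a′ ∘ suc) b n))

      conv-*ˡ : ∀ k a b n → conv (λ i → k *ᶜ a i) b n ≈ᶜ k *ᶜ conv a b n
      conv-*ˡ k a b zero    = *ᶜ-assoc k _ _
      conv-*ˡ k a b (suc n) = transᶜ (+ᶜ-congˡ (conv-*ˡ k (a ∘ suc) b n))
        (solveᶜ 4 (λ k a b x → (k ⊗ a) ⊗ b ⊕ k ⊗ x ⩵ k ⊗ (a ⊗ b ⊕ x)) reflᶜ _ _ _ _)

      conv-*ʳ : ∀ k a b n → conv a (λ i → k *ᶜ b i) n ≈ᶜ k *ᶜ conv a b n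
      conv-*ʳ k a b zero    = solveᶜ 3 (λ k a b → a ⊗ (k ⊗ b) ⩵ k ⊗ (a ⊗ b)) reflᶜ _ _ _
      conv-*ʳ k a b (suc n) = transᶜ (+ᶜ-congˡ (conv-*ʳ k (a ∘ suc) b n))
        (solveᶜ 4 (λ k a b x → a ⊗ (k ⊗ b) ⊕ k ⊗ x ⩵ k ⊗ (a ⊗ b ⊕ x)) reflᶜ _ _ _ _)

      conv-0ˡ : ∀ {a} b → a 0 ≈ᶜ 0ᶜ → ∀ n → conv a b (suc n) ≈ᶜ conv (a ∘ suc) b n
      conv-0ˡ {a} b a₀≈0 n = transᶜ (+ᶜ-congʳ (transᶜ (*ᶜ-congʳ a₀≈0) (zeroˡᶜ _))) (+ᶜ-identityˡ _)

      conv-0ʳ : ∀ a {b} → b 0 ≈ᶜ 0ᶜ → ∀ n → conv a b (suc n) ≈ᶜ conv a (b ∘ suc) n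
      conv-0ʳ a b₀≈0 zero    = transᶜ (+ᶜ-congˡ (transᶜ (*ᶜ-congˡ b₀≈0) (zeroʳᶜ _))) (+ᶜ-identityʳ _)
      conv-0ʳ a b₀≈0 (suc n) = +ᶜ-congˡ (conv-0ʳ (a ∘ suc) b₀≈0 n)

      partialSum-conv : ∀ a b n → partialSum (conv a b) (suc n) ≈ᶜ
                        a 0 *ᶜ partialSum b (suc n) +ᶜ partialSum (conv (a ∘ suc) b) n
      partialSum-conv a b zero    = solveᶜ 2 (λ a b → κ +0 ⊕ a ⊗ b ⩵ a ⊗ (κ +0 ⊕ b) ⊕ κ +0) reflᶜ (a 0) (b 0)
      partialSum-conv a b (suc n) = transᶜ (+ᶜ-congʳ (partialSum-conv a b n))
        (solveᶜ 5 (λ a b x y z → (a ⊗ x ⊕ y) ⊕ (a ⊗ b ⊕ z) ⩵ a ⊗ (x ⊕ b) ⊕ (y ⊕ z)) reflᶜ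
          (a 0) (b (suc n)) (partialSum b (suc n)) (partialSum (conv (a ∘ suc) b) n) (conv (a ∘ suc) b n))

      -- Mertens' theorem for geometrically bounded terms, with the rate (2r)ⁿ.
      cauchyProduct-error : ∀ {r J b} → 0# ≤ r → r + r ≤ 1# → 0# ≤ J → (∀ j → b j ⊑ J * r ^ʳ j) →
        ∀ n {a K} → 0# ≤ K → (∀ i → a i ⊑ K * r ^ʳ i) →
        (partialSum a n *ᶜ partialSum b n -ᶜ partialSum (conv a b) n) ⊑ (K * J + K * J) * (r + r) ^ʳ n
      cauchyProduct-error {r} {J} {b} 0≤r 2r≤1 0≤J q zero {a} {K} 0≤K p =
        ⊑-resp (solveᶜ 0 (κ +0 ⩵ κ +0 ⊗ κ +0 ⊝ κ +0) reflᶜ) refl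
          (⊑-0 (0≤-* (0≤-+ (0≤-* 0≤K 0≤J) (0≤-* 0≤K 0≤J)) (<⇒≤ 0<1)))
      cauchyProduct-error {r} {J} {b} 0≤r 2r≤1 0≤J q (suc n) {a} {K} 0≤K p =
        ⊑-weaken bound (⊑-resp (symᶜ split) refl (⊑-+ (⊑-* A′⊑ (q n)) (cauchyProduct-error 0≤r 2r≤1 0≤J q n 0≤Kr p′)))
        where
        a′ : ℕ → ℂ
        a′ = a ∘ suc
        A′ B C′ : ℂ
        A′ = partialSum a′ n
        B  = partialSum b n
        C′ = partialSum (conv a′ b) n
        0≤Kr : 0# ≤ K * r
        0≤Kr = 0≤-* 0≤K 0≤r
        p′ : ∀ i → a′ i ⊑ (K * r) * r ^ʳ i
        p′ i = ⊑-resp reflᶜ (sym (*-assoc K r _)) (p (suc i))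
        A′⊑ : A′ ⊑ K * r + K * r
        A′⊑ = partialSum-geometric 0≤r 2r≤1 n 0≤Kr p′
        -- The a₀ terms cancel: the error is A′bₙ plus the error for the shifted sequence `a ∘ suc`,
        -- to which the induction applies with Kr for K.
        split : partialSum a (suc n) *ᶜ partialSum b (suc n) -ᶜ partialSum (conv a b) (suc n)
                ≈ᶜ A′ *ᶜ b n +ᶜ (A′ *ᶜ B -ᶜ C′)
        split = transᶜ (-ᶜ-cong₂ (*ᶜ-congʳ (partialSum-suc a n)) (partialSum-conv a b n))
          (solveᶜ 5 (λ a A B b C → (a ⊕ A) ⊗ (B ⊕ b) ⊝ (a ⊗ (B ⊕ b) ⊕ C) ⩵ A ⊗ b ⊕ (A ⊗ B ⊝ C)) reflᶜ (a 0) A′ B (b n) C′)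
        bound : (K * r + K * r) * (J * r ^ʳ n) + ((K * r) * J + (K * r) * J) * (r + r) ^ʳ n
                ≤ (K * J + K * J) * ((r + r) * (r + r) ^ʳ n)
        bound = 0≤-⇒≤ (≤-resp-≈ refl
          (solve 5 (λ k r j x y → ((k :* r :+ k :* r) :* j) :* (y :- x) :=
            (k :* j :+ k :* j) :* ((r :+ r) :* y) :- ((k :* r :+ k :* r) :* (j :* x) :+ ((k :* r) :* j :+ (k :* r) :* j) :* y))
            refl K r J (r ^ʳ n) ((r + r) ^ʳ n))
          (0≤-* (0≤-* (0≤-+ 0≤Kr 0≤Kr) 0≤J) (≤⇒0≤- (^ʳ-monoˡ-≤ 0≤r
            (≤-trans (≤-refl (sym (+-identityʳ r))) (+-mono-≤ (≤-refl refl) 0≤r)) n))))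

  open PowerSeries public

  -- The exponential series.

  module Exponential where

    open CommutativeExpProperties (CommutativeRing.commutativeSemiring commutativeRing) public using ()
      renaming (^-distrib-* to ^ʳ-distrib-*)

    ofℕ : ℕ → ℂ
    ofℕ n = ofReal (fromℕ n)

    1/! : ℕ → ℝ
    1/! n = 1/ (n !) {{ℕₚ._!≢0 n}}

    abstract
      quarter-exists : ∃ λ q → 0# ≤ q × fromℕ 4 * q ≈ 1#
      quarter-exists = 1/ 4 , <⇒≤ (inverse-pos _ _) , 1/-correct 4

    -- The ratio r of the geometric bound on the exponential terms. The error of their Cauchy
    -- product decays like (2r)ⁿ, and `geometric-vanishing` asks for 2(2r) ≤ 1, hence r = 1/4.
    quarter : ℝ
    quarter = proj₁ quarter-exists

    abstract
      0≤quarter : 0# ≤ quarter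
      0≤quarter = proj₁ (proj₂ quarter-exists)

      4*quarter : fromℕ 4 * quarter ≈ 1#
      4*quarter = proj₂ (proj₂ quarter-exists)

      1/!-nonneg : ∀ n → 0# ≤ 1/! n
      1/!-nonneg n = <⇒≤ (inverse-pos _ _)

      n!*1/! : ∀ n → fromℕ (n !) * 1/! n ≈ 1#
      n!*1/! n = 1/-correct (n !) {{ℕₚ._!≢0 n}}

      fromℕ-1 : fromℕ 1 ≈ 1#
      fromℕ-1 = +-identityʳ 1#

      1/!-0 : 1/! 0 ≈ 1#
      1/!-0 = trans (sym (*-identityˡ _)) (trans (*-congʳ (sym fromℕ-1)) (n!*1/! 0))

      1/!-suc : ∀ n → fromℕ (suc n) * 1/! (suc n) ≈ 1/! n
      1/!-suc n = begin
        s * i′                         ≈⟨ *-identityʳ _ ⟨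
        (s * i′) * 1#                  ≈⟨ *-congˡ (n!*1/! n) ⟨
        (s * i′) * (f * 1/! n)         ≈⟨ solve 4 (λ s i f j → (s :* i) :* (f :* j) := ((s :* f) :* i) :* j) refl s i′ f (1/! n) ⟩
        ((s * f) * i′) * 1/! n         ≈⟨ *-congʳ (*-congʳ (×1-homo-* (suc n) (n !))) ⟨
        (fromℕ (suc n !) * i′) * 1/! n ≈⟨ *-congʳ (n!*1/! (suc n)) ⟩
        1# * 1/! n                     ≈⟨ *-identityˡ _ ⟩
        1/! n                          ∎
        where
        open SetoidReasoning setoid
        s f i′ : ℝ
        s  = fromℕ (suc n)
        f  = fromℕ (n !)
        i′ = 1/! (suc n)

      ofℕ-suc-cancel : ∀ n {z w} → ofℕ (suc n) *ᶜ z ≈ᶜ ofℕ (suc n) *ᶜ w → z ≈ᶜ w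
      ofℕ-suc-cancel n {z} {w} p = transᶜ (symᶜ (cancel z)) (transᶜ (*ᶜ-congˡ p) (cancel w))
        where
        cancel : ∀ z → ofReal (1/ (suc n)) *ᶜ (ofℕ (suc n) *ᶜ z) ≈ᶜ z
        cancel z = transᶜ (symᶜ (*ᶜ-assoc _ _ z)) (transᶜ (*ᶜ-congʳ (transᶜ (symᶜ (ofReal-* _ _))
          (ofReal-cong (trans (*-comm _ _) (1/-correct (suc n)))))) (*ᶜ-identityˡ z))

      expTerm-0 : ∀ z → expTerm z 0 ≈ᶜ 1ᶜ
      expTerm-0 z = transᶜ (*ᶜ-identityʳ _) (ofReal-cong 1/!-0)

      expTerm-suc : ∀ z n → ofℕ (suc n) *ᶜ expTerm z (suc n) ≈ᶜ z *ᶜ expTerm z n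
      expTerm-suc z n = begin
        ofℕ (suc n) *ᶜ (ofReal (1/! (suc n)) *ᶜ (z *ᶜ z ^ᶜ n)) ≈⟨ *ᶜ-assoc _ _ _ ⟨
        (ofℕ (suc n) *ᶜ ofReal (1/! (suc n))) *ᶜ (z *ᶜ z ^ᶜ n) ≈⟨ *ᶜ-congʳ (ofReal-* _ _) ⟨
        ofReal (fromℕ (suc n) * 1/! (suc n)) *ᶜ (z *ᶜ z ^ᶜ n) ≈⟨ *ᶜ-congʳ (ofReal-cong (1/!-suc n)) ⟩
        ofReal (1/! n) *ᶜ (z *ᶜ z ^ᶜ n)                        ≈⟨ solveᶜ 3 (λ i z x → i ⊗ (z ⊗ x) ⩵ z ⊗ (i ⊗ x)) reflᶜ _ _ _ ⟩
        z *ᶜ expTerm z n                                       ∎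
        where open SetoidReasoning ℂ-setoid

      expTerm-cong : ∀ {z w} → z ≈ᶜ w → ∀ n → expTerm z n ≈ᶜ expTerm w n
      expTerm-cong p n = *ᶜ-congˡ (^ᶜ-congˡ n p)

      exp-tends : ∀ z → Tends (partialSum (expTerm z)) (exp z)
      exp-tends z ε 0<ε with half 0<ε
      ... | h , 0<h , h+h≈ε with proj₂ (complete (re ∘ partialSum (expTerm z)) (ExpConvergence.re-cauchy z)) h 0<h
                               | proj₂ (complete (im ∘ partialSum (expTerm z)) (ExpConvergence.im-cauchy z)) h 0<h
      ... | M , p | M′ , q = M ℕ.+ M′ , λ n K≤n → ⊑-resp reflᶜ h+h≈ε (norm≤ (0≤-+ 0≤h 0≤h)
        (≤-trans (+-mono-≤ (square (p n (ℕₚ.≤-trans (ℕₚ.m≤m+n M M′) K≤n))) (square (q n (ℕₚ.≤-trans (ℕₚ.m≤n+m M′ M) K≤n))))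
          (0≤-⇒≤ (≤-resp-≈ refl (solve 1 (λ h → h :* h :+ h :* h := (h :+ h) :* (h :+ h) :- (h :* h :+ h :* h)) refl h)
            (0≤-+ (sq-nonneg h) (sq-nonneg h))))))
        where
        0≤h : 0# ≤ h
        0≤h = <⇒≤ 0<h
        square : ∀ {x l} → (x - l < h) × (l - x < h) → (x - l) * (x - l) ≤ h * h
        square {x} {l} (lt , gt) = proj₁ (ExpConvergence.bounded-* 0≤h 0≤h b b)
          where
          b : ExpConvergence.Bounded (x - l) h
          b = <⇒≤ lt , ≤-trans (≤-refl (solve 2 (λ x l → :- (x :- l) := l :- x) refl x l)) (<⇒≤ gt)

      exp-cong : ∀ {z w} → z ≈ᶜ w → exp z ≈ᶜ exp w
      exp-cong {z} {w} p = tends-unique (tends-resp (partialSum-cong (expTerm-cong p)) reflᶜ (exp-tends z)) (exp-tends w)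

      exp-0 : exp 0ᶜ ≈ᶜ 1ᶜ
      exp-0 = tends-unique (exp-tends 0ᶜ) λ ε 0<ε → 1 , λ n 1≤n → close (<⇒≤ 0<ε) n 1≤n
        where
        sum : ∀ n → partialSum (expTerm 0ᶜ) (suc n) ≈ᶜ 1ᶜ
        sum n = transᶜ (partialSum-suc (expTerm 0ᶜ) n) (transᶜ (+ᶜ-cong (expTerm-0 0ᶜ)
          (partialSum-0 (λ n → transᶜ (*ᶜ-congˡ (zeroˡᶜ _)) (zeroʳᶜ _)) n)) (+ᶜ-identityʳ 1ᶜ))
        close : ∀ {ε} → 0# ≤ ε → ∀ n → 1 ℕ.≤ n → (partialSum (expTerm 0ᶜ) n -ᶜ 1ᶜ) ⊑ ε
        close 0≤ε (suc n) _ = ⊑-resp (symᶜ (transᶜ (-ᶜ-cong₂ (sum n) reflᶜ) (-ᶜ-inverseʳ 1ᶜ))) refl (⊑-0 0≤ε)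

      -- The factor bᵇ covers n ≤ b; beyond that, each new b on the left is matched by a factor n +
      -- 1 ≥ b of the factorial.
      power-≤-! : ∀ b → .{{NonZero b}} → ∀ n → b ℕ.^ n ℕ.≤ b ℕ.^ b ℕ.* n !
      power-≤-! b n with ℕₚ.≤-total n b
      power-≤-! b n       | inj₁ n≤b = ℕₚ.≤-trans (ℕₚ.^-monoʳ-≤ b n≤b) (ℕₚ.m≤m*n (b ℕ.^ b) (n !) {{ℕₚ._!≢0 n}})
      power-≤-! b zero    | inj₂ b≤n = ℕ.>-nonZero⁻¹ _ {{ℕₚ.m*n≢0 (b ℕ.^ b) 1 {{ℕₚ.m^n≢0 b b}}}}
      power-≤-! b (suc n) | inj₂ b≤n = begin
        b ℕ.* b ℕ.^ n                       ≤⟨ ℕₚ.*-mono-≤ b≤n (power-≤-! b n) ⟩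
        suc n ℕ.* (b ℕ.^ b ℕ.* n !)         ≡⟨ ℕₚ.*-assoc (suc n) (b ℕ.^ b) (n !) ⟨
        suc n ℕ.* b ℕ.^ b ℕ.* n !           ≡⟨ ≡.cong (ℕ._* n !) (ℕₚ.*-comm (suc n) (b ℕ.^ b)) ⟩
        b ℕ.^ b ℕ.* suc n ℕ.* n !           ≡⟨ ℕₚ.*-assoc (b ℕ.^ b) (suc n) (n !) ⟩
        b ℕ.^ b ℕ.* (suc n ℕ.* n !)         ∎
        where open ℕₚ.≤-Reasoning

      fromℕ-^ : ∀ b n → fromℕ (b ℕ.^ n) ≈ fromℕ b ^ʳ n
      fromℕ-^ b zero    = fromℕ-1
      fromℕ-^ b (suc n) = trans (×1-homo-* b (b ℕ.^ n)) (*-congˡ (fromℕ-^ b n))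

      -- With ∣z∣ ≤ X + 1 and b = 4(X+1), the n-th term is at most (bⁿ/n!)·4⁻ⁿ ≤ bᵇ·4⁻ⁿ.
      expTerm-⊑ : ∀ z → ∃ λ K → 0# ≤ K × (∀ n → expTerm z n ⊑ K * quarter ^ʳ n)
      expTerm-⊑ z with ⊑-bound z
      ... | X , z⊑ = K , fromℕ-nonneg (b ℕ.^ b) , λ n →
        ⊑-weaken (bound n) (⊑-* (⊑-ofReal (1/!-nonneg n)) (⊑-^ z⊑ n))
        where
        b : ℕ
        b = 4 ℕ.* suc X
        x r K : ℝ
        x = fromℕ (suc X)
        r = quarter
        K = fromℕ (b ℕ.^ b)
        0≤r : 0# ≤ r
        0≤r = 0≤quarter
        power : ∀ n → fromℕ (b ℕ.^ n) * r ^ʳ n ≈ x ^ʳ n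
        power n = begin
          fromℕ (b ℕ.^ n) * r ^ʳ n   ≈⟨ *-congʳ (fromℕ-^ b n) ⟩
          fromℕ b ^ʳ n * r ^ʳ n      ≈⟨ ^ʳ-distrib-* (fromℕ b) r n ⟨
          (fromℕ b * r) ^ʳ n         ≈⟨ ^ʳ-congˡ n br≈x ⟩
          x ^ʳ n                     ∎
          where
          open SetoidReasoning setoid
          br≈x : fromℕ b * r ≈ x
          br≈x = trans (*-congʳ (×1-homo-* 4 (suc X))) (trans
            (solve 3 (λ f x r → (f :* x) :* r := x :* (f :* r)) refl (fromℕ 4) x r)
            (trans (*-congˡ 4*quarter) (*-identityʳ x)))
        bound : ∀ n → 1/! n * x ^ʳ n ≤ K * r ^ʳ n
        bound n = ≤-trans (≤-refl (*-congˡ (sym (power n)))) (≤-trans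
          (*-mono-≤ (1/!-nonneg n) (0≤-* (0≤-* (fromℕ-nonneg (b ℕ.^ b)) (fromℕ-nonneg (n !))) (^ʳ-nonneg 0≤r n)) (≤-refl refl)
            (*-mono-≤ (fromℕ-nonneg (b ℕ.^ n)) (^ʳ-nonneg 0≤r n)
              (≤-trans (fromℕ-mono (power-≤-! b n)) (≤-refl (×1-homo-* (b ℕ.^ b) (n !)))) (≤-refl refl)))
          (≤-refl (trans (solve 4 (λ i k f p → i :* ((k :* f) :* p) := (f :* i) :* (k :* p)) refl (1/! n) K (fromℕ (n !)) (r ^ʳ n))
            (trans (*-congʳ (n!*1/! n)) (*-identityˡ _)))))

    private
      θ : (ℕ → ℂ) → ℕ → ℂ
      θ a n = ofℕ n *ᶜ a n

    abstract
      -- The Leibniz rule for the derivation x d/dx.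
      conv-θ : ∀ a b n → ofℕ n *ᶜ conv a b n ≈ᶜ conv (θ a) b n +ᶜ conv a (θ b) n
      conv-θ a b zero    = solveᶜ 2 (λ a b → κ +0 ⊗ (a ⊗ b) ⩵ (κ +0 ⊗ a) ⊗ b ⊕ a ⊗ (κ +0 ⊗ b)) reflᶜ (a 0) (b 0)
      conv-θ a b (suc n) = begin
        s *ᶜ (a 0 *ᶜ b (suc n) +ᶜ conv a′ b n)
          ≈⟨ transᶜ (*ᶜ-congʳ (s≈ {n})) (transᶜ
               (solveᶜ 5 (λ e n a b x → (e ⊕ n) ⊗ (a ⊗ b ⊕ x) ⩵ (e ⊗ x ⊕ a ⊗ ((e ⊕ n) ⊗ b)) ⊕ n ⊗ x) reflᶜ 1ᶜ (ofℕ n) (a 0) (b (suc n)) (conv a′ b n))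
               (+ᶜ-congʳ (+ᶜ-cong (*ᶜ-identityˡ _) (*ᶜ-congˡ (*ᶜ-congʳ (symᶜ (s≈ {n}))))))) ⟩
        (conv a′ b n +ᶜ a 0 *ᶜ θ b (suc n)) +ᶜ ofℕ n *ᶜ conv a′ b n
          ≈⟨ +ᶜ-congˡ (conv-θ a′ b n) ⟩
        (conv a′ b n +ᶜ a 0 *ᶜ θ b (suc n)) +ᶜ (conv (θ a′) b n +ᶜ conv a′ (θ b) n)
          ≈⟨ solveᶜ 4 (λ x y z w → (x ⊕ y) ⊕ (z ⊕ w) ⩵ (x ⊕ z) ⊕ (y ⊕ w)) reflᶜ _ _ _ _ ⟩
        (conv a′ b n +ᶜ conv (θ a′) b n) +ᶜ conv a (θ b) (suc n)
          ≈⟨ +ᶜ-congʳ (transᶜ (symᶜ (conv-+ˡ a′ (θ a′) b n)) (conv-cong θ-suc (λ _ → reflᶜ) n)) ⟩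
        conv (θ a ∘ suc) b n +ᶜ conv a (θ b) (suc n)
          ≈⟨ +ᶜ-congʳ (conv-0ˡ {θ a} b (zeroˡᶜ (a 0)) n) ⟨
        conv (θ a) b (suc n) +ᶜ conv a (θ b) (suc n) ∎
        where
        open SetoidReasoning ℂ-setoid
        a′ : ℕ → ℂ
        a′ = a ∘ suc
        s : ℂ
        s = ofℕ (suc n)
        s≈ : ∀ {n} → ofℕ (suc n) ≈ᶜ 1ᶜ +ᶜ ofℕ n
        s≈ {n} = ofReal-+ 1# (fromℕ n)
        θ-suc : ∀ i → a′ i +ᶜ θ a′ i ≈ᶜ θ a (suc i)
        θ-suc i = symᶜ (transᶜ (*ᶜ-congʳ (s≈ {i})) (transᶜ
          (solveᶜ 3 (λ e n a → (e ⊕ n) ⊗ a ⩵ e ⊗ a ⊕ n ⊗ a) reflᶜ 1ᶜ (ofℕ i) (a′ i)) (+ᶜ-congʳ (*ᶜ-identityˡ _))))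

      -- Induction in place of the binomial theorem: by the Leibniz rule `conv-θ`, (n+1) times the
      -- left side at n+1 is z + w times the left side at n, which is the recursion `expTerm-suc`
      -- satisfied by the right side.
      conv-expTerm : ∀ z w n → conv (expTerm z) (expTerm w) n ≈ᶜ expTerm (z +ᶜ w) n
      conv-expTerm z w zero    = transᶜ (*ᶜ-cong (expTerm-0 z) (expTerm-0 w)) (transᶜ (*ᶜ-identityʳ 1ᶜ) (symᶜ (expTerm-0 (z +ᶜ w))))
      conv-expTerm z w (suc n) = ofℕ-suc-cancel n (begin
        ofℕ (suc n) *ᶜ conv tz tw (suc n)               ≈⟨ conv-θ tz tw (suc n) ⟩
        conv (θ tz) tw (suc n) +ᶜ conv tz (θ tw) (suc n) ≈⟨ +ᶜ-cong left right ⟩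
        z *ᶜ conv tz tw n +ᶜ w *ᶜ conv tz tw n          ≈⟨ solveᶜ 3 (λ z w x → z ⊗ x ⊕ w ⊗ x ⩵ (z ⊕ w) ⊗ x) reflᶜ z w (conv tz tw n) ⟩
        (z +ᶜ w) *ᶜ conv tz tw n                        ≈⟨ *ᶜ-congˡ (conv-expTerm z w n) ⟩
        (z +ᶜ w) *ᶜ expTerm (z +ᶜ w) n                  ≈⟨ expTerm-suc (z +ᶜ w) n ⟨
        ofℕ (suc n) *ᶜ expTerm (z +ᶜ w) (suc n)         ∎)
        where
        open SetoidReasoning ℂ-setoid
        tz tw : ℕ → ℂ
        tz = expTerm z
        tw = expTerm w
        left : conv (θ tz) tw (suc n) ≈ᶜ z *ᶜ conv tz tw n
        left = transᶜ (conv-0ˡ {θ tz} tw (zeroˡᶜ (tz 0)) n)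
          (transᶜ (conv-cong (expTerm-suc z) (λ _ → reflᶜ) n) (conv-*ˡ z tz tw n))
        right : conv tz (θ tw) (suc n) ≈ᶜ w *ᶜ conv tz tw n
        right = transᶜ (conv-0ʳ tz {θ tw} (zeroˡᶜ (tw 0)) n)
          (transᶜ (conv-cong (λ _ → reflᶜ) (expTerm-suc w) n) (conv-*ʳ w tz tw n))

      quarter-quarter : (quarter + quarter) + (quarter + quarter) ≤ 1#
      quarter-quarter = ≤-refl (trans (sym (ExpConvergence.four* quarter)) 4*quarter)

  open Exponential public

  -- The addition law of the exponential.

  module ExponentialLaw where

    abstract
      -- The product of the partial sums tends to the product of the limits, and it differs from the
      -- partial sum for z + w by at most C(2r)ⁿ with 2r = 1/2.
      exp-+ : ∀ z w → exp (z +ᶜ w) ≈ᶜ exp z *ᶜ exp w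
      exp-+ z w with expTerm-⊑ z | expTerm-⊑ w
      ... | K , 0≤K , p | J , 0≤J , q = tends-unique (exp-tends (z +ᶜ w))
        (tends-close small (tends-* (exp-tends z) (exp-tends w)))
        where
        r : ℝ
        r = quarter
        0≤r : 0# ≤ r
        0≤r = 0≤quarter
        0≤r+r : 0# ≤ r + r
        0≤r+r = 0≤-+ 0≤r 0≤r
        2r≤1 : r + r ≤ 1#
        2r≤1 = ≤-trans (≤-trans (≤-refl (sym (+-identityʳ _))) (+-mono-≤ (≤-refl refl) 0≤r+r)) quarter-quarter
        C : ℝ
        C = K * J + K * J
        P Q : ℕ → ℂ
        P n = partialSum (expTerm z) n *ᶜ partialSum (expTerm w) n
        Q n = partialSum (conv (expTerm z) (expTerm w)) n
        small : ∀ ε → 0# < ε → ∃ λ M → ∀ n → M ℕ.≤ n →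
                (partialSum (expTerm (z +ᶜ w)) n -ᶜ partialSum (expTerm z) n *ᶜ partialSum (expTerm w) n) ⊑ ε
        small ε 0<ε with geometric-vanishing {r + r} {C} 0≤r+r quarter-quarter ε 0<ε
        ... | M , bound = M , λ n M≤n → ⊑-weaken (bound n M≤n) (⊑-resp
          (transᶜ (solveᶜ 2 (λ a b → ⊝ (a ⊝ b) ⩵ b ⊝ a) reflᶜ (P n) (Q n)) (-ᶜ-cong₂ (partialSum-cong (conv-expTerm z w) n) reflᶜ)) refl
          (⊑-neg (cauchyProduct-error 0≤r 2r≤1 0≤J q n 0≤K p)))

  open ExponentialLaw public

  -- Conjugation, the unit circle, the real exponential and logarithms.

  module ExponentialBounds where

    conj : ℂ → ℂ
    conj z = re z +i (- im z)

    exp-ofℕ* : ∀ n z → exp (ofℕ n *ᶜ z) ≈ᶜ exp z ^ᶜ n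
    exp-ofℕ* zero    z = transᶜ (exp-cong (zeroˡᶜ z)) exp-0
    exp-ofℕ* (suc n) z = transᶜ (exp-cong (transᶜ (*ᶜ-congʳ (ofReal-+ 1# (fromℕ n)))
      (transᶜ (solveᶜ 3 (λ e n z → (e ⊕ n) ⊗ z ⩵ e ⊗ z ⊕ n ⊗ z) reflᶜ 1ᶜ (ofℕ n) z) (+ᶜ-congʳ (*ᶜ-identityˡ z)))))
      (transᶜ (exp-+ z (ofℕ n *ᶜ z)) (*ᶜ-congˡ (exp-ofℕ* n z)))

    exp-inverse : ∀ z → exp z *ᶜ exp (-ᶜ z) ≈ᶜ 1ᶜ
    exp-inverse z = transᶜ (symᶜ (exp-+ z (-ᶜ z))) (transᶜ (exp-cong (-ᶜ-inverseʳ z)) exp-0)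

    conj-+ : ∀ z w → conj (z +ᶜ w) ≈ᶜ conj z +ᶜ conj w
    conj-+ z w = refl , sym (-‿+-comm _ _)

    conj-- : ∀ z w → conj (z -ᶜ w) ≈ᶜ conj z -ᶜ conj w
    conj-- z w = refl , sym (-‿+-comm _ _)

    conj-* : ∀ z w → conj (z *ᶜ w) ≈ᶜ conj z *ᶜ conj w
    conj-* z w = solve 4 (λ a b c d → a :* c :- b :* d := a :* c :- (:- b) :* (:- d)) refl (re z) (im z) (re w) (im w)
               , solve 4 (λ a b c d → :- (a :* d :+ b :* c) := a :* (:- d) :+ (:- b) :* c) refl (re z) (im z) (re w) (im w)

    conj-ofReal : ∀ x → conj (ofReal x) ≈ᶜ ofReal x
    conj-ofReal x = refl , -0#≈0#

    conj-^ : ∀ z n → conj (z ^ᶜ n) ≈ᶜ conj z ^ᶜ n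
    conj-^ z zero    = conj-ofReal 1#
    conj-^ z (suc n) = transᶜ (conj-* z (z ^ᶜ n)) (*ᶜ-congˡ (conj-^ z n))

    conj-partialSum : ∀ t n → conj (partialSum t n) ≈ᶜ partialSum (conj ∘ t) n
    conj-partialSum t zero    = conj-ofReal 0#
    conj-partialSum t (suc n) = transᶜ (conj-+ (partialSum t n) (t n)) (+ᶜ-congʳ (conj-partialSum t n))

    z*conj : ∀ z → z *ᶜ conj z ≈ᶜ ofReal ∣ z ∣²
    z*conj z = solve 2 (λ a b → a :* a :- b :* (:- b) := a :* a :+ b :* b) refl (re z) (im z)
             , solve 2 (λ a b → a :* (:- b) :+ b :* a := con +0) refl (re z) (im z)

    ⊑-conj : ∀ {z u} → z ⊑ u → conj z ⊑ u
    ⊑-conj {z} (norm≤ 0≤u b) = norm≤ 0≤u (≤-resp-≈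
      (solve 2 (λ a b → a :* a :+ b :* b := a :* a :+ (:- b) :* (:- b)) refl (re z) (im z)) refl b)

    abstract
      conj-exp : ∀ z → conj (exp z) ≈ᶜ exp (conj z)
      conj-exp z = tends-unique {partialSum (conj ∘ expTerm z)}
        (λ ε 0<ε → let (M , close) = exp-tends z ε 0<ε in M , λ n M≤n →
          ⊑-resp (transᶜ (conj-- (partialSum (expTerm z) n) (exp z)) (-ᶜ-cong₂ (conj-partialSum (expTerm z) n) reflᶜ)) refl
            (⊑-conj (close n M≤n)))
        (tends-resp (partialSum-cong (λ n → symᶜ (term n))) reflᶜ (exp-tends (conj z)))
        where
        term : ∀ n → conj (expTerm z n) ≈ᶜ expTerm (conj z) n
        term n = transᶜ (conj-* (ofReal (1/! n)) (z ^ᶜ n)) (*ᶜ-cong (conj-ofReal (1/! n)) (conj-^ z n))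

      -‿fixed⇒0 : ∀ {x} → - x ≈ x → x ≈ 0#
      -‿fixed⇒0 {x} p = ≤-antisym (λ 0<x → <-asym 0<x (<-respˡ-≈ p (<-respʳ-≈ -0#≈0# (neg-anti 0<x))))
                                 (λ x<0 → <-asym x<0 (<-respʳ-≈ p (neg-pos x<0)))
        where
        neg-anti : ∀ {x y} → x < y → - y < - x
        neg-anti {x} {y} x<y = 0<-⇒< (<-respʳ-≈ (solve 2 (λ x y → y :- x := (:- x) :- (:- y)) refl x y) (<⇒0<- x<y))

    -- Conjugation negates ix and commutes with `exp`, so the square of the absolute value is
    -- exp(ix) exp(-ix) = exp 0.
    unit-circle : ∀ x → ∣ exp (𝕚 *ᶜ ofReal x) ∣² ≈ 1#
    unit-circle x = proj₁ (begin
      ofReal ∣ e ∣²                        ≈⟨ z*conj e ⟨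
      e *ᶜ conj e                          ≈⟨ *ᶜ-congˡ (conj-exp ix) ⟩
      exp ix *ᶜ exp (conj ix)              ≈⟨ *ᶜ-congˡ (exp-cong conj-ix) ⟩
      exp ix *ᶜ exp (-ᶜ ix)                ≈⟨ exp-inverse ix ⟩
      1ᶜ                                   ∎)
      where
      open SetoidReasoning ℂ-setoid
      ix e : ℂ
      ix = 𝕚 *ᶜ ofReal x
      e = exp ix
      conj-ix : conj ix ≈ᶜ -ᶜ ix
      conj-ix = solve 2 (λ x e → con +0 :* x :- e :* con +0 := :- (con +0 :* x :- e :* con +0)) refl x 1# , refl

    abstract
      expʳ : ℝ → ℝ
      expʳ x = re (exp (ofReal x))

      -- A real argument is its own conjugate, so the imaginary part of its exponential equals its
      -- own negative.
      exp-ofReal : ∀ x → exp (ofReal x) ≈ᶜ ofReal (expʳ x)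
      exp-ofReal x = refl , -‿fixed⇒0 (proj₂ (transᶜ (conj-exp (ofReal x)) (exp-cong (conj-ofReal x))))

      expʳ-cong : ∀ {x y} → x ≈ y → expʳ x ≈ expʳ y
      expʳ-cong p = proj₁ (exp-cong (ofReal-cong p))

      expʳ-+ : ∀ x y → expʳ (x + y) ≈ expʳ x * expʳ y
      expʳ-+ x y = proj₁ (transᶜ (exp-cong (ofReal-+ x y)) (transᶜ (exp-+ (ofReal x) (ofReal y))
        (transᶜ (*ᶜ-cong (exp-ofReal x) (exp-ofReal y)) (symᶜ (ofReal-* _ _)))))

      expʳ-0 : expʳ 0# ≈ 1#
      expʳ-0 = proj₁ exp-0

      expʳ-inverse : ∀ x → expʳ x * expʳ (- x) ≈ 1#
      expʳ-inverse x = trans (sym (expʳ-+ x (- x))) (trans (expʳ-cong (-‿inverseʳ x)) expʳ-0)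

      expʳ-fromℕ : ∀ n → expʳ (fromℕ n) ≈ expʳ 1# ^ʳ n
      expʳ-fromℕ zero    = expʳ-0
      expʳ-fromℕ (suc n) = trans (expʳ-+ 1# (fromℕ n)) (*-congˡ (expʳ-fromℕ n))

      re-expTerm : ∀ x n → re (expTerm (ofReal x) n) ≈ 1/! n * x ^ʳ n
      re-expTerm x n = proj₁ (transᶜ (*ᶜ-congˡ (power n)) (symᶜ (ofReal-* (1/! n) (x ^ʳ n))))
        where
        power : ∀ n → ofReal x ^ᶜ n ≈ᶜ ofReal (x ^ʳ n)
        power zero    = reflᶜ
        power (suc n) = transᶜ (*ᶜ-congˡ (power n)) (symᶜ (ofReal-* x (x ^ʳ n)))

      1/!-1 : 1/! 1 ≈ 1#
      1/!-1 = trans (sym (*-identityˡ _)) (trans (*-congʳ (sym fromℕ-1)) (trans (1/!-suc 0) 1/!-0))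

      expʳ-lower : ∀ {x} → 0# ≤ x → 1# + x ≤ expʳ x
      expʳ-lower {x} 0≤x = tends-≤-re (2 , λ n 2≤n → ≡.subst (λ n → 1# + x ≤ S n) (ℕₚ.m+[n∸m]≡n 2≤n) (lower (n ℕ.∸ 2))) (exp-tends (ofReal x))
        where
        S : ℕ → ℝ
        S n = re (partialSum (expTerm (ofReal x)) n)
        lower : ∀ n → 1# + x ≤ S (2 ℕ.+ n)
        lower zero    = ≤-refl (+-cong
          (sym (trans (+-identityˡ _) (trans (re-expTerm x 0) (trans (*-identityʳ _) 1/!-0))))
          (sym (trans (re-expTerm x 1) (trans (*-cong 1/!-1 (*-identityʳ x)) (*-identityˡ x)))))
        lower (suc n) = ≤-trans (lower n) (≤-trans (≤-refl (sym (+-identityʳ (S (2 ℕ.+ n)))))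
          (+-mono-≤ (≤-refl refl) (≤-trans (0≤-* (1/!-nonneg (2 ℕ.+ n)) (^ʳ-nonneg 0≤x (2 ℕ.+ n))) (≤-refl (sym (re-expTerm x (2 ℕ.+ n)))))))

      1ʳ^ : ∀ n → 1# ^ʳ n ≈ 1#
      1ʳ^ zero    = refl
      1ʳ^ (suc n) = trans (*-identityˡ _) (1ʳ^ n)

      -- 2/(n+1)! ≤ 1/n! for n ≥ 1, so the partial sums increased by twice the next term decrease.
      expʳ-1≤3 : expʳ 1# ≤ fromℕ 3
      expʳ-1≤3 = tends-re-≤ (1 , λ n 1≤n → ≡.subst (λ n → S n ≤ fromℕ 3) (ℕₚ.m+[n∸m]≡n 1≤n) (≤-trans
          (≤-trans (≤-refl (sym (+-identityʳ _))) (+-mono-≤ (≤-refl refl) (0≤-+ (1/!-nonneg (suc (n ℕ.∸ 1))) (1/!-nonneg (suc (n ℕ.∸ 1))))))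
          (upper (n ℕ.∸ 1)))) (exp-tends (ofReal 1#))
        where
        S : ℕ → ℝ
        S n = re (partialSum (expTerm (ofReal 1#)) n)
        term : ∀ n → re (expTerm (ofReal 1#) n) ≈ 1/! n
        term n = trans (re-expTerm 1# n) (trans (*-congˡ (1ʳ^ n)) (*-identityʳ _))
        halving : ∀ n → 1/! (2 ℕ.+ n) + 1/! (2 ℕ.+ n) ≤ 1/! (suc n)
        halving n = ≤-trans (bound (1/! (2 ℕ.+ n)) (1/!-nonneg (2 ℕ.+ n))) (≤-refl (1/!-suc (suc n)))
          where
          bound : ∀ x → 0# ≤ x → x + x ≤ fromℕ (2 ℕ.+ n) * x
          bound x 0≤x = 0≤-⇒≤ (≤-resp-≈ refl
            (trans (solve 3 (λ e m x → m :* x := (e :+ (e :+ m)) :* x :- (e :* x :+ e :* x)) refl 1# (fromℕ n) x)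
              (+-congˡ (-‿cong (+-cong (*-identityˡ x) (*-identityˡ x)))))
            (0≤-* (fromℕ-nonneg n) 0≤x))
        upper : ∀ n → S (suc n) + (1/! (suc n) + 1/! (suc n)) ≤ fromℕ 3
        upper zero    = ≤-refl (+-cong (trans (+-identityˡ _) (trans (term 0) 1/!-0))
          (trans (+-cong 1/!-1 1/!-1) (+-congˡ (sym (+-identityʳ 1#)))))
        upper (suc n) = ≤-trans (≤-refl (+-assoc _ _ _)) (≤-trans
          (+-mono-≤ (≤-refl refl) (+-mono-≤ (≤-refl (term (suc n))) (halving n))) (upper n))

      expʳ-pos : ∀ x → 0# ≤ x → 0# < expʳ x
      expʳ-pos x 0≤x = <-≤-trans (0<-+ 0<1 0≤x) (expʳ-lower 0≤x)

      -- e^{2y} = N² ≥ 3ᵐ ≥ eᵐ forces m ≤ 2y.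
      log-lower : ∀ N y → IsLog (fromℕ N) y → ∀ m → 3 ℕ.^ m ℕ.≤ N ℕ.* N → fromℕ m ≤ y + y
      log-lower N y isLog m 3^m≤N² y+y<m = <-irrefl refl (≤-<-trans chain strict)
        where
        t X : ℝ
        t = fromℕ m - (y + y)
        X = expʳ (y + y)
        0<t : 0# < t
        0<t = <⇒0<- y+y<m
        X≈ : X ≈ fromℕ (N ℕ.* N)
        X≈ = trans (expʳ-+ y y) (trans (*-cong (proj₁ isLog) (proj₁ isLog)) (sym (×1-homo-* N N)))
        0<X : 0# < X
        0<X = <-≤-trans (fromℕ-pos (3 ℕ.^ m) {{ℕₚ.m^n≢0 3 m}}) (≤-trans (fromℕ-mono 3^m≤N²) (≤-refl (sym X≈)))
        -- X eᵗ = eᵐ ≤ 3ᵐ ≤ N² = X, which is incompatible with `strict`, where eᵗ ≥ 1 + t > 1.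
        chain : X * expʳ t ≤ X
        chain = ≤-trans (≤-refl (trans (sym (expʳ-+ (y + y) t)) (trans
            (expʳ-cong (solve 2 (λ y m → y :+ (m :- y) := m) refl (y + y) (fromℕ m))) (expʳ-fromℕ m))))
          (≤-trans (^ʳ-monoˡ-≤ (<⇒≤ (expʳ-pos 1# (<⇒≤ 0<1))) expʳ-1≤3 m)
          (≤-trans (≤-refl (sym (fromℕ-^ 3 m))) (≤-trans (fromℕ-mono 3^m≤N²) (≤-refl (sym X≈)))))
        strict : X < X * expʳ t
        strict = <-respˡ-≈ (*-identityʳ X) (*-monoʳ-< 0<X (<-≤-trans
          (<-respˡ-≈ (+-identityˡ 1#) (<-respʳ-≈ (+-comm t 1#) (+-monoˡ-< 1# 0<t))) (expʳ-lower (<⇒≤ 0<t))))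

  open ExponentialBounds public

  -- Coefficient bounds and uniqueness of asymptotic expansions.

  module Asymptotics where

    powerTerm : (ℕ → ℂ) → ℂ → ℕ → ℂ
    powerTerm a w n = a n *ᶜ w ^ᶜ n

    partialSum-split : ∀ t m n → partialSum t (m ℕ.+ n) ≈ᶜ partialSum t m +ᶜ partialSum (λ i → t (m ℕ.+ i)) n
    partialSum-split t m zero    rewrite ℕₚ.+-identityʳ m = symᶜ (+ᶜ-identityʳ _)
    partialSum-split t m (suc n) rewrite ℕₚ.+-suc m n =
      transᶜ (+ᶜ-congʳ (partialSum-split t m n)) (+ᶜ-assoc _ _ _)

    prefix-bounded : ∀ (t : ℕ → ℂ) M → ∃ λ C → 0# ≤ C × (∀ n → n ℕ.< M → t n ⊑ C)
    prefix-bounded t zero    = 0# , ≤-refl refl , λ n ()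
    prefix-bounded t (suc M) with prefix-bounded t M | ⊑-bound (t M)
    ... | C , 0≤C , p | N , q = C + fromℕ (suc N) , 0≤-+ 0≤C (0≤bound q) , bound
      where
      bound : ∀ n → n ℕ.< suc M → t n ⊑ C + fromℕ (suc N)
      bound n n<1+M with ℕₚ.m≤n⇒m<n∨m≡n (ℕ.s≤s⁻¹ n<1+M)
      ... | inj₁ n<M    = ⊑-weaken (≤-trans (≤-refl (sym (+-identityʳ C))) (+-mono-≤ (≤-refl refl) (0≤bound q))) (p n n<M)
      ... | inj₂ ≡.refl = ⊑-weaken (≤-trans (≤-refl (sym (+-identityˡ _))) (+-mono-≤ 0≤C (≤-refl refl))) q

    -- From index M on, a term is the difference of two partial sums within 1 of the limit, hence at
    -- most 2; the finitely many earlier terms are bounded by C.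
    terms-bounded : ∀ {t l} → Tends (partialSum t) l → ∃ λ C → 0# < C × (∀ n → t n ⊑ C)
    terms-bounded {t} {l} p with p 1# 0<1
    ... | M , close with prefix-bounded t M
    ... | C , 0≤C , q = (1# + 1#) + C , 0<-+ (0<-+ 0<1 (<⇒≤ 0<1)) 0≤C , bound
      where
      bound : ∀ n → t n ⊑ (1# + 1#) + C
      bound n with n ℕₚ.<? M
      ... | yes n<M = ⊑-weaken (≤-trans (≤-refl (sym (+-identityˡ C))) (+-mono-≤ (0≤-+ (<⇒≤ 0<1) (<⇒≤ 0<1)) (≤-refl refl))) (q n n<M)
      ... | no  n≮M = ⊑-weaken (≤-trans (≤-refl (sym (+-identityʳ _))) (+-mono-≤ (≤-refl refl) 0≤C))
        (⊑-resp (solveᶜ 3 (λ s t l → ((s ⊕ t) ⊝ l) ⊝ (s ⊝ l) ⩵ t) reflᶜ (partialSum t n) (t n) l) refl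
          (⊑-- (close (suc n) (ℕₚ.m≤n⇒m≤1+n (ℕₚ.≮⇒≥ n≮M))) (close n (ℕₚ.≮⇒≥ n≮M))))

    inverse-^ : ∀ {z w} n → z *ᶜ w ≈ᶜ 1ᶜ → z ^ᶜ n *ᶜ w ^ᶜ n ≈ᶜ 1ᶜ
    inverse-^ zero    _    = *ᶜ-identityʳ 1ᶜ
    inverse-^ {z} {w} (suc n) zw≈1 = transᶜ
      (solveᶜ 4 (λ z x w y → (z ⊗ x) ⊗ (w ⊗ y) ⩵ (z ⊗ w) ⊗ (x ⊗ y)) reflᶜ z (z ^ᶜ n) w (w ^ᶜ n))
      (transᶜ (*ᶜ-cong zw≈1 (inverse-^ n zw≈1)) (*ᶜ-identityʳ 1ᶜ))

    -- A Cauchy estimate from convergence at the single point w: all aₙwⁿ share a bound C, and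
    -- multiplying by vⁿ = w⁻ⁿ recovers aₙ.
    coefficients-bounded : ∀ {a w v ρ l} → w *ᶜ v ≈ᶜ 1ᶜ → v ⊑ ρ → Tends (partialSum (powerTerm a w)) l →
                           ∃ λ C → 0# < C × (∀ n → a n ⊑ C * ρ ^ʳ n)
    coefficients-bounded {a} {w} {v} wv≈1 v⊑ρ p with terms-bounded p
    ... | C , 0<C , q = C , 0<C , λ n → ⊑-resp (cancel n) refl (⊑-* (q n) (⊑-^ v⊑ρ n))
      where
      cancel : ∀ n → (a n *ᶜ w ^ᶜ n) *ᶜ v ^ᶜ n ≈ᶜ a n
      cancel n = transᶜ (*ᶜ-assoc _ _ _) (transᶜ (*ᶜ-congˡ (inverse-^ n wv≈1)) (*ᶜ-identityʳ (a n)))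

    -- The constant 4Cρᵐ is the same for every w, and this uniformity lets one expansion hold along
    -- a whole sequence of points. The tail is geometric with ratio xρ ≤ 1/2; one doubling is the
    -- geometric sum, the other the passage to the limit.
    remainder : ∀ {a C ρ} → 0# < C → 0# < ρ → (∀ n → a n ⊑ C * ρ ^ʳ n) → ∀ m → ∃ λ K → 0# ≤ K ×
                (∀ {w x l} → 0# < x → w ⊑ x → x * ρ + x * ρ ≤ 1# → Tends (partialSum (powerTerm a w)) l →
                 (l -ᶜ partialSum (powerTerm a w) m) ⊑ K * x ^ʳ m)
    remainder {a} {C} {ρ} 0<C 0<ρ a⊑ m = (B + B) + (B + B) , 0≤-+ (0≤-+ 0≤B 0≤B) (0≤-+ 0≤B 0≤B) , tail-bound
      where
      B : ℝ
      B = C * ρ ^ʳ m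
      0<B : 0# < B
      0<B = *-pos 0<C (^ʳ-pos 0<ρ m)
      0≤B : 0# ≤ B
      0≤B = <⇒≤ 0<B
      tail-bound : ∀ {w x l} → 0# < x → w ⊑ x → x * ρ + x * ρ ≤ 1# → Tends (partialSum (powerTerm a w)) l →
                   (l -ᶜ partialSum (powerTerm a w) m) ⊑ ((B + B) + (B + B)) * x ^ʳ m
      tail-bound {w} {x} {l} 0<x w⊑x 2xρ≤1 p = ⊑-resp reflᶜ
        (solve 2 (λ b y → (b :* y :+ b :* y) :+ (b :* y :+ b :* y) := ((b :+ b) :+ (b :+ b)) :* y) refl B (x ^ʳ m))
        (tends-⊑ (0<-+ 0<A (<⇒≤ 0<A)) (m , λ n m≤n → ≡.subst (λ n → (S n -ᶜ S m) ⊑ A + A) (ℕₚ.m+[n∸m]≡n m≤n) (close (n ℕ.∸ m))) shifted)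
        where
        S : ℕ → ℂ
        S = partialSum (powerTerm a w)
        A : ℝ
        A = B * x ^ʳ m
        0<A : 0# < A
        0<A = *-pos 0<B (^ʳ-pos 0<x m)
        shifted : Tends (λ n → S n -ᶜ S m) (l -ᶜ S m)
        shifted ε 0<ε with p ε 0<ε
        ... | M , q = M , λ n M≤n → ⊑-resp (solveᶜ 3 (λ s l t → s ⊝ l ⩵ (s ⊝ t) ⊝ (l ⊝ t)) reflᶜ (S n) l (S m)) refl (q n M≤n)
        term : ∀ i → powerTerm a w (m ℕ.+ i) ⊑ A * (x * ρ) ^ʳ i
        term i = ⊑-resp reflᶜ (begin
          (C * ρ ^ʳ (m ℕ.+ i)) * x ^ʳ (m ℕ.+ i)       ≈⟨ *-cong (*-congˡ (^ʳ-homo-* ρ m i)) (^ʳ-homo-* x m i) ⟩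
          (C * (ρ ^ʳ m * ρ ^ʳ i)) * (x ^ʳ m * x ^ʳ i) ≈⟨ solve 5 (λ c p q r s → (c :* (p :* q)) :* (r :* s) := ((c :* p) :* r) :* (s :* q)) refl C (ρ ^ʳ m) (ρ ^ʳ i) (x ^ʳ m) (x ^ʳ i) ⟩
          A * (x ^ʳ i * ρ ^ʳ i)                       ≈⟨ *-congˡ (^ʳ-distrib-* x ρ i) ⟨
          A * (x * ρ) ^ʳ i                            ∎)
          (⊑-* (a⊑ (m ℕ.+ i)) (⊑-^ w⊑x (m ℕ.+ i)))
          where open SetoidReasoning setoid
        close : ∀ n → (S (m ℕ.+ n) -ᶜ S m) ⊑ A + A
        close n = ⊑-resp (symᶜ (transᶜ (-ᶜ-cong₂ (partialSum-split (powerTerm a w) m n) reflᶜ)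
            (solveᶜ 2 (λ s t → (s ⊕ t) ⊝ s ⩵ t) reflᶜ (S m) _))) refl
          (partialSum-geometric (<⇒≤ (*-pos 0<x 0<ρ)) 2xρ≤1 n (<⇒≤ 0<A) term)

    *-cancelˡ-≤ : ∀ {k x y} → 0# < k → k * x ≤ k * y → x ≤ y
    *-cancelˡ-≤ 0<k p y<x = p (*-monoʳ-< 0<k y<x)

    ⊑-cancel : ∀ {x z v} → 0# < x → 0# ≤ v → (ofReal x *ᶜ z) ⊑ x * v → z ⊑ v
    ⊑-cancel {x} {z} {v} 0<x 0≤v (norm≤ _ p) = norm≤ 0≤v (*-cancelˡ-≤ (*-pos 0<x 0<x) (≤-resp-≈
      (solve 3 (λ x a b → (x :* a :- con +0 :* b) :* (x :* a :- con +0 :* b) :+ (x :* b :+ con +0 :* a) :* (x :* b :+ con +0 :* a)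
                  := (x :* x) :* (a :* a :+ b :* b)) refl x (re z) (im z))
      (solve 2 (λ x v → (x :* v) :* (x :* v) := (x :* x) :* (v :* v)) refl x v) p))

    polynomial-bounded : ∀ d m → ∃ λ B → 0# ≤ B × (∀ {w} → w ⊑ 1# → partialSum (powerTerm d w) m ⊑ B)
    polynomial-bounded d zero    = 0# , ≤-refl refl , λ _ → ⊑-0 (≤-refl refl)
    polynomial-bounded d (suc m) with polynomial-bounded d m | ⊑-bound (d m)
    ... | B , 0≤B , p | N , q = B + fromℕ (suc N) * 1# ^ʳ m , 0≤-+ 0≤B (0≤-* (0≤bound q) (^ʳ-nonneg (<⇒≤ 0<1) m)) ,
      λ w⊑1 → ⊑-+ (p w⊑1) (⊑-* q (⊑-^ w⊑1 m))

    polynomial-suc : ∀ d w m → partialSum (powerTerm d w) (suc m) ≈ᶜ d 0 +ᶜ w *ᶜ partialSum (powerTerm (d ∘ suc) w) m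
    polynomial-suc d w m = transᶜ (partialSum-suc (powerTerm d w) m) (+ᶜ-cong (*ᶜ-identityʳ (d 0))
      (transᶜ (partialSum-cong (λ n → solveᶜ 3 (λ d w x → d ⊗ (w ⊗ x) ⩵ w ⊗ (d ⊗ x)) reflᶜ (d (suc n)) w (w ^ᶜ n)) m)
        (partialSum-* w (powerTerm (d ∘ suc) w) m)))

    -- A sequence of positive reals with arbitrarily small members stands for the limit X → 0.
    -- Errors are controlled only where `X n ≤ δ`, the region in which the Fourier remainders are
    -- bounded.
    module Expansions (X : ℕ → ℝ) (X-pos : ∀ n → 0# < X n) (X-small : ∀ ε → 0# < ε → ∃ λ n → X n ≤ ε)
                      (δ : ℝ) (0<δ : 0# < δ) (δ≤1 : δ ≤ 1#) where

      -- G = Σ_{i < m} d i Xⁱ + O(Xᵐ)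
      record Expansion (m : ℕ) (G d : ℕ → ℂ) : Set (c ⊔ ℓ₃) where
        constructor expansion
        field
          constant  : ℝ
          0≤const   : 0# ≤ constant
          error     : ∀ n → X n ≤ δ → (G n -ᶜ partialSum (powerTerm d (ofReal (X n))) m) ⊑ constant * X n ^ʳ m

      X⊑ : ∀ n → ofReal (X n) ⊑ X n
      X⊑ n = ⊑-ofReal (<⇒≤ (X-pos n))

      expansion-resp : ∀ {m G H d e} → (∀ n → G n ≈ᶜ H n) → (∀ i → d i ≈ᶜ e i) → Expansion m G d → Expansion m H e
      expansion-resp {m} p q (expansion K 0≤K b) = expansion K 0≤K λ n Xn≤δ →
        ⊑-resp (-ᶜ-cong₂ (p n) (partialSum-cong (λ i → *ᶜ-congʳ (q i)) m)) refl (b n Xn≤δ)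

      expansion-+ : ∀ {m G H d e} → Expansion m G d → Expansion m H e →
                    Expansion m (λ n → G n +ᶜ H n) (λ i → d i +ᶜ e i)
      expansion-+ {m} {G} {H} {d} {e} (expansion K 0≤K p) (expansion L 0≤L q) = expansion (K + L) (0≤-+ 0≤K 0≤L) λ n Xn≤δ →
        let w = ofReal (X n) in ⊑-resp
        (transᶜ (solveᶜ 4 (λ g s h t → (g ⊝ s) ⊕ (h ⊝ t) ⩵ (g ⊕ h) ⊝ (s ⊕ t)) reflᶜ (G n) (partialSum (powerTerm d w) m) (H n) (partialSum (powerTerm e w) m))
          (-ᶜ-cong₂ reflᶜ (symᶜ (transᶜ
            (partialSum-cong (λ i → solveᶜ 3 (λ d e x → (d ⊕ e) ⊗ x ⩵ d ⊗ x ⊕ e ⊗ x) reflᶜ (d i) (e i) (w ^ᶜ i)) m)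
            (partialSum-+ (powerTerm d w) (powerTerm e w) m)))))
        (solve 3 (λ k l x → k :* x :+ l :* x := (k :+ l) :* x) refl K L (X n ^ʳ m))
        (⊑-+ (p n Xn≤δ) (q n Xn≤δ))

      expansion-* : ∀ {m G d} k → Expansion m G d → Expansion m (λ n → k *ᶜ G n) (λ i → k *ᶜ d i)
      expansion-* {m} {G} {d} k (expansion K 0≤K p) with ⊑-bound k
      ... | N , k⊑ = expansion (fromℕ (suc N) * K) (0≤-* (0≤bound k⊑) 0≤K) λ n Xn≤δ →
        let w = ofReal (X n) in ⊑-resp
        (transᶜ (solveᶜ 3 (λ k g s → k ⊗ (g ⊝ s) ⩵ k ⊗ g ⊝ k ⊗ s) reflᶜ k (G n) (partialSum (powerTerm d w) m))
          (-ᶜ-cong₂ reflᶜ (symᶜ (transᶜ (partialSum-cong (λ i → *ᶜ-assoc k (d i) (w ^ᶜ i)) m) (partialSum-* k (powerTerm d w) m)))))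
        (sym (*-assoc _ _ _))
        (⊑-* k⊑ (p n Xn≤δ))

      expansion-0 : ∀ m → Expansion m (λ _ → 0ᶜ) (λ _ → 0ᶜ)
      expansion-0 m = expansion 0# (≤-refl refl) λ n _ → ⊑-resp
        (symᶜ (transᶜ (-ᶜ-cong₂ reflᶜ (partialSum-0 (λ i → zeroˡᶜ _) m)) (-ᶜ-inverseʳ 0ᶜ))) refl
        (⊑-0 (0≤-* (≤-refl refl) (^ʳ-nonneg (<⇒≤ (X-pos n)) m)))

      expansion-sum : ∀ {m} {G d : ℕ → ℕ → ℂ} r → (∀ b → Expansion m (G b) (d b)) →
                      Expansion m (λ n → partialSum (λ b → G b n) r) (λ i → partialSum (λ b → d b i) r)
      expansion-sum {m} zero    p = expansion-0 m
      expansion-sum     (suc r) p = expansion-+ (expansion-sum r p) (p r)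

      -- The lowest coefficient is O(X), hence 0; divide by X and repeat.
      expansion-unique : ∀ m {d} → Expansion m (λ _ → 0ᶜ) d → ∀ i → i ℕ.< m → d i ≈ᶜ 0ᶜ
      expansion-unique (suc m) {d} (expansion K 0≤K p) = coefficients
        where
        w : ℕ → ℂ
        w n = ofReal (X n)
        Q : ℕ → ℂ
        Q n = partialSum (powerTerm (d ∘ suc) (w n)) m
        d₀+wQ⊑ : ∀ n → X n ≤ δ → (d 0 +ᶜ w n *ᶜ Q n) ⊑ K * X n ^ʳ suc m
        d₀+wQ⊑ n Xn≤δ = ⊑-resp (transᶜ (⊝-cong (polynomial-suc d (w n) m))
          (solveᶜ 1 (λ x → ⊝ (κ +0 ⊝ x) ⩵ x) reflᶜ _)) refl (⊑-neg (p n Xn≤δ))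
          where
          ⊝-cong : ∀ {x y} → x ≈ᶜ y → -ᶜ (0ᶜ -ᶜ x) ≈ᶜ -ᶜ (0ᶜ -ᶜ y)
          ⊝-cong e = -ᶜ-cong (-ᶜ-cong₂ reflᶜ e)
        d₀≈0 : d 0 ≈ᶜ 0ᶜ
        d₀≈0 with polynomial-bounded (d ∘ suc) m
        ... | B , 0≤B , Q⊑ = ⊑-≈0 small
          where
          C : ℝ
          C = (1# + K) + B
          small : ∀ ε → 0# < ε → d 0 ⊑ ε
          small ε 0<ε with scale-down ε C 0<ε (0<-+ (0<-+ 0<1 0≤K) 0≤B)
          -- A point with X n ≤ δη satisfies X n ≤ δ and X n ≤ η together, since δ and η are both at
          -- most 1.
          ... | η , 0<η , η≤1 , ηC≤ε with X-small (δ * η) (*-pos 0<δ 0<η)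
          ... | n , Xn≤δη = ⊑-weaken (bound (X n ^ʳ m) (^ʳ-nonneg 0≤x m) (^ʳ-≤1 0≤x x≤1 m)) (⊑-resp
              (solveᶜ 2 (λ d x → (d ⊕ x) ⊝ x ⩵ d) reflᶜ (d 0) (w n *ᶜ Q n)) refl
              (⊑-- (d₀+wQ⊑ n x≤δ) (⊑-* (X⊑ n) (Q⊑ (⊑-weaken x≤1 (X⊑ n))))))
            where
            x : ℝ
            x = X n
            0≤x : 0# ≤ x
            0≤x = <⇒≤ (X-pos n)
            x≤δ : x ≤ δ
            x≤δ = ≤-trans Xn≤δη (≤-trans (*-mono-≤ (<⇒≤ 0<δ) (<⇒≤ 0<1) (≤-refl refl) η≤1) (≤-refl (*-identityʳ δ)))
            x≤η : x ≤ η
            x≤η = ≤-trans Xn≤δη (≤-trans (*-mono-≤ (<⇒≤ 0<δ) (<⇒≤ 0<η) δ≤1 (≤-refl refl)) (≤-refl (*-identityˡ η)))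
            x≤1 : x ≤ 1#
            x≤1 = ≤-trans x≤η η≤1
            bound : ∀ y → 0# ≤ y → y ≤ 1# → K * (x * y) + x * B ≤ ε
            bound y 0≤y y≤1 = ≤-trans (0≤-⇒≤ (≤-resp-≈ refl
              (solve 5 (λ e k b x y → k :* x :* (e :- y) :+ x :* e := x :* ((e :+ k :* e) :+ b) :- (k :* (x :* y) :+ x :* b)) refl 1# K B x y)
              (0≤-+ (0≤-* (0≤-* 0≤K 0≤x) (≤⇒0≤- y≤1)) (0≤-* 0≤x (<⇒≤ 0<1)))))
              (≤-trans (≤-refl (*-congˡ (+-congʳ (+-congˡ (*-identityʳ K)))))
              (≤-trans (*-mono-≤ 0≤x (0≤-+ (0≤-+ (<⇒≤ 0<1) 0≤K) 0≤B) x≤η (≤-refl refl)) ηC≤ε))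
        shifted : Expansion m (λ _ → 0ᶜ) (d ∘ suc)
        shifted = expansion K 0≤K λ n Xn≤δ → ⊑-resp (solveᶜ 1 (λ x → ⊝ x ⩵ κ +0 ⊝ x) reflᶜ (Q n)) refl
          (⊑-neg (⊑-cancel (X-pos n) (0≤-* 0≤K (^ʳ-nonneg (<⇒≤ (X-pos n)) m))
            (⊑-resp (transᶜ (+ᶜ-congʳ d₀≈0) (+ᶜ-identityˡ _)) (solve 3 (λ k x y → k :* (x :* y) := x :* (k :* y)) refl K (X n) (X n ^ʳ m)) (d₀+wQ⊑ n Xn≤δ))))
        coefficients : ∀ i → i ℕ.< suc m → d i ≈ᶜ 0ᶜ
        coefficients zero    _     = d₀≈0
        coefficients (suc i) i<m = expansion-unique m shifted i (ℕ.s≤s⁻¹ i<m)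

  open Asymptotics public

  -- Fourier expansions as power series in the nome.

  module FourierSeries where

    -- The coefficients of F(wᴾ) for F(w) = Σ c n wⁿ.
    stretch : ℕ → (ℕ → ℂ) → ℕ → ℂ
    stretch P c n with P ∣? n
    ... | yes (divides q _) = c q
    ... | no  _             = 0ᶜ

    stretch-multiple : ∀ P .{{_ : NonZero P}} c {n} q → n ≡ q ℕ.* P → stretch P c n ≡ c q
    stretch-multiple P c {n} q n≡qP with P ∣? n
    ... | yes (divides q′ n≡q′P) = ≡.cong c (ℕₚ.*-cancelʳ-≡ q′ q P (≡.trans (≡.sym n≡q′P) n≡qP))
    ... | no  P∤n                = ⊥-elim (P∤n (divides q n≡qP))

    stretch-∤ : ∀ P c {n} → P ∤ n → stretch P c n ≡ 0ᶜ
    stretch-∤ P c {n} P∤n with P ∣? n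
    ... | yes P∣n = ⊥-elim (P∤n P∣n)
    ... | no  _   = ≡.refl

    partialSum-0-< : ∀ {t} n → (∀ i → i ℕ.< n → t i ≈ᶜ 0ᶜ) → partialSum t n ≈ᶜ 0ᶜ
    partialSum-0-< zero    e = reflᶜ
    partialSum-0-< (suc n) e = transᶜ (+ᶜ-cong (partialSum-0-< n λ i i<n → e i (ℕₚ.m≤n⇒m≤1+n i<n)) (e n ℕₚ.≤-refl)) (+ᶜ-identityʳ 0ᶜ)

    -- Each step of J adds P exponents, of which only the last is a multiple of P. The sum is cut
    -- right after the exponent JP, so no incomplete block remains.
    partialSum-stretch : ∀ P .{{_ : NonZero P}} c w J →
      partialSum (powerTerm (stretch P c) w) (suc (J ℕ.* P)) ≈ᶜ partialSum (powerTerm c (w ^ᶜ P)) (suc J)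
    partialSum-stretch P c w zero = +ᶜ-congˡ (*ᶜ-congʳ (reflexiveᶜ (stretch-multiple P c 0 ≡.refl)))
    partialSum-stretch P@(suc P′) c w (suc J) = begin
      partialSum t (suc (suc J ℕ.* P))                             ≡⟨ ≡.cong (partialSum t) index ⟩
      partialSum t (suc (J ℕ.* P) ℕ.+ P)                           ≈⟨ partialSum-split t (suc (J ℕ.* P)) P ⟩
      partialSum t (suc (J ℕ.* P)) +ᶜ (partialSum t′ P′ +ᶜ t′ P′)  ≈⟨ +ᶜ-cong (partialSum-stretch P c w J) (+ᶜ-cong (partialSum-0-< P′ gap) last) ⟩
      partialSum (powerTerm c (w ^ᶜ P)) (suc J) +ᶜ (0ᶜ +ᶜ powerTerm c (w ^ᶜ P) (suc J)) ≈⟨ +ᶜ-congˡ (+ᶜ-identityˡ _) ⟩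
      partialSum (powerTerm c (w ^ᶜ P)) (suc (suc J))              ∎
      where
      open SetoidReasoning ℂ-setoid
      t t′ : ℕ → ℂ
      t    = powerTerm (stretch P c) w
      t′ i = t (suc (J ℕ.* P) ℕ.+ i)
      index : suc (suc J ℕ.* P) ≡ suc (J ℕ.* P) ℕ.+ P
      index = ≡.cong suc (ℕₚ.+-comm P (J ℕ.* P))
      gap : ∀ i → i ℕ.< P′ → t′ i ≈ᶜ 0ᶜ
      gap i i<P′ = transᶜ (*ᶜ-congʳ (reflexiveᶜ (stretch-∤ P c λ P∣ →
        ℕₚ.<⇒≱ (ℕ.s≤s i<P′) (∣⇒≤ (∣m+n∣m⇒∣n (≡.subst (P ∣_) (≡.sym (ℕₚ.+-suc (J ℕ.* P) i)) P∣) (n∣m*n J)))))) (zeroˡᶜ _)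
      lastIndex : suc (J ℕ.* P) ℕ.+ P′ ≡ suc J ℕ.* P
      lastIndex = ≡.trans (≡.sym (ℕₚ.+-suc (J ℕ.* P) P′)) (ℕₚ.+-comm (J ℕ.* P) P)
      last : t′ P′ ≈ᶜ powerTerm c (w ^ᶜ P) (suc J)
      last = *ᶜ-cong (reflexiveᶜ (stretch-multiple P c (suc J) lastIndex))
        (transᶜ (reflexiveᶜ (≡.cong (w ^ᶜ_) (≡.trans lastIndex (ℕₚ.*-comm (suc J) P)))) (symᶜ (^ᶜ-assocʳ w P (suc J))))

    ^ʳ-antimono-≤ : ∀ {x} → 0# ≤ x → x ≤ 1# → ∀ {m n} → m ℕ.≤ n → x ^ʳ n ≤ x ^ʳ m
    ^ʳ-antimono-≤ {x} 0≤x x≤1 {m} {n} m≤n = ≤-trans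
      (≤-refl (trans (reflexive (≡.cong (x ^ʳ_) (≡.sym (ℕₚ.m+[n∸m]≡n m≤n)))) (^ʳ-homo-* x m (n ℕ.∸ m))))
      (≤-trans (*-mono-≤ (^ʳ-nonneg 0≤x m) (<⇒≤ 0<1) (≤-refl refl) (^ʳ-≤1 0≤x x≤1 (n ℕ.∸ m))) (≤-refl (*-identityʳ _)))

    module _ (X : ℕ → ℝ) (X-pos : ∀ n → 0# < X n) (X-small : ∀ ε → 0# < ε → ∃ λ n → X n ≤ ε)
             (δ : ℝ) (0<δ : 0# < δ) (δ≤1 : δ ≤ 1#) where
      open Expansions X X-pos X-small δ 0<δ δ≤1

      -- The error X^(P(J+1)) is weakened to X^(JP+1), the order to which `partialSum-stretch`
      -- matches the polynomials; this uses X ≤ δ ≤ 1.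
      expansion-stretch : ∀ P .{{_ : NonZero P}} {G c} J K → 0# ≤ K →
        (∀ n → X n ≤ δ → (G n -ᶜ partialSum (powerTerm c (ofReal (X n) ^ᶜ P)) (suc J)) ⊑ K * (X n ^ʳ P) ^ʳ suc J) →
        Expansion (suc (J ℕ.* P)) G (stretch P c)
      expansion-stretch P {G} {c} J K 0≤K error = expansion K 0≤K λ n Xn≤δ →
        ⊑-weaken (*-mono-≤ 0≤K (^ʳ-nonneg (<⇒≤ (X-pos n)) (suc (J ℕ.* P))) (≤-refl refl)
            (≤-trans (≤-refl (^ʳ-assocʳ (X n) P (suc J))) (^ʳ-antimono-≤ (<⇒≤ (X-pos n)) (≤-trans Xn≤δ δ≤1) J*P<)))
          (⊑-resp (-ᶜ-cong₂ reflᶜ (symᶜ (partialSum-stretch P c (ofReal (X n)) J))) refl (error n Xn≤δ))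
        where
        J*P< : suc (J ℕ.* P) ℕ.≤ P ℕ.* suc J
        J*P< = ℕₚ.≤-trans (ℕₚ.+-monoˡ-≤ (J ℕ.* P) (ℕ.>-nonZero⁻¹ P)) (ℕₚ.≤-reflexive (ℕₚ.*-comm (suc J) P))

    module Fourier (π : ℝ) (0<π : 0# < π) where

      τ : ℝ
      τ = fromℕ 2 * π

      0<τ : 0# < τ
      0<τ = *-pos (fromℕ-pos 2) 0<π

      τ𝕚 : ℂ
      τ𝕚 = ofReal τ *ᶜ 𝕚

      nome : ℍ → ℂ
      nome z = exp (τ𝕚 *ᶜ point z)

      iℝ : ∀ y → 0# < y → ℍ
      iℝ y 0<y = record { point = 0# +i y ; im>0 = 0<y }

      τ𝕚*i : ∀ y → τ𝕚 *ᶜ (0# +i y) ≈ᶜ ofReal (- (τ * y))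
      τ𝕚*i y = trans (solve 3 (λ t y e → (t :* con +0 :- con +0 :* e) :* con +0 :- (t :* e :+ con +0 :* con +0) :* y := :- (t :* e :* y)) refl τ y 1#)
                 (-‿cong (*-congʳ (*-identityʳ τ)))
             , solve 3 (λ t y e → (t :* con +0 :- con +0 :* e) :* y :+ (t :* e :+ con +0 :* con +0) :* con +0 := con +0) refl τ y 1#

      -- Fourier expansions start at n = 1; a zero constant term turns them into power series
      -- indexed from 0.
      dropConstant : (ℕ → ℂ) → ℕ → ℂ
      dropConstant a zero    = 0ᶜ
      dropConstant a (suc n) = a (suc n)

      fourier-tends : ∀ {f a} → IsFourierExpansion π f a → ∀ z {w} → nome z ≈ᶜ w →
                      Tends (partialSum (powerTerm (dropConstant a) w)) (f z)
      fourier-tends {f} {a} F z {w} q≈w ε 0<ε = suc M , bound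
        where
        t : ℕ → ℂ
        t n = a (suc n) *ᶜ nome z ^ᶜ suc n
        M : ℕ
        M = proj₁ (sumsTo⇒tends {t} (F z) ε 0<ε)
        reindex : ∀ n → partialSum t n ≈ᶜ partialSum (powerTerm (dropConstant a) w) (suc n)
        reindex n = begin
          partialSum t n                                              ≈⟨ partialSum-cong {t} {powerTerm (dropConstant a) w ∘ suc} (λ i → *ᶜ-congˡ (^ᶜ-congˡ (suc i) q≈w)) n ⟩
          partialSum (powerTerm (dropConstant a) w ∘ suc) n           ≈⟨ +ᶜ-identityˡ _ ⟨
          0ᶜ +ᶜ partialSum (powerTerm (dropConstant a) w ∘ suc) n     ≈⟨ +ᶜ-congʳ (zeroˡᶜ 1ᶜ) ⟨
          powerTerm (dropConstant a) w 0 +ᶜ partialSum (powerTerm (dropConstant a) w ∘ suc) n ≈⟨ partialSum-suc (powerTerm (dropConstant a) w) n ⟨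
          partialSum (powerTerm (dropConstant a) w) (suc n)           ∎
          where open SetoidReasoning ℂ-setoid
        bound : ∀ n → suc M ℕ.≤ n → (partialSum (powerTerm (dropConstant a) w) n -ᶜ f z) ⊑ ε
        bound (suc n) 1+M≤1+n = ⊑-resp (-ᶜ-cong₂ (reindex n) (reflᶜ {f z})) (refl {ε})
          (proj₂ (sumsTo⇒tends {t} (F z) ε 0<ε) n (ℕ.s≤s⁻¹ 1+M≤1+n))

      private
        y₁ : ℝ
        y₁ = τ * 1#
        -- This is e^(2π), the reciprocal of the nome at z = i. Convergence there bounds the
        -- coefficients by Cρⁿ, and `δ` is then taken with 2δρ ≤ 1.
        ρ : ℝ
        ρ = expʳ y₁
        0<ρ : 0# < ρ
        0<ρ = expʳ-pos y₁ (<⇒≤ (*-pos 0<τ 0<1))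
        radius : ∃ λ δ → 0# < δ × δ ≤ 1# × δ * (ρ + ρ) ≤ 1#
        radius = scale-down 1# (ρ + ρ) 0<1 (0<-+ 0<ρ (<⇒≤ 0<ρ))

      δ : ℝ
      δ = proj₁ radius

      0<δ : 0# < δ
      0<δ = proj₁ (proj₂ radius)

      δ≤1 : δ ≤ 1#
      δ≤1 = proj₁ (proj₂ (proj₂ radius))

      -- The constant stems from the coefficient bound at z = i, so it serves every point with nome
      -- bounded by δ: the translates and the dilates in the Hecke sum as well as the base points.
      fourier-remainder : ∀ {f a} → IsFourierExpansion π f a → ∀ m → ∃ λ K → 0# ≤ K ×
        (∀ z {w x} → nome z ≈ᶜ w → 0# < x → w ⊑ x → x ≤ δ →
         (f z -ᶜ partialSum (powerTerm (dropConstant a) w) m) ⊑ K * x ^ʳ m)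
      fourier-remainder {f} {a} F m = K , proj₁ (proj₂ tail) , λ z q≈w 0<x w⊑x x≤δ →
        proj₂ (proj₂ tail) 0<x w⊑x (2xρ≤1 0<x x≤δ) (fourier-tends {f} {a} F z q≈w)
        where
        base-inverse : nome (iℝ 1# 0<1) *ᶜ exp (ofReal y₁) ≈ᶜ 1ᶜ
        base-inverse = transᶜ (*ᶜ-congʳ (exp-cong (transᶜ (τ𝕚*i 1#) (ofReal-neg y₁))))
          (transᶜ (*ᶜ-comm _ _) (exp-inverse (ofReal y₁)))
        base-bound : exp (ofReal y₁) ⊑ ρ
        base-bound = ⊑-resp (symᶜ (exp-ofReal y₁)) refl (⊑-ofReal (<⇒≤ 0<ρ))
        coefficients : ∃ λ C → 0# < C × (∀ n → dropConstant a n ⊑ C * ρ ^ʳ n)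
        coefficients = coefficients-bounded {v = exp (ofReal y₁)} base-inverse base-bound
          (fourier-tends {f} {a} F (iℝ 1# 0<1) reflᶜ)
        tail : ∃ λ K → 0# ≤ K × (∀ {w x l} → 0# < x → w ⊑ x → x * ρ + x * ρ ≤ 1# →
                 Tends (partialSum (powerTerm (dropConstant a) w)) l →
                 (l -ᶜ partialSum (powerTerm (dropConstant a) w) m) ⊑ K * x ^ʳ m)
        tail = remainder (proj₁ (proj₂ coefficients)) 0<ρ (proj₂ (proj₂ coefficients)) m
        K : ℝ
        K = proj₁ tail
        2xρ≤1 : ∀ {x} → 0# < x → x ≤ δ → x * ρ + x * ρ ≤ 1#
        2xρ≤1 {x} 0<x x≤δ = ≤-trans (≤-refl (solve 2 (λ x r → x :* r :+ x :* r := x :* (r :+ r)) refl x ρ))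
          (≤-trans (*-mono-≤ (<⇒≤ 0<x) (0≤-+ (<⇒≤ 0<ρ) (<⇒≤ 0<ρ)) x≤δ (≤-refl refl)) (proj₂ (proj₂ (proj₂ radius))))

      -- The nome at the point i(n+1); the shift by one keeps the height positive.
      X : ℕ → ℝ
      X n = expʳ (- (τ * fromℕ (suc n)))

      private
        y : ℕ → ℝ
        y n = τ * fromℕ (suc n)
        0<y : ∀ n → 0# < y n
        0<y n = *-pos 0<τ (fromℕ-pos (suc n))

      X-pos : ∀ n → 0# < X n
      X-pos n = proj₂ (0<*⇒ (<⇒≤ (expʳ-pos (y n) (<⇒≤ (0<y n)))) (<-respʳ-≈ (sym (expʳ-inverse (y n))) 0<1))

      -- With y = 2π(n+1), the bound eʸ ≥ y gives yX ≤ 1. The index n exceeds 1/(2πε), so that yε ≥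
      -- 1, and y is cancelled.
      X-small : ∀ ε → 0# < ε → ∃ λ n → X n ≤ ε
      X-small ε 0<ε = n , *-cancelˡ-≤ (0<y n) (≤-trans (*-mono-≤ (<⇒≤ (0<y n)) (<⇒≤ (X-pos n)) y≤e (≤-refl refl))
          (≤-trans (≤-refl (expʳ-inverse (y n))) 1≤yε))
        where
        i : ℝ
        i = inverse (τ * ε) (*-pos 0<τ 0<ε)
        n : ℕ
        n = proj₁ (archimedean i)
        i<n : i < fromℕ n
        i<n = proj₂ (archimedean i)
        y≤e : y n ≤ expʳ (y n)
        y≤e = ≤-trans (≤-trans (≤-refl (sym (+-identityˡ _))) (+-mono-≤ (<⇒≤ 0<1) (≤-refl refl))) (expʳ-lower (<⇒≤ (0<y n)))
        1≤yε : 1# ≤ y n * ε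
        1≤yε = ≤-trans (≤-refl (sym (inverse-correct (τ * ε) (*-pos 0<τ 0<ε)))) (≤-trans
          (*-mono-≤ (<⇒≤ (*-pos 0<τ 0<ε)) (fromℕ-nonneg (suc n)) (≤-refl refl) (≤-trans (<⇒≤ i<n) (fromℕ-mono (ℕₚ.n≤1+n n))))
          (≤-refl (solve 3 (λ t e n → (t :* e) :* n := (t :* n) :* e) refl τ ε (fromℕ (suc n)))))

  open FourierSeries public

  -- Hecke operators as sums over upper triangular matrices.

  module HeckeOperators where

    open M₂⁺ using (det)

    inverseᶜ-correct : ∀ z p → z *ᶜ inverseᶜ z p ≈ᶜ 1ᶜ
    inverseᶜ-correct z p =
      trans (solve 3 (λ a b r → a :* (a :* r) :- b :* ((:- b) :* r) := (a :* a :+ b :* b) :* r) refl (re z) (im z) (inverse ∣ z ∣² p))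
        (inverse-correct ∣ z ∣² p) ,
      solve 3 (λ a b r → a :* ((:- b) :* r) :+ b :* (a :* r) := con +0) refl (re z) (im z) (inverse ∣ z ∣² p)

    inverse-unique : ∀ {z w v} → z *ᶜ w ≈ᶜ 1ᶜ → z *ᶜ v ≈ᶜ 1ᶜ → w ≈ᶜ v
    inverse-unique {z} {w} {v} zw≈1 zv≈1 = begin
      w               ≈⟨ *ᶜ-identityʳ w ⟨
      w *ᶜ 1ᶜ         ≈⟨ *ᶜ-congˡ zv≈1 ⟨
      w *ᶜ (z *ᶜ v)   ≈⟨ solveᶜ 3 (λ w z v → w ⊗ (z ⊗ v) ⩵ (z ⊗ w) ⊗ v) reflᶜ w z v ⟩
      (z *ᶜ w) *ᶜ v   ≈⟨ *ᶜ-congʳ zw≈1 ⟩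
      1ᶜ *ᶜ v         ≈⟨ *ᶜ-identityˡ v ⟩
      v               ∎
      where open SetoidReasoning ℂ-setoid

    inverseᶜ-cong : ∀ {z w p q} → z ≈ᶜ w → inverseᶜ z p ≈ᶜ inverseᶜ w q
    inverseᶜ-cong {z} {w} {p} {q} z≈w = inverse-unique (inverseᶜ-correct z p)
      (transᶜ (*ᶜ-congʳ z≈w) (inverseᶜ-correct w q))

    powᶜ-cong : ∀ {z w p q} k → z ≈ᶜ w → powᶜ z p k ≈ᶜ powᶜ w q k
    powᶜ-cong (+ n)        z≈w = ^ᶜ-congˡ n z≈w
    powᶜ-cong {z} {w} {p} {q} -[1+ n ] z≈w = ^ᶜ-congˡ (suc n) (inverseᶜ-cong {z} {w} {p} {q} z≈w)

    1ᶜ^ : ∀ n → 1ᶜ ^ᶜ n ≈ᶜ 1ᶜ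
    1ᶜ^ zero    = reflᶜ
    1ᶜ^ (suc n) = transᶜ (*ᶜ-identityˡ _) (1ᶜ^ n)

    powᶜ-1 : ∀ {z p} k → z ≈ᶜ 1ᶜ → powᶜ z p k ≈ᶜ 1ᶜ
    powᶜ-1 (+ n)        z≈1 = transᶜ (^ᶜ-congˡ n z≈1) (1ᶜ^ n)
    powᶜ-1 {z} {p} -[1+ n ] z≈1 = transᶜ (^ᶜ-congˡ (suc n)
      (inverse-unique (inverseᶜ-correct z p) (transᶜ (*ᶜ-identityʳ z) z≈1))) (1ᶜ^ (suc n))

    powᶜ-inverse : ∀ z p k → powᶜ z p k *ᶜ powᶜ z p (ℤ.- k) ≈ᶜ 1ᶜ
    powᶜ-inverse z p +0       = *ᶜ-identityʳ 1ᶜ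
    powᶜ-inverse z p +[1+ n ] = inverse-^ (suc n) (inverseᶜ-correct z p)
    powᶜ-inverse z p -[1+ n ] = transᶜ (*ᶜ-comm (inverseᶜ z p ^ᶜ suc n) (z ^ᶜ suc n)) (inverse-^ (suc n) (inverseᶜ-correct z p))

    powᶜ-suc : ∀ z p k → z *ᶜ powᶜ z p (k ℤ.- ℤ.1ℤ) ≈ᶜ powᶜ z p k
    powᶜ-suc z p +0       = transᶜ (*ᶜ-congˡ (*ᶜ-identityʳ _)) (inverseᶜ-correct z p)
    powᶜ-suc z p +[1+ n ] = reflᶜ
    powᶜ-suc z p -[1+ n ] rewrite ℕₚ.+-identityʳ n = transᶜ (symᶜ (*ᶜ-assoc z (inverseᶜ z p) (inverseᶜ z p ^ᶜ suc n)))
      (transᶜ (*ᶜ-congʳ (inverseᶜ-correct z p)) (*ᶜ-identityˡ _))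

    ut-det : ∀ i b j → ofℤ (det (upperTriangular (suc i) b (suc j))) ≈ᶜ ofℕ (suc i ℕ.* suc j)
    ut-det i b j = reflexiveᶜ (≡.cong ofℤ (≡.trans (≡.cong (λ e → + suc i ℤ.* + suc j ℤ.- e) (ℤₚ.*-zeroʳ (+ b)))
      (≡.trans (ℤₚ.+-identityʳ _) (≡.sym (ℤₚ.pos-* (suc i) (suc j))))))

    ut-denominator : ∀ i b j z → denominator (upperTriangular (suc i) b (suc j)) z ≈ᶜ ofℕ (suc j)
    ut-denominator i b j z = transᶜ (+ᶜ-congʳ (zeroˡᶜ (point z))) (+ᶜ-identityˡ _)

    ut-point : ∀ i b j z → ofℕ (suc j) *ᶜ point (upperTriangular (suc i) b (suc j) ⟨ z ⟩) ≈ᶜ ofℕ (suc i) *ᶜ point z +ᶜ ofℕ b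
    ut-point i b j z = begin
      ofℕ (suc j) *ᶜ (num *ᶜ inv)   ≈⟨ *ᶜ-congʳ (ut-denominator i b j z) ⟨
      den *ᶜ (num *ᶜ inv)           ≈⟨ solveᶜ 3 (λ d n i → d ⊗ (n ⊗ i) ⩵ n ⊗ (d ⊗ i)) reflᶜ den num inv ⟩
      num *ᶜ (den *ᶜ inv)           ≈⟨ *ᶜ-congˡ (inverseᶜ-correct den (denominator-nonZero γ z)) ⟩
      num *ᶜ 1ᶜ                     ≈⟨ *ᶜ-identityʳ num ⟩
      num                           ∎
      where
      open SetoidReasoning ℂ-setoid
      γ : M₂⁺
      γ = upperTriangular (suc i) b (suc j)
      num den inv : ℂ
      num = numerator γ z
      den = denominator γ z
      inv = inverseᶜ den (denominator-nonZero γ z)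

    listSum : List ℂ → ℂ
    listSum = foldr _+ᶜ_ 0ᶜ

    listSum-++ : ∀ xs ys → listSum (xs ++ ys) ≈ᶜ listSum xs +ᶜ listSum ys
    listSum-++ []       ys = symᶜ (+ᶜ-identityˡ _)
    listSum-++ (x ∷ xs) ys = transᶜ (+ᶜ-congˡ (listSum-++ xs ys)) (symᶜ (+ᶜ-assoc x (listSum xs) (listSum ys)))

    listSum-↭ : ∀ {A : Set} (G : A → ℂ) {xs ys} → xs ↭ ys → listSum (map G xs) ≈ᶜ listSum (map G ys)
    listSum-↭ G Permutation.refl          = reflᶜ
    listSum-↭ G (Permutation.prep x p)    = +ᶜ-congˡ (listSum-↭ G p)
    listSum-↭ G (Permutation.swap {xs} {ys} x y p) = transᶜ (+ᶜ-congˡ (+ᶜ-congˡ (listSum-↭ G p)))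
      (solveᶜ 3 (λ x y s → x ⊕ (y ⊕ s) ⩵ y ⊕ (x ⊕ s)) reflᶜ (G x) (G y) (listSum (map G ys)))
    listSum-↭ G (Permutation.trans p q)   = transᶜ (listSum-↭ G p) (listSum-↭ G q)

    listSum-concatMap : ∀ {A B : Set} (H : B → ℂ) (rows : A → List B) xs →
                        listSum (map H (concatMap rows xs)) ≈ᶜ listSum (map (λ x → listSum (map H (rows x))) xs)
    listSum-concatMap H rows []       = reflᶜ
    listSum-concatMap H rows (x ∷ xs) = transᶜ
      (transᶜ (reflexiveᶜ (≡.cong listSum (map-++ H (rows x) (concatMap rows xs)))) (listSum-++ (map H (rows x)) _))
      (+ᶜ-congˡ (listSum-concatMap H rows xs))

    listSum-applyUpTo : ∀ {B : Set} (H : B → ℂ) (row : ℕ → B) (h : ℕ → ℕ) n →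
                        listSum (map H (map row (applyUpTo h n))) ≈ᶜ partialSum (λ i → H (row (h i))) n
    listSum-applyUpTo H row h zero    = reflᶜ
    listSum-applyUpTo H row h (suc n) = transᶜ (+ᶜ-congˡ (listSum-applyUpTo H row (h ∘ suc) n))
      (symᶜ (partialSum-suc (λ i → H (row (h i))) n))

    -- By `heckePairs` only a = 1, d = p and a = p, d = 1 survive; the first gives the p translates,
    -- and d = 1 leaves b = 0 alone.
    heckeSum : ∀ N r → Prime (suc r) → suc r ∤ N → ∀ (H : M₂⁺ → ℂ) →
      listSum (map H (heckeRepresentatives N (suc r))) ≈ᶜ
      partialSum (λ b → H (upperTriangular 1 b (suc r))) (suc r) +ᶜ H (upperTriangular (suc r) 0 1)
    heckeSum N r pp p∤N H = transᶜ (listSum-concatMap H rows pairs) (transᶜ (listSum-↭ G (heckePairs N r pp p∤N))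
      (+ᶜ-cong (listSum-applyUpTo H (λ b → upperTriangular 1 b (suc r)) (λ b → b) (suc r))
        (transᶜ (+ᶜ-identityʳ (G (r , 0))) (+ᶜ-identityʳ (H (upperTriangular (suc r) 0 1))))))
      where
      rows : ℕ × ℕ → List M₂⁺
      rows (i , j) = map (λ b → upperTriangular (suc i) b (suc j)) (upTo (suc j))
      pairs : List (ℕ × ℕ)
      pairs = filter (heckePair? N (suc r)) (cartesianProduct (upTo (suc r)) (upTo (suc r)))
      G : ℕ × ℕ → ℂ
      G x = listSum (map H (rows x))

  open HeckeOperators public

  -- Roots of unity and the nomes of the points in the Hecke sum.

  module RootsOfUnity where

    open CommutativeExpProperties (CommutativeRing.commutativeSemiring ℂ-commutativeRing) public using ()
      renaming (^-distrib-* to ^ᶜ-distrib-*)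

    private
      -- Meant for u = exp(iπ), which is real since sin π = 0 and lies on the unit circle. Its
      -- square exp(2πi) is 1, and no decision between u = 1 and u = -1 is made.
      square-of-sign : ∀ u → im u ≈ 0# → ∣ u ∣² ≈ 1# → u *ᶜ u ≈ᶜ 1ᶜ
      square-of-sign u im≈0 norm≈1 =
        trans (solve 2 (λ a b → a :* a :- b :* b := (a :* a :+ b :* b) :- (b :* b :+ b :* b)) refl (re u) (im u))
          (trans (+-cong norm≈1 (-‿cong (trans (+-cong im²≈0 im²≈0) (+-identityʳ 0#))))
            (trans (+-congˡ -0#≈0#) (+-identityʳ 1#))) ,
        trans (+-cong (trans (*-congˡ im≈0) (zeroʳ (re u))) (trans (*-congʳ im≈0) (zeroˡ (re u)))) (+-identityʳ 0#)
        where
        im²≈0 : im u * im u ≈ 0#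
        im²≈0 = trans (*-congʳ im≈0) (zeroˡ (im u))

    module Roots (π : ℝ) (isPi : IsPi π) where

      open Fourier π (IsPi.positive isPi) public

      τ𝕚≈2·𝕚π : τ𝕚 ≈ᶜ ofℕ 2 *ᶜ (𝕚 *ᶜ ofReal π)
      τ𝕚≈2·𝕚π = transᶜ (*ᶜ-congʳ (ofReal-* (fromℕ 2) π))
        (solveᶜ 3 (λ t p i → (t ⊗ p) ⊗ i ⩵ t ⊗ (i ⊗ p)) reflᶜ (ofℕ 2) (ofReal π) 𝕚)

      exp-τ𝕚 : exp τ𝕚 ≈ᶜ 1ᶜ
      exp-τ𝕚 = begin
        exp τ𝕚                           ≈⟨ exp-cong τ𝕚≈2·𝕚π ⟩
        exp (ofℕ 2 *ᶜ (𝕚 *ᶜ ofReal π))   ≈⟨ exp-ofℕ* 2 (𝕚 *ᶜ ofReal π) ⟩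
        u *ᶜ (u *ᶜ 1ᶜ)                   ≈⟨ *ᶜ-congˡ (*ᶜ-identityʳ u) ⟩
        u *ᶜ u                           ≈⟨ square-of-sign u (IsPi.sinπ≈0 isPi) (unit-circle π) ⟩
        1ᶜ                               ∎
        where
        open SetoidReasoning ℂ-setoid
        u : ℂ
        u = exp (𝕚 *ᶜ ofReal π)

      module _ (r : ℕ) where

        private
          p : ℕ
          p = suc r

        θ : ℂ
        θ = τ𝕚 *ᶜ ofReal (1/ (suc r))

        ζ : ℂ
        ζ = exp θ

        p*1/p : ofℕ (suc r) *ᶜ ofReal (1/ (suc r)) ≈ᶜ 1ᶜ
        p*1/p = transᶜ (symᶜ (ofReal-* (fromℕ p) (1/ p))) (ofReal-cong (1/-correct p))

        ζ^p : ζ ^ᶜ suc r ≈ᶜ 1ᶜ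
        ζ^p = transᶜ (symᶜ (exp-ofℕ* p θ)) (transᶜ (exp-cong eq) exp-τ𝕚)
          where
          eq : ofℕ p *ᶜ θ ≈ᶜ τ𝕚
          eq = transᶜ (solveᶜ 3 (λ p t i → p ⊗ (t ⊗ i) ⩵ t ⊗ (p ⊗ i)) reflᶜ (ofℕ p) τ𝕚 (ofReal (1/ p)))
            (transᶜ (*ᶜ-congˡ p*1/p) (*ᶜ-identityʳ τ𝕚))

        ζ⊑1 : ζ ⊑ 1#
        ζ⊑1 = norm≤ (<⇒≤ 0<1) (≤-refl (trans (∣∣²-cong (exp-cong eq)) (trans (unit-circle (τ * 1/ p)) (sym (*-identityʳ 1#)))))
          where
          eq : θ ≈ᶜ 𝕚 *ᶜ ofReal (τ * 1/ p)
          eq = transᶜ (solveᶜ 3 (λ t i x → (t ⊗ i) ⊗ x ⩵ i ⊗ (t ⊗ x)) reflᶜ (ofReal τ) 𝕚 (ofReal (1/ p)))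
            (*ᶜ-congˡ (symᶜ (ofReal-* τ (1/ p))))

        ζ^b^p : ∀ b → (ζ ^ᶜ b) ^ᶜ suc r ≈ᶜ 1ᶜ
        ζ^b^p b = transᶜ (^ᶜ-assocʳ ζ b p) (transᶜ (reflexiveᶜ (≡.cong (ζ ^ᶜ_) (ℕₚ.*-comm b p)))
          (transᶜ (symᶜ (^ᶜ-assocʳ ζ p b)) (transᶜ (^ᶜ-congˡ b ζ^p) (1ᶜ^ b))))

        ζ^b^p² : ∀ b → (ζ ^ᶜ b) ^ᶜ (suc r ℕ.* suc r) ≈ᶜ 1ᶜ
        ζ^b^p² b = transᶜ (symᶜ (^ᶜ-assocʳ (ζ ^ᶜ b) p p)) (transᶜ (^ᶜ-congˡ p (ζ^b^p b)) (1ᶜ^ p))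

        w : ℕ → ℂ
        w n = ofReal (X n)

        Y : ℕ → ℝ
        Y n = fromℕ (suc n)

        -- The point at which the Hecke relation is expanded; its level is chosen so that
        -- all translates have nomes of the form ζᵇ Xⁱ.
        basePoint : ℕ → ℍ
        basePoint n = iℝ (fromℕ (suc r) * Y n) (*-pos (fromℕ-pos (suc r)) (fromℕ-pos (suc n)))

        exp-w : ∀ n → exp (τ𝕚 *ᶜ (0# +i Y n)) ≈ᶜ w n
        exp-w n = transᶜ (exp-cong (τ𝕚*i (Y n))) (exp-ofReal (- (τ * Y n)))

        basePoint≈ : ∀ n → point (basePoint n) ≈ᶜ ofℕ (suc r) *ᶜ (0# +i Y n)
        basePoint≈ n = solve 2 (λ p y → con +0 := p :* con +0 :- con +0 :* y) refl (fromℕ p) (Y n)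
                     , solve 2 (λ p y → p :* y := p :* y :+ con +0 :* con +0) refl (fromℕ p) (Y n)

        nome-basePoint : ∀ n → nome (basePoint n) ≈ᶜ w n ^ᶜ suc r
        nome-basePoint n = begin
          exp (τ𝕚 *ᶜ point (basePoint n))         ≈⟨ exp-cong (transᶜ (*ᶜ-congˡ (basePoint≈ n))
                                                       (solveᶜ 3 (λ t p y → t ⊗ (p ⊗ y) ⩵ p ⊗ (t ⊗ y)) reflᶜ τ𝕚 (ofℕ p) (0# +i Y n))) ⟩
          exp (ofℕ p *ᶜ (τ𝕚 *ᶜ (0# +i Y n)))      ≈⟨ exp-ofℕ* p (τ𝕚 *ᶜ (0# +i Y n)) ⟩
          exp (τ𝕚 *ᶜ (0# +i Y n)) ^ᶜ p            ≈⟨ ^ᶜ-congˡ p (exp-w n) ⟩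
          w n ^ᶜ p                                ∎
          where open SetoidReasoning ℂ-setoid

        nome-dilate : ∀ n → nome (upperTriangular (suc r) 0 1 ⟨ basePoint n ⟩) ≈ᶜ w n ^ᶜ (suc r ℕ.* suc r)
        nome-dilate n = begin
          exp (τ𝕚 *ᶜ pt)                        ≈⟨ exp-cong (transᶜ (*ᶜ-congˡ pt≈) (solveᶜ 3 (λ t p y → t ⊗ (p ⊗ y) ⩵ p ⊗ (t ⊗ y)) reflᶜ τ𝕚 (ofℕ p) (point (basePoint n)))) ⟩
          exp (ofℕ p *ᶜ (τ𝕚 *ᶜ point (basePoint n))) ≈⟨ exp-ofℕ* p (τ𝕚 *ᶜ point (basePoint n)) ⟩
          nome (basePoint n) ^ᶜ p               ≈⟨ ^ᶜ-congˡ p (nome-basePoint n) ⟩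
          (w n ^ᶜ p) ^ᶜ p                       ≈⟨ ^ᶜ-assocʳ (w n) p p ⟩
          w n ^ᶜ (p ℕ.* p)                      ∎
          where
          open SetoidReasoning ℂ-setoid
          pt : ℂ
          pt = point (upperTriangular (suc r) 0 1 ⟨ basePoint n ⟩)
          pt≈ : pt ≈ᶜ ofℕ p *ᶜ point (basePoint n)
          pt≈ = transᶜ (symᶜ (*ᶜ-identityˡ pt)) (transᶜ (*ᶜ-congʳ (symᶜ (ofReal-cong fromℕ-1)))
            (transᶜ (ut-point r 0 0 (basePoint n)) (+ᶜ-identityʳ _)))

        -- At z = ipY the translate is (z+b)/p = iY + b/p, and the addition law separates the two
        -- summands.
        nome-translate : ∀ b n → nome (upperTriangular 1 b (suc r) ⟨ basePoint n ⟩) ≈ᶜ w n *ᶜ ζ ^ᶜ b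
        nome-translate b n = begin
          exp (τ𝕚 *ᶜ pt)                                  ≈⟨ exp-cong τ𝕚pt≈ ⟩
          exp (τ𝕚 *ᶜ (0# +i Y n) +ᶜ ofℕ b *ᶜ θ)           ≈⟨ exp-+ (τ𝕚 *ᶜ (0# +i Y n)) (ofℕ b *ᶜ θ) ⟩
          exp (τ𝕚 *ᶜ (0# +i Y n)) *ᶜ exp (ofℕ b *ᶜ θ)     ≈⟨ *ᶜ-cong (exp-w n) (exp-ofℕ* b θ) ⟩
          w n *ᶜ ζ ^ᶜ b                                   ∎
          where
          open SetoidReasoning ℂ-setoid
          pt i iy : ℂ
          pt = point (upperTriangular 1 b (suc r) ⟨ basePoint n ⟩)
          i  = ofReal (1/ p)
          iy = 0# +i Y n
          p*pt : ofℕ p *ᶜ pt ≈ᶜ ofℕ p *ᶜ iy +ᶜ ofℕ b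
          p*pt = transᶜ (ut-point 0 b r (basePoint n)) (+ᶜ-congʳ (transᶜ (*ᶜ-congʳ (ofReal-cong fromℕ-1))
            (transᶜ (*ᶜ-identityˡ _) (basePoint≈ n))))
          τ𝕚pt≈ : τ𝕚 *ᶜ pt ≈ᶜ τ𝕚 *ᶜ iy +ᶜ ofℕ b *ᶜ θ
          τ𝕚pt≈ = begin
            τ𝕚 *ᶜ pt                                  ≈⟨ *ᶜ-identityˡ _ ⟨
            1ᶜ *ᶜ (τ𝕚 *ᶜ pt)                          ≈⟨ *ᶜ-congʳ p*1/p ⟨
            (ofℕ p *ᶜ i) *ᶜ (τ𝕚 *ᶜ pt)                ≈⟨ solveᶜ 4 (λ p i t x → (p ⊗ i) ⊗ (t ⊗ x) ⩵ (t ⊗ i) ⊗ (p ⊗ x)) reflᶜ (ofℕ p) i τ𝕚 pt ⟩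
            (τ𝕚 *ᶜ i) *ᶜ (ofℕ p *ᶜ pt)                ≈⟨ *ᶜ-congˡ p*pt ⟩
            (τ𝕚 *ᶜ i) *ᶜ (ofℕ p *ᶜ iy +ᶜ ofℕ b)       ≈⟨ solveᶜ 5 (λ t i p y b → (t ⊗ i) ⊗ (p ⊗ y ⊕ b) ⩵ (p ⊗ i) ⊗ (t ⊗ y) ⊕ b ⊗ (t ⊗ i)) reflᶜ τ𝕚 i (ofℕ p) iy (ofℕ b) ⟩
            (ofℕ p *ᶜ i) *ᶜ (τ𝕚 *ᶜ iy) +ᶜ ofℕ b *ᶜ θ  ≈⟨ +ᶜ-congʳ (transᶜ (*ᶜ-congʳ p*1/p) (*ᶜ-identityˡ _)) ⟩
            τ𝕚 *ᶜ iy +ᶜ ofℕ b *ᶜ θ                    ∎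

  open RootsOfUnity public

  -- The relation between the coefficients at p and at p².

  module EigenformCoefficients where

    weightFactor : ℕ → ℤ → ℂ
    weightFactor r k = powᶜ (ofℕ (suc r)) (nonZero-ofReal (fromℕ-pos (suc r))) (k ℤ.- ℤ.1ℤ)

    partialSum-const : ∀ z n → partialSum (λ _ → z) n ≈ᶜ ofℕ n *ᶜ z
    partialSum-const z zero    = symᶜ (zeroˡᶜ z)
    partialSum-const z (suc n) = transᶜ (+ᶜ-congʳ (partialSum-const z n)) (transᶜ
      (solveᶜ 2 (λ n z → n ⊗ z ⊕ z ⩵ z ⊕ n ⊗ z) reflᶜ (ofℕ n) z)
      (transᶜ (+ᶜ-congʳ (symᶜ (*ᶜ-identityˡ z)))
        (transᶜ (solveᶜ 3 (λ e n z → e ⊗ z ⊕ n ⊗ z ⩵ (e ⊕ n) ⊗ z) reflᶜ 1ᶜ (ofℕ n) z) (*ᶜ-congʳ (symᶜ (ofReal-+ 1# (fromℕ n)))))))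

    module Relation (π : ℝ) (isPi : IsPi π) (N : ℕ) (k : ℤ) (f : ℍ → ℂ) (eigenform : IsCuspidalEigenform N k f)
                    (a : ℕ → ℂ) (F : IsFourierExpansion π f a) (a₁≈1 : a 1 ≈ᶜ 1ᶜ)
                    (r : ℕ) (pp : Prime (suc r)) (p∤N : suc r ∤ N) where

      open Roots π isPi
      open Expansions X X-pos X-small δ 0<δ δ≤1

      p m : ℕ
      p = suc r
      m = suc (p ℕ.* p)

      â : ℕ → ℂ
      â = dropConstant a

      P κ_k U μ : ℂ
      P   = ofℕ p
      κ_k = weightFactor r k
      -- The slash factor of a translate: determinant p and denominator p give p^(k-1) p^(-k) = 1/p.
      U   = κ_k *ᶜ powᶜ P (nonZero-ofReal (fromℕ-pos p)) (ℤ.- k)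
      μ   = proj₁ (IsCuspidalEigenform.isEigenvector eigenform p (ℕ.s≤s ℕ.z≤n))

      translate : ℕ → ℍ → ℍ
      translate b z = upperTriangular 1 b p ⟨ z ⟩

      dilate : ℍ → ℍ
      dilate z = upperTriangular p 0 1 ⟨ z ⟩

      P*U : P *ᶜ U ≈ᶜ 1ᶜ
      P*U = transᶜ (symᶜ (*ᶜ-assoc P κ_k _)) (transᶜ (*ᶜ-congʳ (powᶜ-suc P _ k)) (powᶜ-inverse P _ k))

      slash-translate : ∀ b z → (f ∣[ k ] upperTriangular 1 b p) z ≈ᶜ U *ᶜ f (translate b z)
      slash-translate b z = *ᶜ-congʳ (*ᶜ-cong
        (powᶜ-cong (k ℤ.- ℤ.1ℤ) (transᶜ (ut-det 0 b r) (reflexiveᶜ (≡.cong ofℕ (ℕₚ.*-identityˡ p)))))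
        (powᶜ-cong (ℤ.- k) (ut-denominator 0 b r z)))

      slash-dilate : ∀ z → (f ∣[ k ] upperTriangular p 0 1) z ≈ᶜ κ_k *ᶜ f (dilate z)
      slash-dilate z = *ᶜ-congʳ (transᶜ (*ᶜ-cong
        (powᶜ-cong (k ℤ.- ℤ.1ℤ) (transᶜ (ut-det r 0 0) (reflexiveᶜ (≡.cong ofℕ (ℕₚ.*-identityʳ p)))))
        (powᶜ-1 (ℤ.- k) (transᶜ (ut-denominator r 0 0 z) (ofReal-cong fromℕ-1)))) (*ᶜ-identityʳ κ_k))

      -- Everything is moved to one side, because `expansion-unique` concerns expansions of the zero
      -- function.
      hecke-relation : ∀ z → (partialSum (λ b → U *ᶜ f (translate b z)) p +ᶜ κ_k *ᶜ f (dilate z)) +ᶜ (-ᶜ μ) *ᶜ f z ≈ᶜ 0ᶜ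
      hecke-relation z = transᶜ (+ᶜ-congʳ Tf) (solveᶜ 2 (λ m f → m ⊗ f ⊕ (⊝ m) ⊗ f ⩵ κ +0) reflᶜ μ (f z))
        where
        Tf : partialSum (λ b → U *ᶜ f (translate b z)) p +ᶜ κ_k *ᶜ f (dilate z) ≈ᶜ μ *ᶜ f z
        Tf = transᶜ (symᶜ (+ᶜ-cong (partialSum-cong (λ b → slash-translate b z) p) (slash-dilate z)))
          (transᶜ (symᶜ (heckeSum N r pp p∤N (λ γ → (f ∣[ k ] γ) z)))
            (proj₂ (IsCuspidalEigenform.isEigenvector eigenform p (ℕ.s≤s ℕ.z≤n)) z))

      translateCoefficients : ℕ → ℕ → ℂ
      translateCoefficients b i = â i *ᶜ (ζ r ^ᶜ b) ^ᶜ i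

      -- The nome of a translate is ζᵇX, of absolute value at most X. The root of unity is moved
      -- into the coefficients, so that the expansion is in the real variable X.
      translate-expansion : ∀ b → Expansion m (λ n → f (translate b (basePoint r n))) (translateCoefficients b)
      translate-expansion b = expansion (proj₁ taylor) (proj₁ (proj₂ taylor)) λ n Xn≤δ →
        ⊑-resp (-ᶜ-cong₂ (reflᶜ {f (translate b (basePoint r n))}) (partialSum-cong (λ i → rearrange n i) m)) (refl {_})
          (proj₂ (proj₂ taylor) (translate b (basePoint r n)) (nome-translate r b n) (X-pos n) (wζ⊑X n) Xn≤δ)
        where
        taylor : ∃ λ K → 0# ≤ K × (∀ z {w x} → nome z ≈ᶜ w → 0# < x → w ⊑ x → x ≤ δ →
                   (f z -ᶜ partialSum (powerTerm â w) m) ⊑ K * x ^ʳ m)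
        taylor = fourier-remainder F m
        rearrange : ∀ n i → powerTerm â (w r n *ᶜ ζ r ^ᶜ b) i ≈ᶜ powerTerm (translateCoefficients b) (w r n) i
        rearrange n i = transᶜ (*ᶜ-congˡ (^ᶜ-distrib-* (w r n) (ζ r ^ᶜ b) i))
          (solveᶜ 3 (λ a w z → a ⊗ (w ⊗ z) ⩵ (a ⊗ z) ⊗ w) reflᶜ (â i) (w r n ^ᶜ i) ((ζ r ^ᶜ b) ^ᶜ i))
        wζ⊑X : ∀ n → (w r n *ᶜ ζ r ^ᶜ b) ⊑ X n
        wζ⊑X n = ⊑-resp reflᶜ (trans (*-congˡ (1ʳ^ b)) (*-identityʳ (X n))) (⊑-* (X⊑ n) (⊑-^ (ζ⊑1 r) b))

      power-≤δ : ∀ n q → .{{_ : NonZero q}} → X n ≤ δ → X n ^ʳ q ≤ δ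
      power-≤δ n q Xn≤δ = ≤-trans (^ʳ-antimono-≤ (<⇒≤ (X-pos n)) (≤-trans Xn≤δ δ≤1) (ℕ.>-nonZero⁻¹ q))
        (≤-trans (≤-refl (*-identityʳ (X n))) Xn≤δ)

      stretched-expansion : ∀ q .{{_ : NonZero q}} J (g : ℕ → ℍ) → (∀ n → nome (g n) ≈ᶜ w r n ^ᶜ q) →
                            Expansion (suc (J ℕ.* q)) (λ n → f (g n)) (stretch q â)
      stretched-expansion q J g nome≈ = expansion-stretch X X-pos X-small δ 0<δ δ≤1 q J (proj₁ taylor) (proj₁ (proj₂ taylor))
        λ n Xn≤δ → proj₂ (proj₂ taylor) (g n) (nome≈ n) (^ʳ-pos (X-pos n) q) (⊑-^ (X⊑ n) q) (power-≤δ n q Xn≤δ)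
        where
        taylor : ∃ λ K → 0# ≤ K × (∀ z {w x} → nome z ≈ᶜ w → 0# < x → w ⊑ x → x ≤ δ →
                   (f z -ᶜ partialSum (powerTerm â w) (suc J)) ⊑ K * x ^ʳ suc J)
        taylor = fourier-remainder F (suc J)

      p²≢0 : NonZero (p ℕ.* p)
      p²≢0 = ℕₚ.m*n≢0 p p

      d : ℕ → ℂ
      d i = (partialSum (λ b → U *ᶜ translateCoefficients b i) p +ᶜ κ_k *ᶜ stretch (p ℕ.* p) â i) +ᶜ (-ᶜ μ) *ᶜ stretch p â i

      -- The truncation p² + 1 lies just past the coefficient p². The dilate has nome X^(p²) and
      -- needs J = 1; f at the base point has nome Xᵖ and needs J = p. Both then stop at the same
      -- order as the translates.
      hecke-expansion : Expansion m (λ _ → 0ᶜ) d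
      hecke-expansion = expansion-resp (λ n → hecke-relation (basePoint r n)) (λ i → reflᶜ {d i})
        (expansion-+ (expansion-+
          (expansion-sum p (λ b → expansion-* U (translate-expansion b)))
          (expansion-* κ_k (≡.subst (λ m → Expansion m (λ n → f (dilate (basePoint r n))) (stretch (p ℕ.* p) â))
            (≡.cong suc (ℕₚ.*-identityˡ (p ℕ.* p)))
            (stretched-expansion (p ℕ.* p) {{p²≢0}} 1 (λ n → dilate (basePoint r n)) (nome-dilate r)))))
          (expansion-* (-ᶜ μ) (stretched-expansion p p (basePoint r) (nome-basePoint r))))

      sum-coefficient : ∀ i → (∀ b → (ζ r ^ᶜ b) ^ᶜ i ≈ᶜ 1ᶜ) → partialSum (λ b → U *ᶜ translateCoefficients b i) p ≈ᶜ â i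
      sum-coefficient i ζ^bi≈1 = begin
        partialSum (λ b → U *ᶜ translateCoefficients b i) p  ≈⟨ partialSum-cong (λ b → *ᶜ-congˡ (transᶜ (*ᶜ-congˡ (ζ^bi≈1 b)) (*ᶜ-identityʳ (â i)))) p ⟩
        partialSum (λ _ → U *ᶜ â i) p                        ≈⟨ partialSum-const (U *ᶜ â i) p ⟩
        P *ᶜ (U *ᶜ â i)                                      ≈⟨ *ᶜ-assoc P U (â i) ⟨
        (P *ᶜ U) *ᶜ â i                                      ≈⟨ *ᶜ-congʳ P*U ⟩
        1ᶜ *ᶜ â i                                            ≈⟨ *ᶜ-identityˡ (â i) ⟩
        â i                                                  ∎
        where open SetoidReasoning ℂ-setoid

      p<p² : p ℕ.< p ℕ.* p
      p<p² = ℕₚ.m<m*n p p (ℕ.s≤s (ℕₚ.n≢0⇒n>0 λ where ≡.refl → ¬prime[1] pp))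

      -- The coefficient of Xᵖ: the p translates contribute a_p/p each, the dilate nothing as p² ∤
      -- p, and the eigenvalue term -μa₁ = -μ.
      a-p : a p ≈ᶜ μ
      a-p = begin
        -- The solver reads its constant 1 as `ofℕ 1`, that is 1 + 0, which agrees with `1ᶜ` only up
        -- to `≈ᶜ`; hence both forms occur.
        a p                                                ≈⟨ solveᶜ 3 (λ a k m → a ⩵ ((a ⊕ k ⊗ κ +0) ⊕ (⊝ m) ⊗ κ (+ 1)) ⊕ m ⊗ κ (+ 1)) reflᶜ (a p) κ_k μ ⟩
        ((a p +ᶜ κ_k *ᶜ 0ᶜ) +ᶜ (-ᶜ μ) *ᶜ ofℕ 1) +ᶜ μ *ᶜ ofℕ 1 ≈⟨ +ᶜ-cong (transᶜ (symᶜ coefficient) (expansion-unique m hecke-expansion p (ℕₚ.m≤n⇒m≤1+n p<p²))) (*ᶜ-congˡ (ofReal-cong fromℕ-1)) ⟩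
        0ᶜ +ᶜ μ *ᶜ 1ᶜ                                      ≈⟨ transᶜ (+ᶜ-identityˡ _) (*ᶜ-identityʳ μ) ⟩
        μ                                                  ∎
        where
        open SetoidReasoning ℂ-setoid
        coefficient : d p ≈ᶜ (a p +ᶜ κ_k *ᶜ 0ᶜ) +ᶜ (-ᶜ μ) *ᶜ ofℕ 1
        coefficient = +ᶜ-cong
          (+ᶜ-cong (sum-coefficient p (ζ^b^p r)) (*ᶜ-congˡ (reflexiveᶜ (stretch-∤ (p ℕ.* p) â λ p²∣p → ℕₚ.<⇒≱ p<p² (∣⇒≤ p²∣p)))))
          (*ᶜ-congˡ (transᶜ (reflexiveᶜ (stretch-multiple p â 1 (≡.sym (ℕₚ.*-identityˡ p)))) (transᶜ a₁≈1 (symᶜ (ofReal-cong fromℕ-1)))))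

      -- The coefficient of X^(p²): the translates contribute a_{p²}, the dilate p^(k-1)a₁, and the
      -- eigenvalue term -μa_p with μ = a_p.
      a-p² : a (p ℕ.* p) +ᶜ κ_k ≈ᶜ a p *ᶜ a p
      a-p² = begin
        a (p ℕ.* p) +ᶜ κ_k                                   ≈⟨ solveᶜ 4 (λ x k m y → x ⊕ k ⩵ ((x ⊕ k) ⊕ (⊝ m) ⊗ y) ⊕ m ⊗ y) reflᶜ (a (p ℕ.* p)) κ_k μ (a p) ⟩
        ((a (p ℕ.* p) +ᶜ κ_k) +ᶜ (-ᶜ μ) *ᶜ a p) +ᶜ μ *ᶜ a p  ≈⟨ +ᶜ-cong (transᶜ (symᶜ coefficient) (expansion-unique m hecke-expansion (p ℕ.* p) ℕₚ.≤-refl)) (*ᶜ-congʳ (symᶜ a-p)) ⟩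
        0ᶜ +ᶜ a p *ᶜ a p                                     ≈⟨ +ᶜ-identityˡ _ ⟩
        a p *ᶜ a p                                           ∎
        where
        open SetoidReasoning ℂ-setoid
        coefficient : d (p ℕ.* p) ≈ᶜ (a (p ℕ.* p) +ᶜ κ_k) +ᶜ (-ᶜ μ) *ᶜ a p
        coefficient = +ᶜ-cong
          (+ᶜ-cong (sum-coefficient (p ℕ.* p) (ζ^b^p² r))
            (transᶜ (*ᶜ-congˡ (transᶜ (reflexiveᶜ (stretch-multiple (p ℕ.* p) {{p²≢0}} â 1 (≡.sym (ℕₚ.*-identityˡ (p ℕ.* p))))) a₁≈1)) (*ᶜ-identityʳ κ_k)))
          (*ᶜ-congˡ (reflexiveᶜ (stretch-multiple p â p ≡.refl)))

  open EigenformCoefficients public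

  -- Apartness of the weight factors, and the size of the witness.

  module Distinguishing where

    nonZero-resp : ∀ {z w} → z ≈ᶜ w → NonZeroᶜ z → NonZeroᶜ w
    nonZero-resp z≈w = <-respʳ-≈ (∣∣²-cong z≈w)

    nonZero-* : ∀ {z w} → NonZeroᶜ z → NonZeroᶜ w → NonZeroᶜ (z *ᶜ w)
    nonZero-* {z} {w} z≠0 w≠0 = <-respʳ-≈ (sym (∣∣²-* z w)) (*-pos z≠0 w≠0)

    nonZero-*⁻ : ∀ {z w} → NonZeroᶜ (z *ᶜ w) → NonZeroᶜ z
    nonZero-*⁻ {z} {w} p = proj₁ (0<*⇒ (∣∣²-nonneg z) (<-respʳ-≈ (∣∣²-* z w) p))

    nonZero-neg : ∀ {z} → NonZeroᶜ z → NonZeroᶜ (-ᶜ z)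
    nonZero-neg {z} = <-respʳ-≈ (solve 2 (λ a b → a :* a :+ b :* b := (:- a) :* (:- a) :+ (:- b) :* (:- b)) refl (re z) (im z))

    -- By the parallelogram law ∣z+w∣² ≤ 2∣z∣² + 2∣w∣², and a positive sum of reals has a positive
    -- summand.
    nonZero-+⁻ : ∀ {z w} → NonZeroᶜ (z +ᶜ w) → NonZeroᶜ z ⊎ NonZeroᶜ w
    nonZero-+⁻ {z} {w} p = [ (λ q → inj₁ (double q)) , (λ q → inj₂ (double q)) ]′ (0<+⇒ (<-≤-trans p parallelogram))
      where
      double : ∀ {x} → 0# < x + x → 0# < x
      double q = [ (λ x>0 → x>0) , (λ x>0 → x>0) ]′ (0<+⇒ q)
      parallelogram : ∣ z +ᶜ w ∣² ≤ (∣ z ∣² + ∣ z ∣²) + (∣ w ∣² + ∣ w ∣²)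
      parallelogram = 0≤-⇒≤ (≤-resp-≈ refl
        (solve 4 (λ a b c d → (a :- c) :* (a :- c) :+ (b :- d) :* (b :- d)
          := (((a :* a :+ b :* b) :+ (a :* a :+ b :* b)) :+ ((c :* c :+ d :* d) :+ (c :* c :+ d :* d)))
             :- ((a :+ c) :* (a :+ c) :+ (b :+ d) :* (b :+ d))) refl (re z) (im z) (re w) (im w))
        (∣∣²-nonneg (z -ᶜ w)))

    nonZero⇒≉ : ∀ {z w} → NonZeroᶜ (z -ᶜ w) → ¬ (z ≈ᶜ w)
    nonZero⇒≉ {z} {w} p z≈w = <-irrefl refl (<-respʳ-≈
      (trans (∣∣²-cong (transᶜ (-ᶜ-cong₂ z≈w reflᶜ) (-ᶜ-inverseʳ w))) (solve 0 (con +0 :* con +0 :+ con +0 :* con +0 := con +0) refl)) p)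

    powᶜ-+ : ∀ z p j n → powᶜ z p (j ℤ.+ + n) ≈ᶜ z ^ᶜ n *ᶜ powᶜ z p j
    powᶜ-+ z p j zero    = transᶜ (reflexiveᶜ (≡.cong (powᶜ z p) (ℤₚ.+-identityʳ j))) (symᶜ (*ᶜ-identityˡ _))
    powᶜ-+ z p j (suc n) = transᶜ (symᶜ (powᶜ-suc z p (j ℤ.+ + suc n))) (transᶜ (*ᶜ-congˡ (transᶜ
      (reflexiveᶜ (≡.cong (powᶜ z p) exponent)) (powᶜ-+ z p j n))) (symᶜ (*ᶜ-assoc z (z ^ᶜ n) _)))
      where
      exponent : j ℤ.+ + suc n ℤ.- ℤ.1ℤ ≡ j ℤ.+ + n
      exponent = ℤₚ.+-assoc j (+ suc n) (ℤ.- ℤ.1ℤ)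

    ofℕ-^ : ∀ b n → ofℕ (b ℕ.^ n) ≈ᶜ ofℕ b ^ᶜ n
    ofℕ-^ b zero    = ofReal-cong fromℕ-1
    ofℕ-^ b (suc n) = transᶜ (ofReal-cong (×1-homo-* b (b ℕ.^ n))) (transᶜ (ofReal-* (fromℕ b) (fromℕ (b ℕ.^ n))) (*ᶜ-congˡ (ofℕ-^ b n)))

    module _ (m : ℕ) where

      private
        P : ℂ
        P = ofℕ (2 ℕ.+ m)

      power-nonZero : ∀ n → NonZeroᶜ (P ^ᶜ suc n -ᶜ 1ᶜ)
      power-nonZero n = nonZero-resp
        (transᶜ (ofReal-+ x (- 1#)) (+ᶜ-cong (ofℕ-^ (2 ℕ.+ m) (suc n)) (ofReal-neg 1#)))
        (nonZero-ofReal (<⇒0<- 1<x))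
        where
        x : ℝ
        x = fromℕ ((2 ℕ.+ m) ℕ.^ suc n)
        1<x : 1# < x
        1<x = <-≤-trans (<-respˡ-≈ (+-identityˡ 1#) (<-respʳ-≈ (+-congˡ (sym (+-identityʳ 1#))) (+-monoˡ-< 1# 0<1)))
          (fromℕ-mono {2} (ℕₚ.≤-trans (ℕₚ.m≤m+n 2 m) (ℕₚ.m≤m*n (2 ℕ.+ m) ((2 ℕ.+ m) ℕ.^ n) {{ℕₚ.m^n≢0 (2 ℕ.+ m) n}})))

      -- p^(k′-1) - p^(k-1) = p^(k-1)(p^(n+1) - 1). The first factor is nonzero because it has the
      -- inverse p^(1-k), the second because p^(n+1) ≥ 2.
      weightFactor-increasing : ∀ k k′ n → k′ ℤ.- k ≡ +[1+ n ] →
                                NonZeroᶜ (weightFactor (suc m) k′ -ᶜ weightFactor (suc m) k)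
      weightFactor-increasing k k′ n k′-k≡ = nonZero-resp
        (transᶜ (solveᶜ 3 (λ u q e → u ⊗ (q ⊝ e) ⩵ q ⊗ u ⊝ u ⊗ e) reflᶜ u (P ^ᶜ suc n) 1ᶜ)
          (-ᶜ-cong₂ (symᶜ (transᶜ (reflexiveᶜ (≡.cong (powᶜ P _) exponent)) (powᶜ-+ P _ (k ℤ.- ℤ.1ℤ) (suc n)))) (*ᶜ-identityʳ u)))
        (nonZero-* u≠0 (power-nonZero n))
        where
        u : ℂ
        u = weightFactor (suc m) k
        exponent : k′ ℤ.- ℤ.1ℤ ≡ (k ℤ.- ℤ.1ℤ) ℤ.+ +[1+ n ]
        exponent = ≡.trans (k-1+[k′-k] k k′) (≡.cong (λ e → (k ℤ.- ℤ.1ℤ) ℤ.+ e) k′-k≡)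
        u≠0 : NonZeroᶜ u
        u≠0 = nonZero-*⁻ (nonZero-resp (symᶜ (powᶜ-inverse P _ (k ℤ.- ℤ.1ℤ))) (nonZero-ofReal 0<1))

      weightFactor-injective : ∀ k k′ → k ≢ k′ → NonZeroᶜ (weightFactor (suc m) k -ᶜ weightFactor (suc m) k′)
      weightFactor-injective k k′ k≢k′ = byDifference (k ℤ.- k′) ≡.refl
        where
        byDifference : ∀ e → k ℤ.- k′ ≡ e → NonZeroᶜ (weightFactor (suc m) k -ᶜ weightFactor (suc m) k′)
        byDifference +0       e = ⊥-elim (k≢k′ (ℤₚ.i-j≡0⇒i≡j k k′ e))
        byDifference +[1+ n ] e = weightFactor-increasing k′ k n e
        byDifference -[1+ n ] e = nonZero-resp
          (solveᶜ 2 (λ x y → ⊝ (x ⊝ y) ⩵ y ⊝ x) reflᶜ (weightFactor (suc m) k′) (weightFactor (suc m) k))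
          (nonZero-neg (weightFactor-increasing k k′ n (≡.trans (k′-k≡-[k-k′] k k′) (≡.cong ℤ.-_ e))))

    -- Equality of coefficients is not decidable; cotransitivity of apartness, applied to
    -- κ₁ - κ₂ = (a₁ - b₁)(a₁ + b₁) + (b₂ - a₂), selects the differing one.
    distinguish : ∀ {a₁ a₂ κ₁ b₁ b₂ κ₂} → a₂ +ᶜ κ₁ ≈ᶜ a₁ *ᶜ a₁ → b₂ +ᶜ κ₂ ≈ᶜ b₁ *ᶜ b₁ → NonZeroᶜ (κ₁ -ᶜ κ₂) →
                  ¬ (a₁ ≈ᶜ b₁) ⊎ ¬ (a₂ ≈ᶜ b₂)
    distinguish {a₁} {a₂} {κ₁} {b₁} {b₂} {κ₂} p q κ₁≠κ₂ =
      [ (λ r → inj₁ (nonZero⇒≉ (nonZero-*⁻ r))) , (λ r → inj₂ λ e → nonZero⇒≉ r (symᶜ e)) ]′ (nonZero-+⁻ (nonZero-resp eq κ₁≠κ₂))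
      where
      eq : κ₁ -ᶜ κ₂ ≈ᶜ (a₁ -ᶜ b₁) *ᶜ (a₁ +ᶜ b₁) +ᶜ (b₂ -ᶜ a₂)
      eq = transᶜ (solveᶜ 4 (λ a k b l → k ⊝ l ⩵ ((a ⊕ k) ⊝ (b ⊕ l)) ⊕ (b ⊝ a)) reflᶜ a₂ κ₁ b₂ κ₂)
        (+ᶜ-congʳ (transᶜ (-ᶜ-cong₂ p q) (solveᶜ 2 (λ a b → a ⊗ a ⊝ b ⊗ b ⩵ (a ⊝ b) ⊗ (a ⊕ b)) reflᶜ a₁ b₁)))

    -- The prime is p = m + 2 ≤ 2y + 2 = 2(y+1); squaring gives the constant 4 of the theorem, and
    -- it covers both candidates p and p².
    square-bound : ∀ m y → fromℕ m ≤ y + y → fromℕ ((2 ℕ.+ m) ℕ.* (2 ℕ.+ m)) ≤ fromℕ 4 * (y + 1#) ^ʳ 2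
    square-bound m y m≤2y = ≤-trans (≤-refl (×1-homo-* (2 ℕ.+ m) (2 ℕ.+ m)))
      (≤-trans (*-mono-≤ (fromℕ-nonneg (2 ℕ.+ m)) (≤-trans (fromℕ-nonneg (2 ℕ.+ m)) p≤B) p≤B p≤B)
        (≤-refl (sym (trans (*-congˡ (*-congˡ (*-identityʳ B₁))) (trans (ExpConvergence.four* (B₁ * B₁))
          (solve 1 (λ b → (b :* b :+ b :* b) :+ (b :* b :+ b :* b) := (b :+ b) :* (b :+ b)) refl B₁))))))
      where
      B₁ : ℝ
      B₁ = y + 1#
      p≤B : fromℕ (2 ℕ.+ m) ≤ B₁ + B₁
      p≤B = ≤-trans (≤-refl (solve 2 (λ e m → e :+ (e :+ m) := m :+ (e :+ e)) refl 1# (fromℕ m)))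
        (≤-trans (+-mono-≤ m≤2y (≤-refl refl)) (≤-refl (solve 2 (λ y e → (y :+ y) :+ (e :+ e) := (y :+ e) :+ (y :+ e)) refl y 1#)))

    module _ (π : ℝ) (isPi : IsPi π) (N : ℕ) (k₁ k₂ : ℤ) (k₁≢k₂ : k₁ ≢ k₂) (f g : ℍ → ℂ)
             (f-eigen : IsCuspidalEigenform N k₁ f) (g-eigen : IsCuspidalEigenform N k₂ g)
             (a b : ℕ → ℂ) (F : IsFourierExpansion π f a) (G : IsFourierExpansion π g b)
             (a₁≈1 : a 1 ≈ᶜ 1ᶜ) (b₁≈1 : b 1 ≈ᶜ 1ᶜ) where

      differ-at-prime-or-square : ∀ m → Prime (2 ℕ.+ m) → 2 ℕ.+ m ∤ N →
        ¬ (a (2 ℕ.+ m) ≈ᶜ b (2 ℕ.+ m)) ⊎ ¬ (a ((2 ℕ.+ m) ℕ.* (2 ℕ.+ m)) ≈ᶜ b ((2 ℕ.+ m) ℕ.* (2 ℕ.+ m)))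
      differ-at-prime-or-square m pp p∤N = distinguish
        (Relation.a-p² π isPi N k₁ f f-eigen a F a₁≈1 (suc m) pp p∤N)
        (Relation.a-p² π isPi N k₂ g g-eigen b G b₁≈1 (suc m) pp p∤N)
        (weightFactor-injective m k₁ k₂ k₁≢k₂)

      bounded-witness : ∀ {B} p .{{_ : NonZero p}} → fromℕ (p ℕ.* p) ≤ B →
        ¬ (a p ≈ᶜ b p) ⊎ ¬ (a (p ℕ.* p) ≈ᶜ b (p ℕ.* p)) → ∃ λ n → 1 ℕ.≤ n × (fromℕ n ≤ B) × ¬ (a n ≈ᶜ b n)
      bounded-witness p p²≤B (inj₁ ≉) = p , ℕ.>-nonZero⁻¹ p , ≤-trans (fromℕ-mono (ℕₚ.m≤m*n p p)) p²≤B , ≉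
      bounded-witness p p²≤B (inj₂ ≉) = p ℕ.* p , ℕ.>-nonZero⁻¹ (p ℕ.* p) {{ℕₚ.m*n≢0 p p}} , p²≤B , ≉

  open Distinguishing public

theorem1 : {ℓ ℓ₁ ℓ₂ ℓ₃ : Level} (R : RealNumbers ℓ ℓ₁ ℓ₂ ℓ₃) →
    let open ModularForms R in
    (π : ℝ) → IsPi π →
    (N : ℕ) → 1 ℕ.≤ N →
    (logN : ℝ) → IsLog (fromℕ N) logN →
    (k₁ k₂ : ℤ) → k₁ ≢ k₂ →
    (f g : ℍ → ℂ) → IsCuspidalEigenform N k₁ f → IsCuspidalEigenform N k₂ g →
    (a b : ℕ → ℂ) → IsFourierExpansion π f a → IsFourierExpansion π g b →
    a 1 ≈ᶜ 1ᶜ → b 1 ≈ᶜ 1ᶜ →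
    ∃ λ n → 1 ℕ.≤ n × (fromℕ n ≤ fromℕ 4 * (logN + 1#) ^ʳ 2) × ¬ (a n ≈ᶜ b n)
theorem1 R π isPi N 1≤N logN isLog k₁ k₂ k₁≢k₂ f g f-eigen g-eigen a b F G a₁≈1 b₁≈1 =
  conclude (smallPrimeNonDivisor N 1≤N)
  where
  open EigenformComparison R
  open PrimeNonDivisors using (smallPrimeNonDivisor)
  conclude : (∃ λ m → Prime (2 ℕ.+ m) × (2 ℕ.+ m ∤ N) × 3 ℕ.^ m ℕ.≤ N ℕ.* N) →
             ∃ λ n → 1 ℕ.≤ n × (fromℕ n ≤ fromℕ 4 * (logN + 1#) ^ʳ 2) × ¬ (a n ≈ᶜ b n)
  conclude (m , pp , p∤N , 3^m≤N²) =
    bounded-witness π isPi N k₁ k₂ k₁≢k₂ f g f-eigen g-eigen a b F G a₁≈1 b₁≈1 (2 ℕ.+ m)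
      (square-bound m logN (log-lower N logN isLog m 3^m≤N²))
      (differ-at-prime-or-square π isPi N k₁ k₂ k₁≢k₂ f g f-eigen g-eigen a b F G a₁≈1 b₁≈1 m pp p∤N)
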